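{- Let $\epsilon_1>0$ be a constant such that for all integers $d\ge 0$, $n\ge d+1$ and all $h:\mathbb{F}_2^n\to\mathbb{F}_2$ one has $\Pr[T_{\mathrm{GN}}^h\text{ rejects}]\ge\min\{2^d\delta_d(h),\epsilon_1\}$. Then for all integers $d\ge 0$, $n\ge 1$, $t\ge 1$ and every $f:\mathbb{F}_2^n\to\mathbb{F}_2$, $$\delta_d(f^{\oplus t})\ \ge\ \frac{1-\left(1-2\min\{\epsilon_1/4,\ 2^{d-2}\cdot\delta_d(f)\}\right)^{t/2^d}}{2}.$$ In particular, if $\delta_d(f)\ge 0.1$, then $\delta_d(f^{\oplus t})\ge \frac12-2^{ -\Omega(t/2^d)}$, where the implied constant in $\Omega$ is a positive constant independent of $d,n,t,f$.
   Context: Every function $f:\mathbb{F}_2^n\to\mathbb{F}_2$ is uniquely a multilinear polynomial over $\mathbb{F}_2$; $\deg f$ is its degree. $\delta_d(f)=\min\{\Pr_{x\in\mathbb{F}_2^n}[f(x)\ne g(x)] : g:\mathbb{F}_2^n\to\mathbb{F}_2,\ \deg g\le d\}$, with $x$ uniform. The test $T_{\mathrm{GN}}^h$ (with degree parameter $d$) picks a uniformly random $(d+1)$-dimensional affine subspace $A\subseteq\mathbb{F}_2^n$ and accepts if and only if $h|_A$ (viewed as a function on $\mathbb{F}_2^{d+1}$ through any affine parametrization of $A$) has degree at most $d$; otherwise it rejects. A constant $\epsilon_1$ with the stated property exists (it is a theorem of the same paper). For $f:\mathbb{F}_2^n\to\mathbb{F}_2$, the $t$-wise XOR $f^{\oplus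 t}:(\mathbb{F}_2^n)^t\to\mathbb{F}_2$ is $f^{\oplus t}(x_1,\dots,x_t)=\sum_{i=1}^t f(x_i)$; it is a function on $\mathbb{F}_2^{nt}$, and $\delta_d(f^{\oplus t})$ is its distance to polynomials of degree at most $d$ in $nt$ variables. -}

module Defs where

open import Algebra.Definitions.RawSemiring as RawExp using ()
open import Data.Bool using (Bool; true; false; _∧_; _xor_)
import Data.Bool.Properties as Bool
open import Data.Fin.Subset using (Subset; inside; outside; ∣_∣)
open import Data.Integer using (+_; +[1+_]; -[1+_])
import Data.Integer as ℤ
import Data.Integer.Properties as ℤ
open import Data.List.Base using (List; []; _∷_; length; map; foldr; filter; cartesianProductWith)
open import Data.List.Membership.Propositional using (_∈_; lose; find)
open import Data.List.Membership.Propositional.Properties using (∈-cartesianProductWith⁺)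
open import Data.List.Properties using (map-cong)
open import Data.List.Relation.Unary.Any using (Any; here; there; any?)
open import Data.Nat using (ℕ; zero; suc; NonZero)
import Data.Nat as ℕ
import Data.Nat.Properties as ℕ
open import Data.Product using (∃; ∃-syntax; _×_; _,_; proj₁; proj₂)
open import Data.Rational
  using (ℚ; mkℚ; 0ℚ; 1ℚ; ½; _<_; _≤_; _+_; _-_; _*_; -_; 1/_; _÷_; _/_; _⊓_; Positive; toℚᵘ
        ; positive; nonNegative; +-*-rawSemiring)
import Data.Rational.Properties as ℚ
open import Data.Rational.Solver using (module +-*-Solver)
import Data.Rational.Unnormalised as ℚᵘ
import Data.Rational.Unnormalised.Properties as ℚᵘ
open import Data.Sum using (_⊎_; inj₁; inj₂)
import Data.Sum as Sum
open import Data.Vec.Base using (Vec; []; _∷_; take; drop; replicate; zipWith)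
import Data.Vec.Base as Vec
open import Data.Vec.Properties using (≡-dec)
open import Function using (_∘_; _⇔_; mk⇔; Equivalence)
open import Relation.Binary using (tri<; tri≈; tri>)
open import Relation.Binary.PropositionalEquality
open import Relation.Nullary
open import Relation.Unary using (Decidable)

open RawExp +-*-rawSemiring public using () renaming (_^_ to _^ℚ_)

0≤1 : 0ℚ ≤ 1ℚ
0≤1 = ℚ.nonNegative⁻¹ 1ℚ

0<1 : 0ℚ < 1ℚ
0<1 = ℚ.positive⁻¹ 1ℚ

<⇒≱ : ∀ {p q} → p < q → ¬ q ≤ p
<⇒≱ p<q q≤p = ℚ.<-irrefl refl (ℚ.<-≤-trans p<q q≤p)

*-monoˡ : ∀ {p q r} → 0ℚ ≤ r → p ≤ q → p * r ≤ q * r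
*-monoˡ {r = r} 0≤r = ℚ.*-monoʳ-≤-nonNeg r {{nonNegative 0≤r}}

*-monoʳ : ∀ {p q r} → 0ℚ ≤ r → p ≤ q → r * p ≤ r * q
*-monoʳ {r = r} 0≤r = ℚ.*-monoˡ-≤-nonNeg r {{nonNegative 0≤r}}

*-nonneg : ∀ {p q} → 0ℚ ≤ p → 0ℚ ≤ q → 0ℚ ≤ p * q
*-nonneg {p} {q} 0≤p 0≤q = subst (_≤ p * q) (ℚ.*-zeroˡ q) (*-monoˡ 0≤q 0≤p)

*-pos : ∀ {p q} → 0ℚ < p → 0ℚ < q → 0ℚ < p * q
*-pos {p} {q} 0<p 0<q =
  subst (_< p * q) (ℚ.*-zeroˡ q) (ℚ.*-monoˡ-<-pos q {{positive 0<q}} 0<p)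

+-nonneg : ∀ {p q} → 0ℚ ≤ p → 0ℚ ≤ q → 0ℚ ≤ p + q
+-nonneg = ℚ.+-mono-≤

p≤p+q : ∀ p {q} → 0ℚ ≤ q → p ≤ p + q
p≤p+q p {q} 0≤q = subst (_≤ p + q) (ℚ.+-identityʳ p) (ℚ.+-monoʳ-≤ p 0≤q)

p<p+q : ∀ p {q} → 0ℚ < q → p < p + q
p<p+q p {q} 0<q = subst (_< p + q) (ℚ.+-identityʳ p) (ℚ.+-monoʳ-< p 0<q)

q≤p+q : ∀ {p} q → 0ℚ ≤ p → q ≤ p + q
q≤p+q {p} q 0≤p = subst (_≤ p + q) (ℚ.+-identityˡ q) (ℚ.+-monoˡ-≤ q 0≤p)

q-p>0 : ∀ {p q} → p < q → 0ℚ < q - p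
q-p>0 {p} {q} p<q = subst (_< q - p) (ℚ.+-inverseʳ p) (ℚ.+-monoˡ-< (- p) p<q)

p+[q-p]≡q : ∀ p q → p + (q - p) ≡ q
p+[q-p]≡q = solve 2 (λ p q → p :+ (q :- p) := q) refl
  where open +-*-Solver

p-[p-q]≡q : ∀ p q → p - (p - q) ≡ q
p-[p-q]≡q = solve 2 (λ p q → p :- (p :- q) := q) refl
  where open +-*-Solver

^-nonneg : ∀ n {p} → 0ℚ ≤ p → 0ℚ ≤ p ^ℚ n
^-nonneg zero    _   = 0≤1
^-nonneg (suc n) 0≤p = *-nonneg 0≤p (^-nonneg n 0≤p)

^-mono-≤ : ∀ n {p q} → 0ℚ ≤ p → p ≤ q → p ^ℚ n ≤ q ^ℚ n
^-mono-≤ zero    _   _   = ℚ.≤-refl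
^-mono-≤ (suc n) 0≤p p≤q = ℚ.≤-trans
  (*-monoˡ (^-nonneg n 0≤p) p≤q) (*-monoʳ (ℚ.≤-trans 0≤p p≤q) (^-mono-≤ n 0≤p p≤q))

^-cancel-< : ∀ n {p q} → 0ℚ ≤ q → p ^ℚ n < q ^ℚ n → p < q
^-cancel-< n {p} {q} 0≤q pⁿ<qⁿ with ℚ.≤-total q p
... | inj₁ q≤p = contradiction (^-mono-≤ n 0≤q q≤p) (<⇒≱ pⁿ<qⁿ)
... | inj₂ p≤q with ℚ.<-cmp p q
...   | tri< p<q _ _ = p<q
...   | tri≈ _ refl _ = contradiction pⁿ<qⁿ (ℚ.<-irrefl refl)
...   | tri> _ _ q<p = contradiction p≤q (<⇒≱ q<p)

1≤^ : ∀ n {p} → 1ℚ ≤ p → 1ℚ ≤ p ^ℚ n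
1≤^ zero    _   = ℚ.≤-refl
1≤^ (suc n) {p} 1≤p = ℚ.≤-trans (subst (1ℚ ≤_) (sym (ℚ.*-identityʳ p)) 1≤p)
  (*-monoʳ (ℚ.≤-trans 0≤1 1≤p) (1≤^ n 1≤p))

≤^ : ∀ n {p} → 1ℚ ≤ p → p ≤ p ^ℚ suc n
≤^ n {p} 1≤p = subst (_≤ p ^ℚ suc n) (ℚ.*-identityʳ p)
  (*-monoʳ (ℚ.≤-trans 0≤1 1≤p) (1≤^ n 1≤p))

^-mono-< : ∀ n {p q} → 0ℚ ≤ p → p < q → p ^ℚ suc n < q ^ℚ suc n
^-mono-< zero {p} {q} _ p<q =
  subst₂ _<_ (sym (ℚ.*-identityʳ p)) (sym (ℚ.*-identityʳ q)) p<q
^-mono-< (suc n) {p} {q} 0≤p p<q = ℚ.≤-<-trans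
  (*-monoˡ (^-nonneg (suc n) 0≤p) (ℚ.<⇒≤ p<q))
  (ℚ.*-monoʳ-<-pos q {{positive (ℚ.≤-<-trans 0≤p p<q)}} (^-mono-< n 0≤p p<q))

slope : ℚ → ℕ → ℚ
slope m zero    = 0ℚ
slope m (suc n) = (m + 1ℚ) ^ℚ n + m * slope m n

slope-nonneg : ∀ n {m} → 0ℚ ≤ m → 0ℚ ≤ slope m n
slope-nonneg zero    _   = ℚ.≤-refl
slope-nonneg (suc n) 0≤m =
  +-nonneg (^-nonneg n (+-nonneg 0≤m 0≤1)) (*-nonneg 0≤m (slope-nonneg n 0≤m))

^-step : ∀ n {m s h} → 0ℚ ≤ s → s ≤ m → 0ℚ ≤ h → h ≤ 1ℚ →
         (s + h) ^ℚ n ≤ s ^ℚ n + h * slope m n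
^-step zero {h = h} _ _ _ _ =
  ℚ.≤-reflexive (sym (trans (cong (λ z → 1ℚ + z) (ℚ.*-zeroʳ h)) (ℚ.+-identityʳ 1ℚ)))
^-step (suc n) {m} {s} {h} 0≤s s≤m 0≤h h≤1 = begin
  (s + h) * (s + h) ^ℚ n                        ≡⟨ ℚ.*-distribʳ-+ _ s h ⟩
  s * (s + h) ^ℚ n + h * (s + h) ^ℚ n           ≤⟨ ℚ.+-mono-≤ first second ⟩
  (s * s ^ℚ n + h * (m * c)) + h * (m + 1ℚ) ^ℚ n ≡⟨ rearrange (s * s ^ℚ n) h (m * c) _ ⟩
  s * s ^ℚ n + h * ((m + 1ℚ) ^ℚ n + m * c)      ∎
  where
  open ℚ.≤-Reasoning
  open +-*-Solver
  c = slope m n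
  rearrange : ∀ a b d e → (a + b * d) + b * e ≡ a + b * (e + d)
  rearrange = solve 4 (λ a b d e → (a :+ b :* d) :+ b :* e := a :+ b :* (e :+ d)) refl
  swap : ∀ a b d e → a * (b + d * e) ≡ a * b + d * (a * e)
  swap = solve 4 (λ a b d e → a :* (b :+ d :* e) := a :* b :+ d :* (a :* e)) refl
  first : s * (s + h) ^ℚ n ≤ s * s ^ℚ n + h * (m * c)
  first = begin
    s * (s + h) ^ℚ n             ≤⟨ *-monoʳ 0≤s (^-step n 0≤s s≤m 0≤h h≤1) ⟩
    s * (s ^ℚ n + h * c)         ≡⟨ swap s (s ^ℚ n) h c ⟩
    s * s ^ℚ n + h * (s * c)     ≤⟨ ℚ.+-monoʳ-≤ (s * s ^ℚ n) (*-monoʳ 0≤h (*-monoˡ c≥0 s≤m)) ⟩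
    s * s ^ℚ n + h * (m * c)     ∎
    where c≥0 = slope-nonneg n (ℚ.≤-trans 0≤s s≤m)
  second : h * (s + h) ^ℚ n ≤ h * (m + 1ℚ) ^ℚ n
  second = *-monoʳ 0≤h (^-mono-≤ n (+-nonneg 0≤s 0≤h) (ℚ.+-mono-≤ s≤m h≤1))

grid : ℚ → ℕ → ℚ
grid h zero    = 0ℚ
grid h (suc k) = grid h k + h

grid-nonneg : ∀ {h} → 0ℚ ≤ h → ∀ k → 0ℚ ≤ grid h k
grid-nonneg 0≤h zero    = ℚ.≤-refl
grid-nonneg 0≤h (suc k) = +-nonneg (grid-nonneg 0≤h k) 0≤h

grid-1 : ∀ k → toℚᵘ (grid 1ℚ k) ℚᵘ.≃ ℚᵘ.mkℚᵘ (+ k) 0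
grid-1 zero    = ℚᵘ.≃-refl
grid-1 (suc k) = ℚᵘ.≃-trans (ℚ.toℚᵘ-homo-+ (grid 1ℚ k) 1ℚ)
  (ℚᵘ.≃-trans (ℚᵘ.+-congˡ (toℚᵘ 1ℚ) (grid-1 k))
    (ℚᵘ.*≡* (cong (ℤ._* + 1) (trans (cong (ℤ._+ + 1) (ℤ.*-identityʳ (+ k)))
                                     (cong +_ (ℕ.+-comm k 1))))))

grid-scale : ∀ h k → grid h k ≡ grid 1ℚ k * h
grid-scale h zero    = sym (ℚ.*-zeroˡ h)
grid-scale h (suc k) = trans (cong (_+ h) (grid-scale h k))
  (solve 2 (λ g h → g :* h :+ h := (g :+ con 1ℚ) :* h) refl (grid 1ℚ k) h)
  where open +-*-Solver

archimedean : ∀ p → ∃[ k ] p ≤ grid 1ℚ k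
archimedean p@(mkℚ n d _) = ℤ.∣ n ∣ , ℚ.toℚᵘ-cancel-≤ (ℚᵘ.≤-respʳ-≃
  (ℚᵘ.≃-sym (grid-1 ℤ.∣ n ∣)) (ℚᵘ.*≤* (ineq n)))
  where
  ineq : ∀ n → n ℤ.* + 1 ℤ.≤ + ℤ.∣ n ∣ ℤ.* + suc d
  ineq (+ n) = subst₂ ℤ._≤_ (sym (ℤ.*-identityʳ (+ n))) (ℤ.pos-* n (suc d))
                 (ℤ.+≤+ (ℕ.m≤m*n n (suc d)))
  ineq -[1+ n ] = subst (ℤ._≤ + suc n ℤ.* + suc d) (sym (ℤ.*-identityʳ -[1+ n ])) ℤ.-≤+

1/-pos : ∀ p (0<p : 0ℚ < p) → ∃[ w ] 0ℚ < w × w * p ≡ 1ℚ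
1/-pos p 0<p = 1/ p , ℚ.positive⁻¹ (1/ p) {{ℚ.1/pos⇒pos p}} , ℚ.*-inverseˡ p
  where instance
    pos = positive 0<p
    nz  = ℚ.pos⇒nonZero p

grid-unbounded : ∀ {h} → 0ℚ < h → ∀ m → ∃[ k ] m ≤ grid h k
grid-unbounded {h} 0<h m =
  let w , _ , wh≡1 = 1/-pos h 0<h
      k , mw≤k     = archimedean (m * w)
      m≡mwh        = trans (sym (ℚ.*-identityʳ m))
                       (trans (cong (m *_) (sym wh≡1)) (sym (ℚ.*-assoc m w h)))
  in  k , subst₂ _≤_ (sym m≡mwh) (sym (grid-scale h k)) (*-monoˡ (ℚ.<⇒≤ 0<h) mw≤k)

crossing : ∀ (s : ℕ → ℚ) u → s 0 ≤ u → ∀ k → u < s k → ∃[ j ] (s j ≤ u × u < s (suc j))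
crossing s u s₀≤u zero    u<s₀ = contradiction s₀≤u (<⇒≱ u<s₀)
crossing s u s₀≤u (suc k) u<s with ℚ._<?_ u (s k)
... | yes u<sₖ = crossing s u s₀≤u k u<sₖ
... | no  u≮sₖ = k , ℚ.≮⇒≥ u≮sₖ , u<s

^-dense : ∀ n {u v} → 0ℚ ≤ u → u < v → ∃[ s ] 0ℚ ≤ s × u < s ^ℚ suc n × s ^ℚ suc n < v
^-dense n {u} {v} 0≤u u<v = grid h (suc j) , grid-nonneg 0≤h (suc j) , u<next , next<v
  where
  open ℚ.≤-Reasoning
  e = v - u
  0<e = q-p>0 u<v
  0≤v = ℚ.<⇒≤ (ℚ.≤-<-trans 0≤u u<v)
  m = v + 1ℚ
  0≤m = +-nonneg 0≤v 0≤1
  1≤m = q≤p+q 1ℚ 0≤v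
  c = slope m (suc n)
  0≤c = slope-nonneg (suc n) 0≤m
  D = e + (c + 1ℚ)
  0<c+1 = ℚ.≤-<-trans 0≤c (p<p+q c 0<1)
  0<D = ℚ.<-trans 0<e (p<p+q e 0<c+1)
  w = proj₁ (1/-pos D 0<D)
  0<w = proj₁ (proj₂ (1/-pos D 0<D))
  h = e * w
  0<h = *-pos 0<e 0<w
  0≤h = ℚ.<⇒≤ 0<h
  hD≡e : h * D ≡ e
  hD≡e = trans (ℚ.*-assoc e w D)
    (trans (cong (e *_) (proj₂ (proj₂ (1/-pos D 0<D)))) (ℚ.*-identityʳ e))
  h≤1 : h ≤ 1ℚ
  h≤1 = ℚ.*-cancelʳ-≤-pos D {{positive 0<D}} (begin
    h * D   ≡⟨ hD≡e ⟩
    e       ≤⟨ p≤p+q e (ℚ.<⇒≤ 0<c+1) ⟩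
    D       ≡⟨ ℚ.*-identityˡ D ⟨
    1ℚ * D  ∎)
  hc<e : h * c < e
  hc<e = begin-strict
    h * c  <⟨ ℚ.*-monoʳ-<-pos h {{positive 0<h}}
                (ℚ.<-≤-trans (p<p+q c 0<1) (q≤p+q (c + 1ℚ) (ℚ.<⇒≤ 0<e))) ⟩
    h * D  ≡⟨ hD≡e ⟩
    e      ∎
  s : ℕ → ℚ
  s k = grid h k ^ℚ suc n
  k = proj₁ (grid-unbounded 0<h m)
  m≤sₖ = proj₂ (grid-unbounded 0<h m)
  u<sₖ : u < s k
  u<sₖ = begin-strict
    u           <⟨ u<v ⟩
    v           <⟨ p<p+q v 0<1 ⟩
    m           ≤⟨ ≤^ n 1≤m ⟩
    m ^ℚ suc n  ≤⟨ ^-mono-≤ (suc n) 0≤m m≤sₖ ⟩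
    s k         ∎
  s₀≤u : s 0 ≤ u
  s₀≤u = subst (_≤ u) (sym (ℚ.*-zeroˡ (0ℚ ^ℚ n))) 0≤u
  found = crossing s u s₀≤u k u<sₖ
  j = proj₁ found
  sⱼ≤u = proj₁ (proj₂ found)
  u<next = proj₂ (proj₂ found)
  gⱼ≤m : grid h j ≤ m
  gⱼ≤m = ℚ.<⇒≤ (^-cancel-< (suc n) 0≤m (begin-strict
    s j         ≤⟨ sⱼ≤u ⟩
    u           <⟨ u<v ⟩
    v           <⟨ p<p+q v 0<1 ⟩
    m           ≤⟨ ≤^ n 1≤m ⟩
    m ^ℚ suc n  ∎))
  next<v : s (suc j) < v
  next<v = begin-strict
    s (suc j)    ≤⟨ ^-step (suc n) (grid-nonneg 0≤h j) gⱼ≤m 0≤h h≤1 ⟩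
    s j + h * c  ≤⟨ ℚ.+-monoˡ-≤ (h * c) sⱼ≤u ⟩
    u + h * c    <⟨ ℚ.+-monoʳ-< u hc<e ⟩
    u + e        ≡⟨ p+[q-p]≡q u v ⟩
    v            ∎

-- Two-sided Dedekind cuts.
record ℝ : Set₁ where
  field
    L U         : ℚ → Set
    L-inhabited : ∃[ q ] L q
    U-inhabited : ∃[ q ] U q
    L-open      : ∀ {q} → L q → ∃[ r ] q < r × L r
    U-open      : ∀ {q} → U q → ∃[ r ] r < q × U r
    L-down      : ∀ {q r} → q < r → L r → L q
    U-up        : ∀ {q r} → q < r → U q → U r
    disjoint    : ∀ {q} → L q → ¬ U q
    located     : ∀ {q r} → q < r → L q ⊎ U r

open ℝ

infix 4 _≤ℝ_ _<ℝ_
_≤ℝ_ : ℝ → ℝ → Set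
x ≤ℝ y = ∀ {q} → L x q → L y q

_<ℝ_ : ℝ → ℝ → Set
x <ℝ y = ∃[ q ] U x q × L y q

fromℚ : ℚ → ℝ
fromℚ p .L q = q < p
fromℚ p .U q = p < q
fromℚ p .L-inhabited = p - 1ℚ , subst (p - 1ℚ <_) (ℚ.+-identityʳ p)
  (ℚ.+-monoʳ-< p (ℚ.negative⁻¹ (- 1ℚ)))
fromℚ p .U-inhabited = p + 1ℚ , p<p+q p 0<1
fromℚ p .L-open q<p = let r , q<r , r<p = ℚ.<-dense q<p in r , q<r , r<p
fromℚ p .U-open p<q = let r , p<r , r<q = ℚ.<-dense p<q in r , r<q , p<r
fromℚ p .L-down = ℚ.<-trans
fromℚ p .U-up q<r p<q = ℚ.<-trans p<q q<r
fromℚ p .disjoint = ℚ.<-asym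
fromℚ p .located {q} q<r with ℚ._<?_ q p
... | yes q<p = inj₁ q<p
... | no  q≮p = inj₂ (ℚ.≤-<-trans (ℚ.≮⇒≥ q≮p) q<r)

infixl 7 _⊓ℝ_
_⊓ℝ_ : ℝ → ℝ → ℝ
(x ⊓ℝ y) .L q = L x q × L y q
(x ⊓ℝ y) .U q = U x q ⊎ U y q
(x ⊓ℝ y) .L-inhabited with L-inhabited x | L-inhabited y
... | q , q∈x | r , r∈y with ℚ.<-cmp q r
...   | tri< q<r _ _ = q , q∈x , L-down y q<r r∈y
...   | tri≈ _ refl _ = q , q∈x , r∈y
...   | tri> _ _ r<q = r , L-down x r<q q∈x , r∈y
(x ⊓ℝ y) .U-inhabited = let q , q∈x = U-inhabited x in q , inj₁ q∈x
(x ⊓ℝ y) .L-open (q∈x , q∈y) with L-open x q∈x | L-open y q∈y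
... | r , q<r , r∈x | s , q<s , s∈y with ℚ.<-cmp r s
...   | tri< r<s _ _ = r , q<r , r∈x , L-down y r<s s∈y
...   | tri≈ _ refl _ = r , q<r , r∈x , s∈y
...   | tri> _ _ s<r = s , q<s , L-down x s<r r∈x , s∈y
(x ⊓ℝ y) .U-open (inj₁ q∈x) = let r , r<q , r∈x = U-open x q∈x in r , r<q , inj₁ r∈x
(x ⊓ℝ y) .U-open (inj₂ q∈y) = let r , r<q , r∈y = U-open y q∈y in r , r<q , inj₂ r∈y
(x ⊓ℝ y) .L-down q<r (r∈x , r∈y) = L-down x q<r r∈x , L-down y q<r r∈y
(x ⊓ℝ y) .U-up q<r = Sum.map (U-up x q<r) (U-up y q<r)
(x ⊓ℝ y) .disjoint (q∈Lx , _) (inj₁ q∈Ux) = disjoint x q∈Lx q∈Ux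
(x ⊓ℝ y) .disjoint (_ , q∈Ly) (inj₂ q∈Uy) = disjoint y q∈Ly q∈Uy
(x ⊓ℝ y) .located q<r with located x q<r | located y q<r
... | inj₁ q∈x | inj₁ q∈y = inj₁ (q∈x , q∈y)
... | inj₂ r∈x | _        = inj₂ (inj₁ r∈x)
... | inj₁ _   | inj₂ r∈y = inj₂ (inj₂ r∈y)

-‿anti : ∀ p {q r} → q < r → p - r < p - q
-‿anti p q<r = ℚ.+-monoʳ-< p (ℚ.neg-antimono-< q<r)

infixl 6 _⊖_
_⊖_ : ℚ → ℝ → ℝ
(p ⊖ x) .L q = U x (p - q)
(p ⊖ x) .U q = L x (p - q)
(p ⊖ x) .L-inhabited = let q , q∈x = U-inhabited x in p - q , subst (U x) (sym (p-[p-q]≡q p q)) q∈x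
(p ⊖ x) .U-inhabited = let q , q∈x = L-inhabited x in p - q , subst (L x) (sym (p-[p-q]≡q p q)) q∈x
(p ⊖ x) .L-open {q} q∈ = let r , r<p-q , r∈x = U-open x q∈ in
  p - r , subst (_< p - r) (p-[p-q]≡q p q) (-‿anti p r<p-q) , subst (U x) (sym (p-[p-q]≡q p r)) r∈x
(p ⊖ x) .U-open {q} q∈ = let r , p-q<r , r∈x = L-open x q∈ in
  p - r , subst (p - r <_) (p-[p-q]≡q p q) (-‿anti p p-q<r) , subst (L x) (sym (p-[p-q]≡q p r)) r∈x
(p ⊖ x) .L-down q<r = U-up x (-‿anti p q<r)
(p ⊖ x) .U-up q<r = L-down x (-‿anti p q<r)
(p ⊖ x) .disjoint q∈L q∈U = disjoint x q∈U q∈L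
(p ⊖ x) .located q<r = Sum.swap (located x (-‿anti p q<r))

infixl 7 _·_
_·_ : (c : ℚ) .{{_ : Positive c}} → ℝ → ℝ
c · x = cx
  where
  instance
    c≢0 = ℚ.pos⇒nonZero c
    1/c>0 = ℚ.1/pos⇒pos c
  ÷-mono : ∀ {q r} → q < r → q ÷ c < r ÷ c
  ÷-mono = ℚ.*-monoˡ-<-pos (1/ c)
  *c÷c : ∀ q → q * c ÷ c ≡ q
  *c÷c q = trans (ℚ.*-assoc q c (1/ c)) (trans (cong (q *_) (ℚ.*-inverseʳ c)) (ℚ.*-identityʳ q))
  ÷c*c : ∀ q → (q ÷ c) * c ≡ q
  ÷c*c q = trans (ℚ.*-assoc q (1/ c) c) (trans (cong (q *_) (ℚ.*-inverseˡ c)) (ℚ.*-identityʳ q))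
  cx : ℝ
  cx .L q = L x (q ÷ c)
  cx .U q = U x (q ÷ c)
  cx .L-inhabited = let q , q∈x = L-inhabited x in q * c , subst (L x) (sym (*c÷c q)) q∈x
  cx .U-inhabited = let q , q∈x = U-inhabited x in q * c , subst (U x) (sym (*c÷c q)) q∈x
  cx .L-open {q} q∈ = let r , q<r , r∈x = L-open x q∈ in
    r * c , subst (_< r * c) (÷c*c q) (ℚ.*-monoˡ-<-pos c q<r) , subst (L x) (sym (*c÷c r)) r∈x
  cx .U-open {q} q∈ = let r , r<q , r∈x = U-open x q∈ in
    r * c , subst (r * c <_) (÷c*c q) (ℚ.*-monoˡ-<-pos c r<q) , subst (U x) (sym (*c÷c r)) r∈x
  cx .L-down q<r = L-down x (÷-mono q<r)
  cx .U-up q<r = U-up x (÷-mono q<r)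
  cx .disjoint = disjoint x
  cx .located q<r = located x (÷-mono q<r)

max : ∀ p q → ∃[ r ] p ≤ r × q ≤ r
max p q with ℚ.≤-total p q
... | inj₁ p≤q = q , p≤q , ℚ.≤-refl
... | inj₂ q≤p = p , ℚ.≤-refl , q≤p

-- The (b+1)-st root of the (a+1)-st power of max(x , 0).
power : ℝ → ℕ → ℕ → ℝ
power x a b = y
  where
  open ℚ.≤-Reasoning
  y : ℝ
  y .L q = q < 0ℚ ⊎ (∃[ r ] 0ℚ ≤ r × L x r × q ^ℚ suc b < r ^ℚ suc a)
  y .U q = 0ℚ < q × (∃[ r ] 0ℚ ≤ r × U x r × r ^ℚ suc a < q ^ℚ suc b)
  y .L-inhabited = - 1ℚ , inj₁ (ℚ.negative⁻¹ (- 1ℚ))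
  y .U-inhabited =
    let u , u∈x = U-inhabited x
        m , u≤m , 1≤m = max u 1ℚ
        r = m + 1ℚ
        u<r = ℚ.≤-<-trans u≤m (p<p+q m 0<1)
        0≤r = +-nonneg (ℚ.≤-trans 0≤1 1≤m) 0≤1
        rᵃ = r ^ℚ suc a
        0≤rᵃ = ^-nonneg (suc a) 0≤r
        q = rᵃ + 1ℚ
        0<q = ℚ.≤-<-trans 0≤rᵃ (p<p+q rᵃ 0<1)
    in  q , 0<q , r , 0≤r , U-up x u<r u∈x
          , ℚ.<-≤-trans (p<p+q rᵃ 0<1) (≤^ b (q≤p+q 1ℚ 0≤rᵃ))
  y .L-open (inj₁ q<0) = let r , q<r , r<0 = ℚ.<-dense q<0 in r , q<r , inj₁ r<0
  y .L-open {q} (inj₂ (r , 0≤r , r∈x , qᵇ<rᵃ)) with ℚ._<?_ q 0ℚ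
  ... | yes q<0 = let r , q<r , r<0 = ℚ.<-dense q<0 in r , q<r , inj₁ r<0
  ... | no  q≮0 =
    let s , 0≤s , qᵇ<sᵇ , sᵇ<rᵃ = ^-dense b (^-nonneg (suc b) (ℚ.≮⇒≥ q≮0)) qᵇ<rᵃ
    in  s , ^-cancel-< (suc b) 0≤s qᵇ<sᵇ , inj₂ (r , 0≤r , r∈x , sᵇ<rᵃ)
  y .U-open {q} (0<q , r , 0≤r , r∈x , rᵃ<qᵇ) =
    let s , 0≤s , rᵃ<sᵇ , sᵇ<qᵇ = ^-dense b (^-nonneg (suc a) 0≤r) rᵃ<qᵇ
        0ᵇ<sᵇ = subst (_< s ^ℚ suc b) (sym (ℚ.*-zeroˡ (0ℚ ^ℚ b)))
                  (ℚ.≤-<-trans (^-nonneg (suc a) 0≤r) rᵃ<sᵇ)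
    in  s , ^-cancel-< (suc b) (ℚ.<⇒≤ 0<q) sᵇ<qᵇ
          , ^-cancel-< (suc b) 0≤s 0ᵇ<sᵇ , r , 0≤r , r∈x , rᵃ<sᵇ
  y .L-down q<r (inj₁ r<0) = inj₁ (ℚ.<-trans q<r r<0)
  y .L-down {q} q<r (inj₂ (s , 0≤s , s∈x , rᵇ<sᵃ)) with ℚ._<?_ q 0ℚ
  ... | yes q<0 = inj₁ q<0
  ... | no  q≮0 = inj₂ (s , 0≤s , s∈x ,
    ℚ.≤-<-trans (^-mono-≤ (suc b) (ℚ.≮⇒≥ q≮0) (ℚ.<⇒≤ q<r)) rᵇ<sᵃ)
  y .U-up q<r (0<q , s , 0≤s , s∈x , sᵃ<qᵇ) =
    ℚ.<-trans 0<q q<r , s , 0≤s , s∈x ,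
    ℚ.<-≤-trans sᵃ<qᵇ (^-mono-≤ (suc b) (ℚ.<⇒≤ 0<q) (ℚ.<⇒≤ q<r))
  y .disjoint (inj₁ q<0) (0<q , _) = ℚ.<-asym q<0 0<q
  y .disjoint (inj₂ (r , 0≤r , r∈L , qᵇ<rᵃ)) (_ , s , 0≤s , s∈U , sᵃ<qᵇ) =
    disjoint x r∈L (U-up x (^-cancel-< (suc a) 0≤r (ℚ.<-trans sᵃ<qᵇ qᵇ<rᵃ)) s∈U)
  y .located {p} {q} p<q with ℚ._<?_ p 0ℚ
  ... | yes p<0 = inj₁ (inj₁ p<0)
  ... | no  p≮0 =
    let 0≤p = ℚ.≮⇒≥ p≮0
        pᵇ<qᵇ = ^-mono-< b 0≤p p<q
        0≤pᵇ = ^-nonneg (suc b) 0≤p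
        s , 0≤s , pᵇ<sᵃ , sᵃ<qᵇ = ^-dense a 0≤pᵇ pᵇ<qᵇ
        r , 0≤r , pᵇ<rᵃ , rᵃ<sᵃ = ^-dense a 0≤pᵇ pᵇ<sᵃ
    in  Sum.map (λ r∈x → inj₂ (r , 0≤r , r∈x , pᵇ<rᵃ))
                (λ s∈x → ℚ.≤-<-trans 0≤p p<q , s , 0≤s , s∈x , sᵃ<qᵇ)
                (located x (^-cancel-< (suc a) 0≤s rᵃ<sᵃ))

record ℚ⁺ : Set where
  constructor mkℚ⁺
  field
    value           : ℚ
    .{{isPositive}} : Positive value

open ℚ⁺ public

infixl 7 _*⁺_ _/2^_
_*⁺_ : ℚ⁺ → ℚ⁺ → ℚ⁺
mkℚ⁺ p *⁺ mkℚ⁺ q = mkℚ⁺ (p * q) {{ℚ.pos*pos⇒pos p q}}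

_/2^_ : (t d : ℕ) .{{_ : NonZero t}} → ℚ⁺
t /2^ d = mkℚ⁺ (+ t / 2 ℕ.^ d) {{ℚ.normalize-pos t (2 ℕ.^ d)}}
  where instance _ = ℕ.m^n≢0 2 d

-- Rational powers of non-negative reals; a negative base is replaced by 0.
infixr 8 _^_
_^_ : ℝ → ℚ⁺ → ℝ
x ^ mkℚ⁺ (mkℚ +[1+ a ] b _) = power x a b

Searchable : Set → Set₁
Searchable A = ∀ {P : A → Set} → Decidable P → Dec (∃ P)

search-Bool : Searchable Bool
search-Bool P? = map′ Sum.[ (true ,_) , (false ,_) ]
  (λ { (true , p) → inj₁ p ; (false , p) → inj₂ p }) (P? true ⊎-dec P? false)

search-× : ∀ {A B} → Searchable A → Searchable B → Searchable (A × B)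
search-× s t P? = map′ (λ { (a , b , p) → (a , b) , p }) (λ { ((a , b) , p) → a , b , p })
  (s λ a → t λ b → P? (a , b))

search-Vec : ∀ {A} → Searchable A → ∀ {n} → Searchable (Vec A n)
search-Vec s {zero}  P? = map′ ([] ,_) (λ { ([] , p) → p }) (P? [])
search-Vec s {suc n} P? = map′ (λ { (a , v , p) → a ∷ v , p }) (λ { (a ∷ v , p) → a , v , p })
  (s λ a → search-Vec s λ v → P? (a ∷ v))

all-by : ∀ {A} → Searchable A → {P : A → Set} → Decidable P → Dec (∀ a → P a)
all-by s P? with s (λ a → ¬? (P? a))
... | yes (a , ¬p) = no λ ∀p → ¬p (∀p a)
... | no  ∄¬p      = yes λ a → decidable-stable (P? a) λ ¬p → ∄¬p (a , ¬p)

_⇔-dec_ : {A B : Set} → Dec A → Dec B → Dec (A ⇔ B)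
a? ⇔-dec b? = map′ (λ { (f , g) → mk⇔ f g }) (λ e → Equivalence.to e , Equivalence.from e)
  ((a? →-dec b?) ×-dec (b? →-dec a?))

ratio : ℕ → ℕ → ℚ
ratio m zero    = 0ℚ
ratio m (suc n) = + m / suc n

-- Probability under the uniform distribution on the entries of a list
-- without repetitions; by convention 0 for the empty list.
Pr : {A : Set} {P : A → Set} → List A → Decidable P → ℚ
Pr xs P? = ratio (length (filter P? xs)) (length xs)

-- The field 𝔽₂ is Bool, with addition _xor_ and multiplication _∧_.
𝔽₂^_ : ℕ → Set
𝔽₂^ n = Vec Bool n

bits : List Bool
bits = false ∷ true ∷ []

points : ∀ n → List (𝔽₂^ n)
points zero    = [] ∷ []
points (suc n) = cartesianProductWith _∷_ bits (points n)

glue : ∀ {n} → (𝔽₂^ n → Bool) → (𝔽₂^ n → Bool) → 𝔽₂^ suc n → Bool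
glue f g (false ∷ x) = f x
glue f g (true  ∷ x) = g x

-- Every function 𝔽₂ⁿ → 𝔽₂ occurs exactly once, up to pointwise equality.
functions : ∀ n → List (𝔽₂^ n → Bool)
functions zero    = map (λ b _ → b) bits
functions (suc n) = cartesianProductWith glue (functions n) (functions n)

functions-complete : ∀ {n} (f : 𝔽₂^ n → Bool) → ∃[ g ] g ∈ functions n × g ≗ f
functions-complete {zero} f with f [] in eq
... | false = _ , here refl , λ { [] → sym eq }
... | true  = _ , there (here refl) , λ { [] → sym eq }
functions-complete {suc n} f =
  let g , g∈ , g≗ = functions-complete (λ x → f (false ∷ x))
      h , h∈ , h≗ = functions-complete (λ x → f (true ∷ x))
  in  glue g h , ∈-cartesianProductWith⁺ glue g∈ h∈ , λ { (false ∷ x) → g≗ x ; (true ∷ x) → h≗ x }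

-- A polynomial is the family of its coefficients, indexed by the set of
-- variables of each monomial.
Poly : ℕ → Set
Poly n = Subset n → Bool

monomial : ∀ {n} → Subset n → 𝔽₂^ n → Bool
monomial []            []      = true
monomial (inside  ∷ S) (x ∷ xs) = x ∧ monomial S xs
monomial (outside ∷ S) (x ∷ xs) = monomial S xs

⟦_⟧ : ∀ {n} → Poly n → 𝔽₂^ n → Bool
⟦_⟧ {n} c x = foldr _xor_ false (map (λ S → c S ∧ monomial S x) (points n))

_Represents_ : ∀ {n} → Poly n → (𝔽₂^ n → Bool) → Set
c Represents f = ∀ x → ⟦ c ⟧ x ≡ f x

PolyDeg≤ : ∀ {n} → ℕ → Poly n → Set
PolyDeg≤ d c = ∀ S → c S ≡ true → ∣ S ∣ ℕ.≤ d

Deg≤ : ∀ {n} → ℕ → (𝔽₂^ n → Bool) → Set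
Deg≤ d f = ∃[ c ] c Represents f × PolyDeg≤ d c

⟦⟧-cong : ∀ {n} {c c′ : Poly n} → c ≗ c′ → ⟦ c ⟧ ≗ ⟦ c′ ⟧
⟦⟧-cong {n} c≗ x = cong (foldr _xor_ false)
  (map-cong (λ S → cong (_∧ monomial S x) (c≗ S)) (points n))

deg≤? : ∀ {n} d → Decidable (Deg≤ {n} d)
deg≤? {n} d f = map′ (λ p → let c , _ , q = find p in c , q) from (any? low? (functions n))
  where
  Low : Poly n → Set
  Low c = c Represents f × PolyDeg≤ d c
  low? : Decidable Low
  low? c = all-by (search-Vec search-Bool) (λ x → ⟦ c ⟧ x Bool.≟ f x)
     ×-dec all-by (search-Vec search-Bool) (λ S → (c S Bool.≟ true) →-dec (∣ S ∣ ℕ.≤? d))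
  from : Deg≤ d f → Any Low (functions n)
  from (c , rep , low) = let c′ , c′∈ , c′≗c = functions-complete c in
    lose c′∈ ((λ x → trans (⟦⟧-cong c′≗c x) (rep x)) , λ S e → low S (trans (sym (c′≗c S)) e))

distance : ∀ {n} → (f g : 𝔽₂^ n → Bool) → ℚ
distance {n} f g = Pr (points n) (λ x → ¬? (f x Bool.≟ g x))

-- The minimum is over a non-empty list of numbers ≤ 1, so that starting it at 1
-- has no effect.
δ : ∀ {n} → ℕ → (𝔽₂^ n → Bool) → ℚ
δ {n} d f = foldr _⊓_ 1ℚ (map (distance f) (filter (deg≤? d) (functions n)))

infixl 6 _⊕_
_⊕_ : ∀ {n} → 𝔽₂^ n → 𝔽₂^ n → 𝔽₂^ n
_⊕_ = zipWith _xor_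

𝟎 : ∀ {n} → 𝔽₂^ n
𝟎 = replicate _ false

combination : ∀ {n k} → Vec (𝔽₂^ n) k → 𝔽₂^ k → 𝔽₂^ n
combination []       []      = 𝟎
combination (v ∷ vs) (b ∷ c) = Vec.map (b ∧_) v ⊕ combination vs c

LinearlyIndependent : ∀ {n k} → Vec (𝔽₂^ n) k → Set
LinearlyIndependent vs = ∀ c → combination vs c ≡ 𝟎 → c ≡ 𝟎

-- An affine map 𝔽₂ᵏ → 𝔽₂ⁿ, given by the image of the origin and the
-- linear images of the standard basis vectors.
AffineMap : ℕ → ℕ → Set
AffineMap k n = 𝔽₂^ n × Vec (𝔽₂^ n) k

apply : ∀ {k n} → AffineMap k n → 𝔽₂^ k → 𝔽₂^ n
apply (a , vs) c = a ⊕ combination vs c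

-- The subset A of 𝔽₂ⁿ is given by its indicator function.
_Parametrizes_ : ∀ {k n} → AffineMap k n → (𝔽₂^ n → Bool) → Set
φ Parametrizes A = LinearlyIndependent (proj₂ φ) × (∀ y → A y ≡ true ⇔ (∃[ c ] apply φ c ≡ y))

IsAffineSubspace : ∀ {n} → ℕ → (𝔽₂^ n → Bool) → Set
IsAffineSubspace {n} k A = ∃[ φ ] _Parametrizes_ {k} {n} φ A

search-point : ∀ {n} → Searchable (𝔽₂^ n)
search-point = search-Vec search-Bool

search-affine : ∀ {k n} → Searchable (AffineMap k n)
search-affine = search-× search-point (search-Vec search-point)

_≟ᵛ_ : ∀ {n} (x y : 𝔽₂^ n) → Dec (x ≡ y)
_≟ᵛ_ = ≡-dec Bool._≟_

parametrizes? : ∀ {k n} (φ : AffineMap k n) (A : 𝔽₂^ n → Bool) → Dec (φ Parametrizes A)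
parametrizes? φ A =
  all-by search-point (λ c → (combination (proj₂ φ) c ≟ᵛ 𝟎) →-dec (c ≟ᵛ 𝟎))
  ×-dec
  all-by search-point (λ y → (A y Bool.≟ true) ⇔-dec search-point (λ c → apply φ c ≟ᵛ y))

isAffineSubspace? : ∀ {n} k → Decidable (IsAffineSubspace {n} k)
isAffineSubspace? k A = search-affine (λ φ → parametrizes? φ A)

affineSubspaces : ∀ n k → List (𝔽₂^ n → Bool)
affineSubspaces n k = filter (isAffineSubspace? k) (functions n)

-- All parametrizations of A give the same answer, since they differ by an affine
-- automorphism of 𝔽₂^(d+1).
Accepts : ∀ {n} → ℕ → (𝔽₂^ n → Bool) → (𝔽₂^ n → Bool) → Set
Accepts {n} d h A = ∀ (φ : AffineMap (suc d) n) → φ Parametrizes A → Deg≤ d (h ∘ apply φ)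

accepts? : ∀ {n} d (h : 𝔽₂^ n → Bool) → Decidable (Accepts d h)
accepts? d h A = all-by search-affine (λ φ → parametrizes? φ A →-dec deg≤? d (h ∘ apply φ))

Pr-rejects : ∀ {n} → ℕ → (𝔽₂^ n → Bool) → ℚ
Pr-rejects {n} d h = Pr (affineSubspaces n (suc d)) (λ A → ¬? (accepts? d h A))

-- For d + 1 ≤ n the list of subspaces is non-empty, so the empty-list convention
-- of Pr plays no role here.
TestBound : ℝ → Set
TestBound ε₁ = ∀ d n → suc d ℕ.≤ n → (h : 𝔽₂^ n → Bool) →
  fromℚ (+ (2 ℕ.^ d) / 1 * δ d h) ⊓ℝ ε₁ ≤ℝ fromℚ (Pr-rejects d h)

infixl 8 _^⊕_
_^⊕_ : ∀ {n} → (𝔽₂^ n → Bool) → ∀ t → 𝔽₂^ (t ℕ.* n) → Bool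
_^⊕_     f zero    _ = false
_^⊕_ {n} f (suc t) x = f (take n x) xor (f ^⊕ t) (drop n x)

{-# OPTIONS --safe #-}
module Submission where

open import Defs using (ℝ; fromℚ; _≤ℝ_; _<ℝ_; _⊓ℝ_; _⊖_; _·_; ℚ⁺; _*⁺_; _/2^_; _^_; 𝔽₂^_; δ; TestBound; _^⊕_)
open import Data.Bool using (Bool)
open import Data.Integer using (+_)
open import Data.Nat as ℕ using (ℕ; NonZero)
open import Data.Product using (∃; _×_)
open import Data.Rational using (0ℚ; 1ℚ; ½; _≤_; _*_; _/_)

open import Defs using
  ( mkℚ⁺; value; _^ℚ_; ^-nonneg; ^-mono-≤; ^-mono-<; ^-cancel-<; grid; grid-nonneg; grid-unbounded
  ; *-monoˡ; *-monoʳ; *-nonneg; *-pos; +-nonneg; 0≤1; 0<1; <⇒≱; p≤p+q; p<p+q; p+[q-p]≡q; p-[p-q]≡q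
  ; _⊕_; 𝟎; _≟ᵛ_; points; functions; functions-complete; glue; all-by; search-point
  ; monomial; ⟦_⟧; Poly; Deg≤; deg≤?; Pr; distance
  ; AffineMap; apply; combination; LinearlyIndependent; _Parametrizes_; parametrizes?
  ; IsAffineSubspace; isAffineSubspace?; affineSubspaces; Accepts; accepts?; Pr-rejects)
open ℝ
open import Algebra.Bundles using (CommutativeRing)
open import Data.Bool using (true; false; not; _∧_; _xor_)
import Data.Bool.Properties as Bool
open import Data.Fin.Subset using (Subset; inside; outside) renaming (∣_∣ to card; ⊤ to full)
import Data.Fin.Subset.Properties as Subset
open import Data.Integer using (+[1+_])
import Data.Integer as ℤ
import Data.Integer.Properties as ℤ
open import Data.List.Base using (List; []; _∷_; _++_; map; foldr; filter; length)
open import Data.List.Membership.Propositional using (_∈_)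
open import Data.List.Membership.Propositional.Properties using (∈-filter⁺; ∈-map⁺)
open import Data.List.Relation.Unary.All as All using (All; []; _∷_)
open import Data.List.Relation.Unary.All.Properties using (all-filter; map⁺)
open import Data.List.Relation.Unary.AllPairs using ([]; _∷_)
open import Data.List.Relation.Unary.Any using (here; there)
open import Data.List.Relation.Unary.Unique.Setoid using (Unique)
import Data.List.Relation.Unary.Unique.Setoid.Properties as Unique
open import Data.Nat using (zero; suc)
import Data.Nat.Properties as ℕ
open import Data.Product using (∃₂; _,_; proj₁; proj₂)
open import Data.Product.Properties using (≡-dec)
open import Data.Rational using (ℚ; mkℚ; _<_; _+_; _-_; -_; ∣_∣; _⊓_; positive; toℚᵘ)
import Data.Rational.Properties as ℚ
open import Data.Rational.Solver using (module +-*-Solver)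
import Data.Rational.Unnormalised as ℚᵘ
import Data.Rational.Unnormalised.Properties as ℚᵘ
open import Data.Sum as Sum using (_⊎_; inj₁; inj₂)
open import Data.Unit using (⊤; tt)
import Data.Unit.Properties as Unit
open import Data.Vec.Base as Vec using (Vec; []; _∷_; take; drop)
import Data.Vec.Properties as Vec
open import Function using (_∘_; _⇔_; mk⇔; Equivalence)
open import Relation.Binary using (DecidableEquality; Tri; tri<; tri≈; tri>)
open import Relation.Binary.PropositionalEquality
open import Relation.Nullary
open import Relation.Nullary.Decidable using (does-⇔; dec-true; dec-false)
open import Relation.Unary using (Decidable)

open import Algebra.Properties.Semiring.Exp (CommutativeRing.semiring ℚ.+-*-commutativeRing) using (^-homo-*; ^-assocʳ)
open +-*-Solver using (solve; _:=_; _:+_; _:*_; _:-_; :-_; con)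

-- Let bias f be the mean of (-1)^f and D y f the derivative of f in direction y. Applying
-- Cauchy–Schwarz d times gives |bias (f + g)|^(2^d) ≤ N d f whenever deg g ≤ d, where N d f is
-- the mean of |bias| over all d-fold derivatives of f. As N d is multiplicative over independent
-- copies, |bias (f^⊕t + g)| ≤ (N d f)^(t/2^d), and |a| ≤ (1 + a²)/2 gives N d f ≤ 1 - ρ, where ρ is
-- the probability that a random (d+1)-fold derivative of f is 1 at a random point.
--
-- This ρ is the rejection probability of the test with d + 1 uniform directions, so it is at least
-- Pr[T rejects] times the probability that the directions are independent. For n ≥ d + 2 the
-- latter is at least 1/2, whence ρ ≥ 2 min{ε₁/4, 2^(d-2) δ}. For n = d + 1 it is only known to be at
-- least 1/4, but then T rejects with probability 0 or 1 and δ ≤ 2^-(d+1); for n ≤ d, δ = 0.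

-- Means over finite types

-- The bound sought is ρ ≥ ½ min{ε₁, 2^d δ}, and its factor ½ makes small dimensions special. When k
-- directions are drawn in 𝔽₂^n, the last one avoids the span of k - 1 independent others with
-- probability 1 - 2^-(n-k+1). The losses form a geometric series, so all are independent with
-- probability at least 1 - 2^-(n-k). At n = k = d + 1 this says nothing, and the true value falls
-- to about 0.29 as d grows, which is less than ½. The term 1 - ρ arises because one further
-- derivative squares the bias: the squares a² average to 1 - 2ρ, and (1 + (1 - 2ρ))/2 = 1 - ρ. No
-- real analysis is involved. A rational q below the left-hand side unfolds to a rational r above
-- the base of the power, together with an inequality between an integer power of r and one of 1 -
-- 2q. The argument therefore runs over ℚ for each q separately, and ε₁ is seen only through
-- rationals below it.

record IsLinear {A : Set} (M : (A → ℚ) → ℚ) : Set where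
  field
    ≗-cong : ∀ {F G} → F ≗ G → M F ≡ M G
    +-homo : ∀ F G → M (λ a → F a + G a) ≡ M F + M G
    *-homo : ∀ p F → M (λ a → p * F a) ≡ p * M F

  *-homoʳ : ∀ p F → M (λ a → F a * p) ≡ M F * p
  *-homoʳ p F = trans (≗-cong λ a → ℚ.*-comm (F a) p) (trans (*-homo p F) (ℚ.*-comm p (M F)))

𝟙 : Bool → ℚ
𝟙 false = 0ℚ
𝟙 true  = 1ℚ

𝟙-nonneg : ∀ b → 0ℚ ≤ 𝟙 b
𝟙-nonneg false = ℚ.≤-refl
𝟙-nonneg true  = 0≤1

𝟙-∧ : ∀ b c → 𝟙 (b ∧ c) ≡ 𝟙 b * 𝟙 c
𝟙-∧ false c = sym (ℚ.*-zeroˡ (𝟙 c))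
𝟙-∧ true  c = sym (ℚ.*-identityˡ (𝟙 c))

⟪_⟫ : {P : Set} → Dec P → ℚ
⟪ P? ⟫ = 𝟙 (does P?)

⟪⟫-yes : {P : Set} (P? : Dec P) → P → ⟪ P? ⟫ ≡ 1ℚ
⟪⟫-yes P? p = cong 𝟙 (dec-true P? p)

⟪⟫-no : {P : Set} (P? : Dec P) → ¬ P → ⟪ P? ⟫ ≡ 0ℚ
⟪⟫-no P? ¬p = cong 𝟙 (dec-false P? ¬p)

⟪⟫-⇔ : {P Q : Set} (P? : Dec P) (Q? : Dec Q) → P ⇔ Q → ⟪ P? ⟫ ≡ ⟪ Q? ⟫
⟪⟫-⇔ P? Q? e = cong 𝟙 (does-⇔ e P? Q?)

⟪⟫-mono : {P Q : Set} (P? : Dec P) (Q? : Dec Q) → (P → Q) → ⟪ P? ⟫ ≤ ⟪ Q? ⟫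
⟪⟫-mono (no _)  Q? f = 𝟙-nonneg (does Q?)
⟪⟫-mono (yes p) Q? f = ℚ.≤-reflexive (sym (⟪⟫-yes Q? (f p)))

⟪⟫≡0⊎ : {P : Set} (P? : Dec P) → ⟪ P? ⟫ ≡ 0ℚ ⊎ P
⟪⟫≡0⊎ (no _)  = inj₁ refl
⟪⟫≡0⊎ (yes p) = inj₂ p

⟪⟫≤ : {P : Set} (P? : Dec P) {q : ℚ} → 0ℚ ≤ q → (P → 1ℚ ≤ q) → ⟪ P? ⟫ ≤ q
⟪⟫≤ (no _)  0≤q 1≤q = 0≤q
⟪⟫≤ (yes p) 0≤q 1≤q = 1≤q p

does⇒ : {P : Set} (P? : Dec P) → does P? ≡ true → P
does⇒ (yes p) _ = p

⟪⟫*⟪⟫≤ : {P Q : Set} (P? : Dec P) (Q? : Dec Q) {b : Bool} → (P → Q → b ≡ true) → ⟪ P? ⟫ * ⟪ Q? ⟫ ≤ 𝟙 b * ⟪ Q? ⟫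
⟪⟫*⟪⟫≤ P?      (no _)  {b} _ = ℚ.≤-reflexive (trans (ℚ.*-zeroʳ ⟪ P? ⟫) (sym (ℚ.*-zeroʳ (𝟙 b))))
⟪⟫*⟪⟫≤ (no _)  (yes _) {b} _ = *-monoˡ 0≤1 (𝟙-nonneg b)
⟪⟫*⟪⟫≤ (yes p) (yes q)     h = *-monoˡ 0≤1 (ℚ.≤-reflexive (cong 𝟙 (sym (h p q))))

-- The uniform distribution on a finite type. Since fubini allows any linear functional,
-- it also exchanges 𝔼 with sums over lists.
record Mean (A : Set) : Set₁ where
  field
    𝔼        : (A → ℚ) → ℚ
    isLinear : IsLinear 𝔼
    const    : ∀ p → 𝔼 (λ _ → p) ≡ p
    mono     : ∀ {F G} → (∀ a → F a ≤ G a) → 𝔼 F ≤ 𝔼 G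
    fubini   : ∀ {B : Set} {M : (B → ℚ) → ℚ} → IsLinear M → (F : A → B → ℚ) →
               𝔼 (λ a → M (F a)) ≡ M (λ b → 𝔼 (λ a → F a b))
    _≟_      : DecidableEquality A
    mass     : ℚ
    mass>0   : 0ℚ < mass
    point    : ∀ z → 𝔼 (λ a → ⟪ a ≟ z ⟫) ≡ mass

  open IsLinear isLinear public

  affine : ∀ p q F → 𝔼 (λ a → p + q * F a) ≡ p + q * 𝔼 F
  affine p q F = trans (+-homo (λ _ → p) (λ a → q * F a)) (cong₂ _+_ (const p) (*-homo q F))

  nonneg : ∀ {F} → (∀ a → 0ℚ ≤ F a) → 0ℚ ≤ 𝔼 F
  nonneg {F} 0≤F = subst (_≤ 𝔼 F) (const 0ℚ) (mono 0≤F)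

instance
  Bool-mean : Mean Bool
  Bool-mean = record
    { 𝔼        = λ F → ½ * (F false + F true)
    ; isLinear = record
      { ≗-cong = λ F≗G → cong₂ (λ p q → ½ * (p + q)) (F≗G false) (F≗G true)
      ; +-homo = λ F G → solve 5 (λ h a b c d → h :* ((a :+ b) :+ (c :+ d)) := h :* (a :+ c) :+ h :* (b :+ d))
                   refl ½ (F false) (G false) (F true) (G true)
      ; *-homo = λ p F → solve 4 (λ h p a b → h :* (p :* a :+ p :* b) := p :* (h :* (a :+ b)))
                   refl ½ p (F false) (F true)
      }
    ; const    = solve 1 (λ p → con ½ :* (p :+ p) := p) refl
    ; mono     = λ F≤G → *-monoʳ 0≤½ (ℚ.+-mono-≤ (F≤G false) (F≤G true))
    ; fubini   = λ {_} {M} lin F → sym (trans (IsLinear.*-homo lin ½ (λ b → F false b + F true b))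
                   (cong (½ *_) (IsLinear.+-homo lin (F false) (F true))))
    ; _≟_      = Bool._≟_
    ; mass     = ½
    ; mass>0   = ℚ.positive⁻¹ ½
    ; point    = λ { false → refl ; true → refl }
    }
    where
    0≤½ : 0ℚ ≤ ½
    0≤½ = ℚ.nonNegative⁻¹ ½

  ⊤-mean : Mean ⊤
  ⊤-mean = record
    { 𝔼        = λ F → F tt
    ; isLinear = record { ≗-cong = λ F≗G → F≗G tt ; +-homo = λ _ _ → refl ; *-homo = λ _ _ → refl }
    ; const    = λ _ → refl
    ; mono     = λ F≤G → F≤G tt
    ; fubini   = λ _ _ → refl
    ; _≟_      = Unit._≟_
    ; mass     = 1ℚ
    ; mass>0   = 0<1
    ; point    = λ _ → refl
    }

  ×-mean : ∀ {A B} → {{Mean A}} → {{Mean B}} → Mean (A × B)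
  ×-mean {A} {B} {{μ}} {{ν}} = record
    { 𝔼        = λ F → μ.𝔼 λ a → ν.𝔼 λ b → F (a , b)
    ; isLinear = record
      { ≗-cong = λ F≗G → μ.≗-cong λ a → ν.≗-cong λ b → F≗G (a , b)
      ; +-homo = λ F G → trans (μ.≗-cong λ a → ν.+-homo _ _) (μ.+-homo _ _)
      ; *-homo = λ p F → trans (μ.≗-cong λ a → ν.*-homo p _) (μ.*-homo p _)
      }
    ; const    = λ p → trans (μ.≗-cong λ a → ν.const p) (μ.const p)
    ; mono     = λ F≤G → μ.mono λ a → ν.mono λ b → F≤G (a , b)
    ; fubini   = λ lin F → trans (μ.≗-cong λ a → ν.fubini lin λ b → F (a , b)) (μ.fubini lin _)
    ; _≟_      = ≟×
    ; mass     = μ.mass * ν.mass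
    ; mass>0   = *-pos μ.mass>0 ν.mass>0
    ; point    = λ { (a , b) → begin
        μ.𝔼 (λ x → ν.𝔼 λ y → ⟪ ≟× (x , y) (a , b) ⟫)     ≡⟨ μ.≗-cong (λ x → ν.≗-cong λ y → ≟×-∧ x y a b) ⟩
        μ.𝔼 (λ x → ν.𝔼 λ y → ⟪ x μ.≟ a ⟫ * ⟪ y ν.≟ b ⟫)  ≡⟨ μ.≗-cong (λ x → trans (ν.*-homo ⟪ x μ.≟ a ⟫ (λ y → ⟪ y ν.≟ b ⟫))
                                                              (cong (⟪ x μ.≟ a ⟫ *_) (ν.point b))) ⟩
        μ.𝔼 (λ x → ⟪ x μ.≟ a ⟫ * ν.mass)  ≡⟨ μ.*-homoʳ ν.mass (λ x → ⟪ x μ.≟ a ⟫) ⟩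
        μ.𝔼 (λ x → ⟪ x μ.≟ a ⟫) * ν.mass  ≡⟨ cong (_* ν.mass) (μ.point a) ⟩
        μ.mass * ν.mass                   ∎ }
    }
    where
    open ≡-Reasoning
    module μ = Mean μ
    module ν = Mean ν
    ≟× = ≡-dec μ._≟_ ν._≟_
    ≟×-∧ : ∀ x y a b → ⟪ ≟× (x , y) (a , b) ⟫ ≡ ⟪ x μ.≟ a ⟫ * ⟪ y ν.≟ b ⟫
    ≟×-∧ x y a b = trans
      (⟪⟫-⇔ (≟× (x , y) (a , b)) ((x μ.≟ a) ×-dec (y ν.≟ b))
        (mk⇔ (λ { refl → refl , refl }) λ { (refl , refl) → refl }))
      (𝟙-∧ (does (x μ.≟ a)) (does (y ν.≟ b)))

transport : ∀ {A B : Set} (to : A → B) (from : B → A) → (∀ a → from (to a) ≡ a) → (∀ b → to (from b) ≡ b) →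
            Mean A → Mean B
transport to from from∘to to∘from μ = record
  { 𝔼        = λ F → μ.𝔼 (F ∘ to)
  ; isLinear = record
    { ≗-cong = λ F≗G → μ.≗-cong (F≗G ∘ to)
    ; +-homo = λ F G → μ.+-homo (F ∘ to) (G ∘ to)
    ; *-homo = λ p F → μ.*-homo p (F ∘ to)
    }
  ; const    = μ.const
  ; mono     = λ F≤G → μ.mono (F≤G ∘ to)
  ; fubini   = λ lin F → μ.fubini lin (F ∘ to)
  ; _≟_      = _≟ᴮ_
  ; mass     = μ.mass
  ; mass>0   = μ.mass>0
  ; point    = λ z → trans (μ.≗-cong λ a → ⟪⟫-⇔ (to a ≟ᴮ z) (a μ.≟ from z)
      (mk⇔ (λ { refl → sym (from∘to a) }) (λ { refl → to∘from z }))) (μ.point (from z))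
  }
  where
  module μ = Mean μ
  _≟ᴮ_ : DecidableEquality _
  x ≟ᴮ y = map′ (λ e → trans (sym (to∘from x)) (trans (cong to e) (to∘from y))) (cong from)
             (from x μ.≟ from y)

instance
  Vec-mean : ∀ {A n} → {{Mean A}} → Mean (Vec A n)
  Vec-mean {n = zero}  = transport (λ _ → []) (λ _ → tt) (λ _ → refl) (λ { [] → refl }) ⊤-mean
  Vec-mean {n = suc n} {{μ}} = transport (λ { (a , v) → a ∷ v }) (λ { (a ∷ v) → a , v })
    (λ _ → refl) (λ { (_ ∷ _) → refl }) (×-mean {{μ}} {{Vec-mean {{μ}}}})

open Mean {{...}}

mass-point : ∀ n → mass {𝔽₂^ n} ≡ ½ ^ℚ n
mass-point zero    = refl
mass-point (suc n) = cong (½ *_) (mass-point n)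

-- Squares and convexity

p²-nonneg : ∀ p → 0ℚ ≤ p * p
p²-nonneg p with ℚ.≤-total 0ℚ p
... | inj₁ 0≤p = *-nonneg 0≤p 0≤p
... | inj₂ p≤0 = subst (0ℚ ≤_) (solve 1 (λ p → (:- p) :* (:- p) := p :* p) refl p)
                   (*-nonneg (ℚ.neg-antimono-≤ p≤0) (ℚ.neg-antimono-≤ p≤0))

p≤∣p∣ : ∀ p → p ≤ ∣ p ∣
p≤∣p∣ p with ℚ.≤-total 0ℚ p
... | inj₁ 0≤p = ℚ.≤-reflexive (sym (ℚ.0≤p⇒∣p∣≡p 0≤p))
... | inj₂ p≤0 = ℚ.≤-trans p≤0 (ℚ.0≤∣p∣ p)

∣p∣²≡p² : ∀ p → ∣ p ∣ * ∣ p ∣ ≡ p * p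
∣p∣²≡p² p = trans (sym (ℚ.∣p*q∣≡∣p∣*∣q∣ p p)) (ℚ.0≤p⇒∣p∣≡p (p²-nonneg p))

0≤q-p⇒p≤q : ∀ {p q} → 0ℚ ≤ q - p → p ≤ q
0≤q-p⇒p≤q {p} {q} 0≤q-p = subst₂ _≤_ (ℚ.+-identityʳ p) (p+[q-p]≡q p q) (ℚ.+-monoʳ-≤ p 0≤q-p)

^-2^suc : ∀ p d → p ^ℚ (2 ℕ.^ suc d) ≡ (p * p) ^ℚ (2 ℕ.^ d)
^-2^suc p d = trans (sym (^-assocʳ p 2 (2 ℕ.^ d))) (cong (λ q → (p * q) ^ℚ (2 ℕ.^ d)) (ℚ.*-identityʳ p))

module _ {A : Set} {{_ : Mean A}} where

  -- The parabola lies above its tangent at the mean `m`: p² ≥ 2mp - m². Averaging the affine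
  -- right-hand side gives m².
  jensen : (F : A → ℚ) → 𝔼 F * 𝔼 F ≤ 𝔼 (λ a → F a * F a)
  jensen F = begin
    m * m                                ≡⟨ solve 1 (λ m → m :* m := :- (m :* m) :+ (m :+ m) :* m) refl m ⟩
    - (m * m) + (m + m) * m              ≡⟨ affine (- (m * m)) (m + m) F ⟨
    𝔼 (λ a → - (m * m) + (m + m) * F a)  ≤⟨ mono (λ a → 0≤q-p⇒p≤q (subst (0ℚ ≤_) (square (F a) m) (p²-nonneg (F a - m)))) ⟩
    𝔼 (λ a → F a * F a)                  ∎
    where
    open ℚ.≤-Reasoning
    m = 𝔼 F
    square : ∀ p m → (p - m) * (p - m) ≡ p * p - (- (m * m) + (m + m) * p)
    square = solve 2 (λ p m → (p :- m) :* (p :- m) := p :* p :- (:- (m :* m) :+ (m :+ m) :* p)) refl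

  -- The square is peeled off from the inside, so powers are compared only between nonnegative
  -- numbers even when `F` changes sign.
  jensen-2^ : ∀ d (F : A → ℚ) → 𝔼 F ^ℚ (2 ℕ.^ d) ≤ 𝔼 (λ a → F a ^ℚ (2 ℕ.^ d))
  jensen-2^ zero    F = ℚ.≤-reflexive (trans (ℚ.*-identityʳ (𝔼 F)) (≗-cong λ a → sym (ℚ.*-identityʳ (F a))))
  jensen-2^ (suc d) F = begin
    𝔼 F ^ℚ (2 ℕ.^ suc d)                ≡⟨ ^-2^suc (𝔼 F) d ⟩
    (𝔼 F * 𝔼 F) ^ℚ (2 ℕ.^ d)            ≤⟨ ^-mono-≤ (2 ℕ.^ d) (p²-nonneg (𝔼 F)) (jensen F) ⟩
    𝔼 (λ a → F a * F a) ^ℚ (2 ℕ.^ d)    ≤⟨ jensen-2^ d (λ a → F a * F a) ⟩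
    𝔼 (λ a → (F a * F a) ^ℚ (2 ℕ.^ d))  ≡⟨ ≗-cong (λ a → ^-2^suc (F a) d) ⟨
    𝔼 (λ a → F a ^ℚ (2 ℕ.^ suc d))      ∎
    where open ℚ.≤-Reasoning

-- Derivatives and sums of independent copies

⊕-comm : ∀ {n} (x y : 𝔽₂^ n) → x ⊕ y ≡ y ⊕ x
⊕-comm = Vec.zipWith-comm Bool.xor-comm

⊕-assoc : ∀ {n} (x y z : 𝔽₂^ n) → (x ⊕ y) ⊕ z ≡ x ⊕ (y ⊕ z)
⊕-assoc = Vec.zipWith-assoc Bool.xor-assoc

⊕-identityˡ : ∀ {n} (x : 𝔽₂^ n) → 𝟎 ⊕ x ≡ x
⊕-identityˡ = Vec.zipWith-identityˡ Bool.xor-identityˡ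

⊕-identityʳ : ∀ {n} (x : 𝔽₂^ n) → x ⊕ 𝟎 ≡ x
⊕-identityʳ = Vec.zipWith-identityʳ Bool.xor-identityʳ

⊕-same : ∀ {n} (x : 𝔽₂^ n) → x ⊕ x ≡ 𝟎
⊕-same []      = refl
⊕-same (b ∷ x) = cong₂ _∷_ (Bool.xor-same b) (⊕-same x)

⊕-cancelˡ : ∀ {n} (x y : 𝔽₂^ n) → x ⊕ (x ⊕ y) ≡ y
⊕-cancelˡ x y = trans (sym (⊕-assoc x x y)) (trans (cong (_⊕ y) (⊕-same x)) (⊕-identityˡ y))

⊕-interchange : ∀ {n} (x y z w : 𝔽₂^ n) → (x ⊕ y) ⊕ (z ⊕ w) ≡ (x ⊕ z) ⊕ (y ⊕ w)
⊕-interchange x y z w = begin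
  (x ⊕ y) ⊕ (z ⊕ w)  ≡⟨ ⊕-assoc x y (z ⊕ w) ⟩
  x ⊕ (y ⊕ (z ⊕ w))  ≡⟨ cong (x ⊕_) (⊕-assoc y z w) ⟨
  x ⊕ ((y ⊕ z) ⊕ w)  ≡⟨ cong (λ u → x ⊕ (u ⊕ w)) (⊕-comm y z) ⟩
  x ⊕ ((z ⊕ y) ⊕ w)  ≡⟨ cong (x ⊕_) (⊕-assoc z y w) ⟩
  x ⊕ (z ⊕ (y ⊕ w))  ≡⟨ ⊕-assoc x z (y ⊕ w) ⟨
  (x ⊕ z) ⊕ (y ⊕ w)  ∎
  where open ≡-Reasoning

xor-interchange : ∀ a b c d → (a xor b) xor (c xor d) ≡ (a xor c) xor (b xor d)
xor-interchange false b c d = trans (sym (Bool.xor-assoc b c d))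
  (trans (cong (_xor d) (Bool.xor-comm b c)) (Bool.xor-assoc c b d))
xor-interchange true b c d = begin
  not b xor (c xor d)    ≡⟨ Bool.not-distribˡ-xor b (c xor d) ⟨
  not (b xor (c xor d))  ≡⟨ cong not (xor-interchange false b c d) ⟩
  not (c xor (b xor d))  ≡⟨ Bool.not-distribˡ-xor c (b xor d) ⟩
  not c xor (b xor d)    ∎
  where open ≡-Reasoning

𝔼-translate : ∀ {n} (y : 𝔽₂^ n) (F : 𝔽₂^ n → ℚ) → 𝔼 (λ x → F (y ⊕ x)) ≡ 𝔼 F
𝔼-translate []          F = refl
𝔼-translate (false ∷ y) F = ≗-cong λ a → 𝔼-translate y (λ x → F (a ∷ x))
𝔼-translate (true ∷ y)  F = trans
  (cong₂ (λ p q → ½ * (p + q)) (𝔼-translate y (λ x → F (true ∷ x))) (𝔼-translate y (λ x → F (false ∷ x))))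
  (cong (½ *_) (ℚ.+-comm (𝔼 λ x → F (true ∷ x)) (𝔼 λ x → F (false ∷ x))))

χ : Bool → ℚ
χ false = 1ℚ
χ true  = - 1ℚ

χ-xor : ∀ a b → χ (a xor b) ≡ χ a * χ b
χ-xor false b     = sym (ℚ.*-identityˡ (χ b))
χ-xor true  false = refl
χ-xor true  true  = refl

∣χ∣≡1 : ∀ b → ∣ χ b ∣ ≡ 1ℚ
∣χ∣≡1 false = refl
∣χ∣≡1 true  = refl

𝟙≡½-½χ : ∀ b → 𝟙 b ≡ ½ + (- ½) * χ b
𝟙≡½-½χ false = refl
𝟙≡½-½χ true  = refl

bias : ∀ {n} → (𝔽₂^ n → Bool) → ℚ
bias f = 𝔼 (χ ∘ f)

bias-cong : ∀ {n} {f g : 𝔽₂^ n → Bool} → f ≗ g → bias f ≡ bias g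
bias-cong f≗g = ≗-cong λ x → cong χ (f≗g x)

infixl 6 _⊞_
_⊞_ : ∀ {n} → (𝔽₂^ n → Bool) → (𝔽₂^ n → Bool) → 𝔽₂^ n → Bool
(f ⊞ g) x = f x xor g x

D : ∀ {n} → 𝔽₂^ n → (𝔽₂^ n → Bool) → 𝔽₂^ n → Bool
D y f x = f x xor f (x ⊕ y)

D-cong : ∀ {n} (y : 𝔽₂^ n) {f g} → f ≗ g → D y f ≗ D y g
D-cong y f≗g x = cong₂ _xor_ (f≗g x) (f≗g (x ⊕ y))

D-⊞ : ∀ {n} (y : 𝔽₂^ n) f g → D y (f ⊞ g) ≗ D y f ⊞ D y g
D-⊞ y f g x = xor-interchange (f x) (g x) (f (x ⊕ y)) (g (x ⊕ y))

-- The square is a mean over pairs of points. Writing the second point as `x ⊕ y`, a translate of a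
-- uniform variable, turns pairs of points into a point and a direction.
bias²≡𝔼-bias-D : ∀ {n} (f : 𝔽₂^ n → Bool) → bias f * bias f ≡ 𝔼 (λ y → bias (D y f))
bias²≡𝔼-bias-D f = begin
  bias f * bias f                              ≡⟨ *-homoʳ (bias f) (χ ∘ f) ⟨
  𝔼 (λ x → χ (f x) * bias f)                   ≡⟨ ≗-cong (λ x → cong (χ (f x) *_) (𝔼-translate x (χ ∘ f))) ⟨
  𝔼 (λ x → χ (f x) * 𝔼 (λ y → χ (f (x ⊕ y))))  ≡⟨ ≗-cong (λ x → *-homo (χ (f x)) (λ y → χ (f (x ⊕ y)))) ⟨
  𝔼 (λ x → 𝔼 (λ y → χ (f x) * χ (f (x ⊕ y))))  ≡⟨ ≗-cong (λ x → ≗-cong λ y → χ-xor (f x) (f (x ⊕ y))) ⟨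
  𝔼 (λ x → 𝔼 (λ y → χ (D y f x)))              ≡⟨ fubini isLinear (λ x y → χ (D y f x)) ⟩
  𝔼 (λ y → bias (D y f))                       ∎
  where open ≡-Reasoning

-- The 2^(d+1)-th power of the Gowers norm U^(d+1) with the innermost bias² replaced by ∣bias∣;
-- this saves a factor 2 in the exponent t / 2^d of the theorem.
N : ∀ {n} → ℕ → (𝔽₂^ n → Bool) → ℚ
N zero    f = ∣ bias f ∣
N (suc d) f = 𝔼 λ y → N d (D y f)

N-cong : ∀ d {n} {f g : 𝔽₂^ n → Bool} → f ≗ g → N d f ≡ N d g
N-cong zero    f≗g = cong ∣_∣ (bias-cong f≗g)
N-cong (suc d) f≗g = ≗-cong λ y → N-cong d (D-cong y f≗g)

-- The derivative form of degree at most `d`, stopped one derivative before zero: all `d`-fold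
-- derivatives are constant. `Deg≤⇒Flat` leads here from coefficients; in dimension d + 1,
-- `Flat⇒even` and `even⇒Deg≤` lead back.
Flat : ∀ {n} → ℕ → (𝔽₂^ n → Bool) → Set
Flat zero    f = ∀ x y → f x ≡ f y
Flat (suc d) f = ∀ y → Flat d (D y f)

-- Each squaring differentiates `f` and `g` together and uses up one degree of `g`. After `d` rounds
-- `g` is constant and can only change the sign of the bias, which the absolute value in `N zero`
-- absorbs.
∣bias∣^2^d≤N : ∀ d {n} {f g : 𝔽₂^ n → Bool} → Flat d g → ∣ bias (f ⊞ g) ∣ ^ℚ (2 ℕ.^ d) ≤ N d f
∣bias∣^2^d≤N zero {f = f} {g} flat = ℚ.≤-reflexive (begin
  ∣ bias (f ⊞ g) ∣ * 1ℚ               ≡⟨ ℚ.*-identityʳ ∣ bias (f ⊞ g) ∣ ⟩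
  ∣ bias (f ⊞ g) ∣                    ≡⟨ cong ∣_∣ (≗-cong λ x → trans (χ-xor (f x) (g x))
                                           (cong (λ b → χ (f x) * χ b) (flat x 𝟎))) ⟩
  ∣ 𝔼 (λ x → χ (f x) * χ (g 𝟎)) ∣  ≡⟨ cong ∣_∣ (*-homoʳ (χ (g 𝟎)) (χ ∘ f)) ⟩
  ∣ bias f * χ (g 𝟎) ∣             ≡⟨ ℚ.∣p*q∣≡∣p∣*∣q∣ (bias f) (χ (g 𝟎)) ⟩
  ∣ bias f ∣ * ∣ χ (g 𝟎) ∣         ≡⟨ cong (∣ bias f ∣ *_) (∣χ∣≡1 (g 𝟎)) ⟩
  ∣ bias f ∣ * 1ℚ                  ≡⟨ ℚ.*-identityʳ ∣ bias f ∣ ⟩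
  ∣ bias f ∣                       ∎)
  where open ≡-Reasoning
∣bias∣^2^d≤N (suc d) {f = f} {g} flat = begin
  ∣ bias (f ⊞ g) ∣ ^ℚ (2 ℕ.^ suc d)                   ≡⟨ ^-2^suc ∣ bias (f ⊞ g) ∣ d ⟩
  (∣ bias (f ⊞ g) ∣ * ∣ bias (f ⊞ g) ∣) ^ℚ (2 ℕ.^ d)  ≡⟨ cong (_^ℚ (2 ℕ.^ d)) (∣p∣²≡p² (bias (f ⊞ g))) ⟩
  (bias (f ⊞ g) * bias (f ⊞ g)) ^ℚ (2 ℕ.^ d)          ≤⟨ ^-mono-≤ (2 ℕ.^ d) (p²-nonneg (bias (f ⊞ g))) bias²≤ ⟩
  𝔼 (λ y → ∣ bias (D y f ⊞ D y g) ∣) ^ℚ (2 ℕ.^ d)     ≤⟨ jensen-2^ d (λ y → ∣ bias (D y f ⊞ D y g) ∣) ⟩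
  𝔼 (λ y → ∣ bias (D y f ⊞ D y g) ∣ ^ℚ (2 ℕ.^ d))     ≤⟨ mono (λ y → ∣bias∣^2^d≤N d (flat y)) ⟩
  𝔼 (λ y → N d (D y f))                               ∎
  where
  open ℚ.≤-Reasoning
  bias²≤ : bias (f ⊞ g) * bias (f ⊞ g) ≤ 𝔼 (λ y → ∣ bias (D y f ⊞ D y g) ∣)
  bias²≤ = begin
    bias (f ⊞ g) * bias (f ⊞ g)         ≡⟨ bias²≡𝔼-bias-D (f ⊞ g) ⟩
    𝔼 (λ y → bias (D y (f ⊞ g)))        ≡⟨ ≗-cong (λ y → bias-cong (D-⊞ y f g)) ⟩
    𝔼 (λ y → bias (D y f ⊞ D y g))      ≤⟨ mono (λ y → p≤∣p∣ (bias (D y f ⊞ D y g))) ⟩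
    𝔼 (λ y → ∣ bias (D y f ⊞ D y g) ∣)  ∎

𝔼-split : ∀ m {n} (F : 𝔽₂^ m → 𝔽₂^ n → ℚ) → 𝔼 (λ x → F (take m x) (drop m x)) ≡ 𝔼 (λ y → 𝔼 (F y))
𝔼-split zero    F = refl
𝔼-split (suc m) F = ≗-cong λ b → 𝔼-split m (λ y → F (b ∷ y))

infixr 7 _∥_
_∥_ : ∀ {m n} → (𝔽₂^ m → Bool) → (𝔽₂^ n → Bool) → 𝔽₂^ (m ℕ.+ n) → Bool
_∥_ {m} f g x = f (take m x) xor g (drop m x)

D-∥ : ∀ {m n} (f : 𝔽₂^ m → Bool) (g : 𝔽₂^ n → Bool) y →
      D y (f ∥ g) ≗ D (take m y) f ∥ D (drop m y) g
D-∥ {m} f g y x = trans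
  (cong₂ (λ u v → (f (take m x) xor g (drop m x)) xor (f u xor g v))
    (Vec.take-zipWith {m = m} _xor_ x y) (Vec.drop-zipWith {m = m} _xor_ x y))
  (xor-interchange (f (take m x)) (g (drop m x)) (f (take m x ⊕ take m y)) (g (drop m x ⊕ drop m y)))

𝔼-∗ : ∀ {A B} {{_ : Mean A}} {{_ : Mean B}} (F : A → ℚ) (G : B → ℚ) →
      𝔼 (λ a → 𝔼 (λ b → F a * G b)) ≡ 𝔼 F * 𝔼 G
𝔼-∗ F G = trans (≗-cong λ a → *-homo (F a) G) (*-homoʳ (𝔼 G) F)

-- A uniform direction in the product is a pair of independent uniform directions, and
-- differentiating along it acts on each summand separately.
N-∥ : ∀ d {m n} (f : 𝔽₂^ m → Bool) (g : 𝔽₂^ n → Bool) → N d (f ∥ g) ≡ N d f * N d g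
N-∥ zero {m} f g = begin
  ∣ 𝔼 (λ x → χ (f (take m x) xor g (drop m x))) ∣  ≡⟨ cong ∣_∣ (𝔼-split m (λ y z → χ (f y xor g z))) ⟩
  ∣ 𝔼 (λ y → 𝔼 (λ z → χ (f y xor g z))) ∣          ≡⟨ cong ∣_∣ (≗-cong λ y → ≗-cong λ z → χ-xor (f y) (g z)) ⟩
  ∣ 𝔼 (λ y → 𝔼 (λ z → χ (f y) * χ (g z))) ∣        ≡⟨ cong ∣_∣ (𝔼-∗ (χ ∘ f) (χ ∘ g)) ⟩
  ∣ bias f * bias g ∣                              ≡⟨ ℚ.∣p*q∣≡∣p∣*∣q∣ (bias f) (bias g) ⟩
  ∣ bias f ∣ * ∣ bias g ∣                          ∎
  where open ≡-Reasoning
N-∥ (suc d) {m} f g = begin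
  𝔼 (λ y → N d (D y (f ∥ g)))                            ≡⟨ ≗-cong (λ y → trans (N-cong d (D-∥ f g y)) (N-∥ d _ _)) ⟩
  𝔼 (λ y → N d (D (take m y) f) * N d (D (drop m y) g))  ≡⟨ 𝔼-split m (λ y z → N d (D y f) * N d (D z g)) ⟩
  𝔼 (λ y → 𝔼 (λ z → N d (D y f) * N d (D z g)))          ≡⟨ 𝔼-∗ (λ y → N d (D y f)) (λ z → N d (D z g)) ⟩
  N (suc d) f * N (suc d) g                              ∎
  where open ≡-Reasoning

N-0 : ∀ d {n} → N {n} d (λ _ → false) ≡ 1ℚ
N-0 zero    {n} = cong ∣_∣ (const {𝔽₂^ n} 1ℚ)
N-0 (suc d) {n} = trans (≗-cong {𝔽₂^ n} λ y → N-0 d) (const {𝔽₂^ n} 1ℚ)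

N-^⊕ : ∀ d {n} (f : 𝔽₂^ n → Bool) t → N d (f ^⊕ t) ≡ N d f ^ℚ t
N-^⊕ d f zero    = N-0 d
N-^⊕ d f (suc t) = trans (N-∥ d f (f ^⊕ t)) (cong (N d f *_) (N-^⊕ d f t))

-- For k = d + 1, the rejection probability of the test when its directions are uniform and
-- possibly dependent.
R : ∀ {n} → ℕ → (𝔽₂^ n → Bool) → ℚ
R zero    f = 𝔼 (𝟙 ∘ f)
R (suc k) f = 𝔼 λ y → R k (D y f)

𝔼-𝟙≡½-½bias : ∀ {n} (f : 𝔽₂^ n → Bool) → 𝔼 (𝟙 ∘ f) ≡ ½ + (- ½) * bias f
𝔼-𝟙≡½-½bias f = trans (≗-cong λ x → 𝟙≡½-½χ (f x)) (affine ½ (- ½) (χ ∘ f))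

-- In the base case `R 1 f` is (1 - b²)/2, so the claim is (1 - b)² ≥ 0. The induction merely
-- averages, because the right-hand side is affine in `R`.
N≤1-R : ∀ d {n} (f : 𝔽₂^ n → Bool) → N d f ≤ 1ℚ - R (suc d) f
N≤1-R zero f = subst (b ≤_) (sym 1-R) (0≤q-p⇒p≤q (subst (0ℚ ≤_)
    (solve 1 (λ b → con ½ :* ((con 1ℚ :- b) :* (con 1ℚ :- b)) := con ½ :+ con ½ :* (b :* b) :- b) refl b)
    (*-nonneg (ℚ.nonNegative⁻¹ ½) (p²-nonneg (1ℚ - b)))))
  where
  open ≡-Reasoning
  b = ∣ bias f ∣
  1-R : 1ℚ - R 1 f ≡ ½ + ½ * (b * b)
  1-R = begin
    1ℚ - 𝔼 (λ y → 𝔼 (𝟙 ∘ D y f))               ≡⟨ cong (λ p → 1ℚ - p) (≗-cong λ y → 𝔼-𝟙≡½-½bias (D y f)) ⟩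
    1ℚ - 𝔼 (λ y → ½ + (- ½) * bias (D y f))    ≡⟨ cong (λ p → 1ℚ - p) (affine ½ (- ½) (λ y → bias (D y f))) ⟩
    1ℚ - (½ + (- ½) * 𝔼 (λ y → bias (D y f)))  ≡⟨ cong (λ p → 1ℚ - (½ + (- ½) * p)) (bias²≡𝔼-bias-D f) ⟨
    1ℚ - (½ + (- ½) * (bias f * bias f))       ≡⟨ cong (λ p → 1ℚ - (½ + (- ½) * p)) (∣p∣²≡p² (bias f)) ⟨
    1ℚ - (½ + (- ½) * (b * b))                 ≡⟨ solve 1 (λ p → con 1ℚ :- (con ½ :+ con (- ½) :* p) := con ½ :+ con ½ :* p)
                                                    refl (b * b) ⟩
    ½ + ½ * (b * b)                            ∎
N≤1-R (suc d) f = begin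
  𝔼 (λ y → N d (D y f))                      ≤⟨ mono (λ y → N≤1-R d (D y f)) ⟩
  𝔼 (λ y → 1ℚ - R (suc d) (D y f))           ≡⟨ ≗-cong (λ y → cong (λ q → 1ℚ + q) (negate (R (suc d) (D y f)))) ⟩
  𝔼 (λ y → 1ℚ + (- 1ℚ) * R (suc d) (D y f))  ≡⟨ affine 1ℚ (- 1ℚ) (λ y → R (suc d) (D y f)) ⟩
  1ℚ + (- 1ℚ) * R (suc (suc d)) f            ≡⟨ cong (λ q → 1ℚ + q) (negate (R (suc (suc d)) f)) ⟨
  1ℚ - R (suc (suc d)) f                     ∎
  where
  open ℚ.≤-Reasoning
  negate : ∀ p → - p ≡ (- 1ℚ) * p
  negate = solve 1 (λ p → :- p := con (- 1ℚ) :* p) refl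

N-nonneg : ∀ d {n} (f : 𝔽₂^ n → Bool) → 0ℚ ≤ N d f
N-nonneg zero    f = ℚ.0≤∣p∣ (bias f)
N-nonneg (suc d) f = nonneg λ y → N-nonneg d (D y f)

bias-^⊕ : ∀ d {n} (f : 𝔽₂^ n → Bool) t {g} → Flat d g →
          ∣ bias (f ^⊕ t ⊞ g) ∣ ^ℚ (2 ℕ.^ d) ≤ (1ℚ - R (suc d) f) ^ℚ t
bias-^⊕ d f t {g} flat = begin
  ∣ bias (f ^⊕ t ⊞ g) ∣ ^ℚ (2 ℕ.^ d)  ≤⟨ ∣bias∣^2^d≤N d flat ⟩
  N d (f ^⊕ t)                        ≡⟨ N-^⊕ d f t ⟩
  N d f ^ℚ t                          ≤⟨ ^-mono-≤ t (N-nonneg d f) (N≤1-R d f) ⟩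
  (1ℚ - R (suc d) f) ^ℚ t             ∎
  where open ℚ.≤-Reasoning

-- Degree

Flat-cong : ∀ d {n} {f g : 𝔽₂^ n → Bool} → f ≗ g → Flat d f → Flat d g
Flat-cong zero    f≗g flat x y = trans (sym (f≗g x)) (trans (flat x y) (f≗g y))
Flat-cong (suc d) f≗g flat y   = Flat-cong d (D-cong y f≗g) (flat y)

Flat-⊞ : ∀ d {n} {f g : 𝔽₂^ n → Bool} → Flat d f → Flat d g → Flat d (f ⊞ g)
Flat-⊞ zero    flatf flatg x y = cong₂ _xor_ (flatf x y) (flatg x y)
Flat-⊞ (suc d) {f = f} {g} flatf flatg y =
  Flat-cong d (λ x → sym (D-⊞ y f g x)) (Flat-⊞ d (flatf y) (flatg y))

Flat-const : ∀ d {n} b → Flat {n} d (λ _ → b)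
Flat-const zero    b _ _ = refl
Flat-const (suc d) b y   = Flat-const d (b xor b)

Flat-suc : ∀ d {n} {f : 𝔽₂^ n → Bool} → Flat d f → Flat (suc d) f
Flat-suc zero    {f = f} flat y x z = cong₂ _xor_ (flat x z) (flat (x ⊕ y) (z ⊕ y))
Flat-suc (suc d) flat y = Flat-suc d (flat y)

Flat-+ : ∀ k d {n} {f : 𝔽₂^ n → Bool} → Flat d f → Flat (k ℕ.+ d) f
Flat-+ zero    d flat = flat
Flat-+ (suc k) d flat = Flat-suc (k ℕ.+ d) (Flat-+ k d flat)

Flat-≤ : ∀ {d e n} {f : 𝔽₂^ n → Bool} → d ℕ.≤ e → Flat d f → Flat e f
Flat-≤ {d} {e} {f = f} d≤e flat = subst (λ k → Flat k f) (ℕ.m∸n+n≡m d≤e) (Flat-+ (e ℕ.∸ d) d flat)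

infixr 7 _∧̇_
_∧̇_ : ∀ {n} → (𝔽₂^ n → Bool) → (𝔽₂^ n → Bool) → 𝔽₂^ n → Bool
(f ∧̇ g) x = f x ∧ g x

∧̇-const : ∀ d {n} {f g : 𝔽₂^ n → Bool} → Flat zero f → Flat d g → Flat d (f ∧̇ g)
∧̇-const d {f = f} {g} flatf flatg with f 𝟎 in f0
... | false = Flat-cong d (λ x → cong (_∧ g x) (sym (trans (flatf x 𝟎) f0))) (Flat-const d false)
... | true  = Flat-cong d (λ x → cong (_∧ g x) (sym (trans (flatf x 𝟎) f0))) flatg

-- The product rule for finite differences, with `c` and `d` the shifted values of `a` and `b`; the
-- last term is the second-order correction absent from the infinitesimal rule.
leibniz : ∀ a b c d → (a ∧ b) xor (c ∧ d) ≡ ((a xor c) ∧ b) xor ((a ∧ (b xor d)) xor ((a xor c) ∧ (b xor d)))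
leibniz false b     false d     = refl
leibniz false false true  d     = refl
leibniz false true  true  false = refl
leibniz false true  true  true  = refl
leibniz true  false false d     = sym (Bool.xor-same d)
leibniz true  true  false false = refl
leibniz true  true  false true  = refl
leibniz true  b     true  d     = sym (Bool.xor-identityʳ (b xor d))

-- In each of the three terms of `leibniz` at least one factor is differentiated, so the total
-- degree drops by one. The term with two derivatives drops by two and is raised again by
-- `Flat-suc`.
Flat-∧ : ∀ d e {n} {f g : 𝔽₂^ n → Bool} → Flat d f → Flat e g → Flat (d ℕ.+ e) (f ∧̇ g)
Flat-∧ zero    e {f = f} {g} flatf flatg = ∧̇-const e {f = f} {g} flatf flatg
Flat-∧ (suc d) zero {f = f} {g} flatf flatg = Flat-cong (suc d ℕ.+ 0) (λ x → Bool.∧-comm (g x) (f x))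
  (subst (λ k → Flat k (g ∧̇ f)) (sym (ℕ.+-identityʳ (suc d))) (∧̇-const (suc d) {f = g} {f} flatg flatf))
Flat-∧ (suc d) (suc e) {f = f} {g} flatf flatg y =
  Flat-cong k (λ x → sym (leibniz (f x) (g x) (f (x ⊕ y)) (g (x ⊕ y))))
    (Flat-⊞ k (Flat-∧ d (suc e) {f = D y f} {g} (flatf y) flatg)
    (Flat-⊞ k (subst (λ j → Flat j (f ∧̇ D y g)) (sym (ℕ.+-suc d e)) (Flat-∧ (suc d) e {f = f} {D y g} flatf (flatg y)))
              (subst (λ j → Flat j (D y f ∧̇ D y g)) (sym (ℕ.+-suc d e))
                (Flat-suc (d ℕ.+ e) (Flat-∧ d e {f = D y f} {D y g} (flatf y) (flatg y))))))
  where k = d ℕ.+ suc e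

-- With `L` the linear part of `φ`, the derivative of `f ∘ φ` along `y` is the derivative of `f`
-- along `L y`, composed with `φ`. Asking only for this identity covers projections, embeddings,
-- affine maps and their inverses at once.
Flat-∘ : ∀ d {m n} (φ L : 𝔽₂^ m → 𝔽₂^ n) → (∀ x y → φ (x ⊕ y) ≡ φ x ⊕ L y) →
         ∀ {f} → Flat d f → Flat d (f ∘ φ)
Flat-∘ zero    φ L φ-⊕ flat x y = flat (φ x) (φ y)
Flat-∘ (suc d) φ L φ-⊕ {f} flat y =
  Flat-cong d (λ x → cong (λ z → f (φ x) xor f z) (sym (φ-⊕ x y))) (Flat-∘ d φ L φ-⊕ (flat (L y)))

Flat-head : ∀ {n} → Flat {suc n} 1 Vec.head
Flat-head (c ∷ _) (a ∷ _) (b ∷ _) = trans (cancel a) (sym (cancel b))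
  where
  cancel : ∀ a → a xor (a xor c) ≡ c
  cancel a = trans (sym (Bool.xor-assoc a a c)) (cong (_xor c) (Bool.xor-same a))

tail-⊕ : ∀ {n} (x y : 𝔽₂^ suc n) → Vec.tail (x ⊕ y) ≡ Vec.tail x ⊕ Vec.tail y
tail-⊕ (_ ∷ _) (_ ∷ _) = refl

Flat-monomial : ∀ {n} (S : Subset n) → Flat (card S) (monomial S)
Flat-monomial []            = λ { [] [] → refl }
Flat-monomial (outside ∷ S) = Flat-cong (card S) {f = monomial S ∘ Vec.tail} (λ { (_ ∷ _) → refl })
  (Flat-∘ (card S) Vec.tail Vec.tail tail-⊕ {monomial S} (Flat-monomial S))
Flat-monomial (inside ∷ S)  = Flat-cong (suc (card S)) {f = Vec.head ∧̇ (monomial S ∘ Vec.tail)} {monomial (inside ∷ S)} (λ { (_ ∷ _) → refl })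
  (Flat-∧ 1 (card S) {f = Vec.head} {monomial S ∘ Vec.tail} Flat-head
    (Flat-∘ (card S) Vec.tail Vec.tail tail-⊕ {monomial S} (Flat-monomial S)))

⊕∑ : {A : Set} → List A → (A → Bool) → Bool
⊕∑ xs F = foldr _xor_ false (map F xs)

Flat-⊕∑ : ∀ d {n} {A : Set} (xs : List A) {F : A → 𝔽₂^ n → Bool} → (∀ a → Flat d (F a)) →
          Flat d (λ x → ⊕∑ xs (λ a → F a x))
Flat-⊕∑ d []       flat = Flat-const d false
Flat-⊕∑ d (a ∷ xs) flat = Flat-⊞ d (flat a) (Flat-⊕∑ d xs flat)

Deg≤⇒Flat : ∀ {d n} {f : 𝔽₂^ n → Bool} → Deg≤ d f → Flat d f
Deg≤⇒Flat {d} {n} (c , rep , low) = Flat-cong d rep (Flat-⊕∑ d (points n) term)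
  where
  term : ∀ S → Flat d (λ x → c S ∧ monomial S x)
  term S with c S in cS
  ... | false = Flat-const d false
  ... | true  = Flat-≤ (low S cS) (Flat-monomial S)

-- Coefficients of a function and its top coefficient

⊕∑-++ : {A : Set} (xs ys : List A) (F : A → Bool) → ⊕∑ (xs ++ ys) F ≡ ⊕∑ xs F xor ⊕∑ ys F
⊕∑-++ []       ys F = refl
⊕∑-++ (a ∷ xs) ys F = trans (cong (F a xor_) (⊕∑-++ xs ys F)) (sym (Bool.xor-assoc (F a) (⊕∑ xs F) (⊕∑ ys F)))

⊕∑-map : {A B : Set} (h : A → B) (xs : List A) (F : B → Bool) → ⊕∑ (map h xs) F ≡ ⊕∑ xs (F ∘ h)
⊕∑-map h []       F = refl
⊕∑-map h (a ∷ xs) F = cong (F (h a) xor_) (⊕∑-map h xs F)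

⊕∑-∧ : {A : Set} (b : Bool) (xs : List A) (F G : A → Bool) →
       ⊕∑ xs (λ a → F a ∧ (b ∧ G a)) ≡ b ∧ ⊕∑ xs (λ a → F a ∧ G a)
⊕∑-∧ true  xs       F G = refl
⊕∑-∧ false []       F G = refl
⊕∑-∧ false (a ∷ xs) F G = cong₂ _xor_ (Bool.∧-zeroʳ (F a)) (⊕∑-∧ false xs F G)

⟦⟧-∷ : ∀ {n} (c : Poly (suc n)) b (x : 𝔽₂^ n) →
       ⟦ c ⟧ (b ∷ x) ≡ ⟦ c ∘ (outside ∷_) ⟧ x xor (b ∧ ⟦ c ∘ (inside ∷_) ⟧ x)
⟦⟧-∷ {n} c b x = begin
  ⊕∑ (map (outside ∷_) ps ++ map (inside ∷_) ps ++ []) F            ≡⟨ ⊕∑-++ (map (outside ∷_) ps) _ F ⟩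
  ⊕∑ (map (outside ∷_) ps) F xor ⊕∑ (map (inside ∷_) ps ++ []) F    ≡⟨ cong₂ _xor_ (⊕∑-map (outside ∷_) ps F)
                                                                       (trans (⊕∑-++ (map (inside ∷_) ps) [] F) (Bool.xor-identityʳ _)) ⟩
  ⟦ c ∘ (outside ∷_) ⟧ x xor ⊕∑ (map (inside ∷_) ps) F              ≡⟨ cong (⟦ c ∘ (outside ∷_) ⟧ x xor_)
                                                                       (trans (⊕∑-map (inside ∷_) ps F) (⊕∑-∧ b ps (c ∘ (inside ∷_)) (λ S → monomial S x))) ⟩
  ⟦ c ∘ (outside ∷_) ⟧ x xor (b ∧ ⟦ c ∘ (inside ∷_) ⟧ x)            ∎
  where
  open ≡-Reasoning
  ps = points n
  F : Subset (suc n) → Bool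
  F S = c S ∧ monomial S (b ∷ x)

-- The derivative along the first coordinate, which is independent of that coordinate; as a
-- polynomial it is the cofactor of the first variable.
∂₀ : ∀ {n} → (𝔽₂^ suc n → Bool) → 𝔽₂^ n → Bool
∂₀ f = (f ∘ (false ∷_)) ⊞ (f ∘ (true ∷_))

-- Möbius inversion, unrolled variable by variable: the coefficient at `S` is the sum of `f` over
-- the points supported in `S`.
coefficient : ∀ {n} → (𝔽₂^ n → Bool) → Poly n
coefficient f []            = f []
coefficient f (outside ∷ S) = coefficient (f ∘ (false ∷_)) S
coefficient f (inside ∷ S)  = coefficient (∂₀ f) S

coefficient-represents : ∀ {n} (f : 𝔽₂^ n → Bool) x → ⟦ coefficient f ⟧ x ≡ f x
coefficient-represents f []      = trans (Bool.xor-identityʳ (f [] ∧ true)) (Bool.∧-identityʳ (f []))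
coefficient-represents f (b ∷ x) = begin
  ⟦ coefficient f ⟧ (b ∷ x)                                          ≡⟨ ⟦⟧-∷ (coefficient f) b x ⟩
  ⟦ coefficient (f ∘ (false ∷_)) ⟧ x xor (b ∧ ⟦ coefficient (∂₀ f) ⟧ x)  ≡⟨ cong₂ (λ p q → p xor (b ∧ q))
                                                                             (coefficient-represents (f ∘ (false ∷_)) x)
                                                                             (coefficient-represents (∂₀ f) x) ⟩
  f (false ∷ x) xor (b ∧ (f (false ∷ x) xor f (true ∷ x)))           ≡⟨ interpolate b ⟩
  f (b ∷ x)                                                          ∎
  where
  open ≡-Reasoning
  interpolate : ∀ b → f (false ∷ x) xor (b ∧ (f (false ∷ x) xor f (true ∷ x))) ≡ f (b ∷ x)
  interpolate false = Bool.xor-identityʳ (f (false ∷ x))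
  interpolate true  = trans (sym (Bool.xor-assoc (f (false ∷ x)) _ _))
                        (cong (_xor f (true ∷ x)) (Bool.xor-same (f (false ∷ x))))

-- The sum of `f` over the whole cube, in the recursive form that matches both the top coefficient
-- and iterated derivatives.
parity : ∀ {n} → (𝔽₂^ n → Bool) → Bool
parity {zero}  f = f []
parity {suc n} f = parity (∂₀ f)

coefficient-full : ∀ {n} (f : 𝔽₂^ n → Bool) → coefficient f full ≡ parity f
coefficient-full {zero}  f = refl
coefficient-full {suc n} f = coefficient-full (∂₀ f)

parity-cong : ∀ {n} {f g : 𝔽₂^ n → Bool} → f ≗ g → parity f ≡ parity g
parity-cong {zero}  f≗g = f≗g []
parity-cong {suc n} f≗g = parity-cong λ x → cong₂ _xor_ (f≗g (false ∷ x)) (f≗g (true ∷ x))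

parity-⊞ : ∀ {n} (f g : 𝔽₂^ n → Bool) → parity (f ⊞ g) ≡ parity f xor parity g
parity-⊞ {zero}  f g = refl
parity-⊞ {suc n} f g = trans
  (parity-cong (λ x → xor-interchange (f (false ∷ x)) (g (false ∷ x)) (f (true ∷ x)) (g (true ∷ x))))
  (parity-⊞ (∂₀ f) (∂₀ g))

Deg≤-dimension : ∀ {d n} (f : 𝔽₂^ n → Bool) → n ℕ.≤ d → Deg≤ d f
Deg≤-dimension f n≤d = coefficient f , coefficient-represents f , λ S _ → ℕ.≤-trans (Subset.∣p∣≤n S) n≤d

-- In d + 1 variables the full monomial is the only one of degree above d, and its coefficient is
-- the parity.
even⇒Deg≤ : ∀ {d} (f : 𝔽₂^ suc d → Bool) → parity f ≡ false → Deg≤ d f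
even⇒Deg≤ {d} f even = coefficient f , coefficient-represents f , low
  where
  low : ∀ S → coefficient f S ≡ true → card S ℕ.≤ d
  low S cS with ℕ.m≤n⇒m<n∨m≡n (Subset.∣p∣≤n S)
  ... | inj₁ (ℕ.s≤s ∣S∣≤d) = ∣S∣≤d
  ... | inj₂ ∣S∣≡1+d = contradiction
    (trans (sym cS) (trans (cong (coefficient f) (Subset.∣p∣≡n⇒p≡⊤ {p = S} ∣S∣≡1+d)) (trans (coefficient-full f) even))) λ ()

-- The derivative along the first basis vector, restricted to the hyperplane where the first
-- coordinate is `false`, is `∂₀ f`; degree and dimension both fall by one.
Flat⇒even : ∀ {d} {f : 𝔽₂^ suc d → Bool} → Flat d f → parity f ≡ false
Flat⇒even {zero}  {f} flat = trans (cong (_xor f (true ∷ [])) (flat (false ∷ []) (true ∷ []))) (Bool.xor-same (f (true ∷ [])))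
Flat⇒even {suc d} {f} flat = trans
  (parity-cong λ x → cong (λ z → f (false ∷ x) xor f (true ∷ z)) (sym (⊕-identityʳ x)))
  (Flat⇒even {d} (Flat-∘ d (false ∷_) (false ∷_) (λ _ _ → refl) (flat (true ∷ 𝟎))))

-- The odd function of smallest support: adding it makes an odd function even at the cost of a
-- single point, which is how `δ≤½^` bounds the distance.
isZero : ∀ {n} → 𝔽₂^ n → Bool
isZero []      = true
isZero (b ∷ x) = not b ∧ isZero x

parity-isZero : ∀ n → parity (isZero {n}) ≡ true
parity-isZero zero    = refl
parity-isZero (suc n) = trans (parity-cong {n} λ x → Bool.xor-identityʳ (isZero x)) (parity-isZero n)

-- Linear combinations and affine maps

scale-false : ∀ {n} (v : 𝔽₂^ n) → Vec.map (false ∧_) v ≡ 𝟎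
scale-false []      = refl
scale-false (_ ∷ v) = cong (false ∷_) (scale-false v)

scale-true : ∀ {n} (v : 𝔽₂^ n) → Vec.map (true ∧_) v ≡ v
scale-true = Vec.map-id

scale-xor : ∀ {n} a b (v : 𝔽₂^ n) → Vec.map ((a xor b) ∧_) v ≡ Vec.map (a ∧_) v ⊕ Vec.map (b ∧_) v
scale-xor a b []      = refl
scale-xor a b (c ∷ v) = cong₂ _∷_ (Bool.∧-distribʳ-xor c a b) (scale-xor a b v)

module _ {n : ℕ} where

  combination-𝟎 : ∀ {k} (vs : Vec (𝔽₂^ n) k) → combination vs 𝟎 ≡ 𝟎
  combination-𝟎 []       = refl
  combination-𝟎 (v ∷ vs) = trans (cong₂ _⊕_ (scale-false v) (combination-𝟎 vs)) (⊕-identityˡ 𝟎)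

  combination-⊕ : ∀ {k} (vs : Vec (𝔽₂^ n) k) x y →
                  combination vs (x ⊕ y) ≡ combination vs x ⊕ combination vs y
  combination-⊕ []       []      []      = sym (⊕-identityˡ 𝟎)
  combination-⊕ (v ∷ vs) (a ∷ x) (b ∷ y) = trans
    (cong₂ _⊕_ (scale-xor a b v) (combination-⊕ vs x y))
    (⊕-interchange (Vec.map (a ∧_) v) (Vec.map (b ∧_) v) (combination vs x) (combination vs y))

  combination-scale : ∀ {k} (vs : Vec (𝔽₂^ n) k) b x →
                      combination vs (Vec.map (b ∧_) x) ≡ Vec.map (b ∧_) (combination vs x)
  combination-scale vs false x = trans (cong (combination vs) (scale-false x))
    (trans (combination-𝟎 vs) (sym (scale-false (combination vs x))))
  combination-scale vs true  x = trans (cong (combination vs) (scale-true x)) (sym (scale-true (combination vs x)))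

  combination-∘ : ∀ {k l} (vs : Vec (𝔽₂^ n) k) (cs : Vec (𝔽₂^ k) l) x →
                  combination (Vec.map (combination vs) cs) x ≡ combination vs (combination cs x)
  combination-∘ vs []       []      = sym (combination-𝟎 vs)
  combination-∘ vs (c ∷ cs) (b ∷ x) = trans
    (cong₂ _⊕_ (sym (combination-scale vs b c)) (combination-∘ vs cs x))
    (sym (combination-⊕ vs (Vec.map (b ∧_) c) (combination cs x)))

apply-⊕ : ∀ {k n} (φ : AffineMap k n) x y → apply φ (x ⊕ y) ≡ apply φ x ⊕ combination (proj₂ φ) y
apply-⊕ (a , vs) x y = trans (cong (a ⊕_) (combination-⊕ vs x y)) (sym (⊕-assoc a _ _))

_∘ᴬ_ : ∀ {k l n} → AffineMap k n → AffineMap l k → AffineMap l n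
φ ∘ᴬ (c , cs) = apply φ c , Vec.map (combination (proj₂ φ)) cs

apply-∘ : ∀ {k l n} (φ : AffineMap k n) (ψ : AffineMap l k) x → apply (φ ∘ᴬ ψ) x ≡ apply φ (apply ψ x)
apply-∘ φ@(_ , vs) (c , cs) x = trans (cong (apply φ c ⊕_) (combination-∘ vs cs x)) (sym (apply-⊕ φ c (combination cs x)))

Flat-apply : ∀ d {k n} (φ : AffineMap k n) {f} → Flat d f → Flat d (f ∘ apply φ)
Flat-apply d φ = Flat-∘ d (apply φ) (combination (proj₂ φ)) (apply-⊕ φ)

-- Splitting the cube by the coefficient of `v` pairs every point `x` with `x ⊕ v`, and the sum over
-- such a pair is a value of `D v f`.
parity-apply-∷ : ∀ {k n} a v (vs : Vec (𝔽₂^ n) k) f →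
                 parity (f ∘ apply (a , v ∷ vs)) ≡ parity (D v f ∘ apply (a , vs))
parity-apply-∷ a v vs f = parity-cong λ c → cong₂ (λ x y → f x xor f y)
  (cong (a ⊕_) (trans (cong (_⊕ combination vs c) (scale-false v)) (⊕-identityˡ _)))
  (trans (cong (a ⊕_) (trans (cong (_⊕ combination vs c) (scale-true v)) (⊕-comm v _))) (sym (⊕-assoc a _ v)))

-- By `parity-apply-∷`, the `k`-fold derivative of `f` along the directions of `φ`, taken at its
-- base point; dependent directions are allowed.
odd : ∀ {k n} → (𝔽₂^ n → Bool) → AffineMap k n → Bool
odd f φ = parity (f ∘ apply φ)

-- `R` draws the base point after the directions, `AffineMap` stores it before them; hence the
-- exchange of means in each step.
R≡𝔼-odd : ∀ k {n} (f : 𝔽₂^ n → Bool) → R k f ≡ 𝔼 (λ φ → 𝟙 (odd {k} f φ))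
R≡𝔼-odd zero    f = ≗-cong λ a → cong (𝟙 ∘ f) (sym (⊕-identityʳ a))
R≡𝔼-odd (suc k) f = begin
  𝔼 (λ v → R k (D v f))                                      ≡⟨ ≗-cong (λ v → R≡𝔼-odd k (D v f)) ⟩
  𝔼 (λ v → 𝔼 λ a → 𝔼 λ vs → 𝟙 (odd {k} (D v f) (a , vs)))    ≡⟨ fubini isLinear (λ v a → 𝔼 λ vs → 𝟙 (odd {k} (D v f) (a , vs))) ⟩
  𝔼 (λ a → 𝔼 λ v → 𝔼 λ vs → 𝟙 (odd {k} (D v f) (a , vs)))    ≡⟨ ≗-cong (λ a → ≗-cong λ v → ≗-cong λ vs → cong 𝟙 (parity-apply-∷ {k} a v vs f)) ⟨
  𝔼 (λ a → 𝔼 λ v → 𝔼 λ vs → 𝟙 (odd {suc k} f (a , v ∷ vs)))  ∎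
  where open ≡-Reasoning

-- Probabilities and distances

toℚᵘ-/ : ∀ i m → toℚᵘ (i / suc m) ℚᵘ.≃ ℚᵘ.mkℚᵘ i m
toℚᵘ-/ i m = ℚ.toℚᵘ-fromℚᵘ (ℚᵘ.mkℚᵘ i m)

ι : ℕ → ℚ
ι n = + n / 1

ι-suc : ∀ n → ι (suc n) ≡ 1ℚ + ι n
ι-suc n = ℚ.toℚᵘ-injective (begin-equality
  toℚᵘ (ι (suc n))             ≃⟨ toℚᵘ-/ (+ suc n) 0 ⟩
  ℚᵘ.mkℚᵘ (+ suc n) 0          ≃⟨ ℚᵘ.*≡* (cong (ℤ._* + 1) (cong (λ k → + 1 ℤ.+ k) (sym (ℤ.*-identityʳ (+ n))))) ⟩
  ℚᵘ.1ℚᵘ ℚᵘ.+ ℚᵘ.mkℚᵘ (+ n) 0  ≃⟨ ℚᵘ.+-congʳ ℚᵘ.1ℚᵘ (toℚᵘ-/ (+ n) 0) ⟨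
  toℚᵘ 1ℚ ℚᵘ.+ toℚᵘ (ι n)      ≃⟨ ℚ.toℚᵘ-homo-+ 1ℚ (ι n) ⟨
  toℚᵘ (1ℚ + ι n)              ∎)
  where open ℚᵘ.≤-Reasoning

/-*-ι : ∀ i m .{{_ : NonZero m}} → (i / m) * ι m ≡ i / 1
/-*-ι i (suc m) = ℚ.toℚᵘ-injective (begin-equality
  toℚᵘ ((i / suc m) * ι (suc m))          ≃⟨ ℚ.toℚᵘ-homo-* (i / suc m) (ι (suc m)) ⟩
  toℚᵘ (i / suc m) ℚᵘ.* toℚᵘ (ι (suc m))  ≃⟨ ℚᵘ.*-cong (toℚᵘ-/ i m) (toℚᵘ-/ (+ suc m) 0) ⟩
  ℚᵘ.mkℚᵘ i m ℚᵘ.* ℚᵘ.mkℚᵘ (+ suc m) 0    ≃⟨ ℚᵘ.*≡* (trans (ℤ.*-identityʳ (i ℤ.* + suc m)) (cong (λ k → i ℤ.* + k) (sym (ℕ.*-identityʳ (suc m))))) ⟩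
  ℚᵘ.mkℚᵘ i 0                             ≃⟨ toℚᵘ-/ i 0 ⟨
  toℚᵘ (i / 1)                            ∎)
  where open ℚᵘ.≤-Reasoning

∑ : {A : Set} → List A → (A → ℚ) → ℚ
∑ xs F = foldr _+_ 0ℚ (map F xs)

∑-linear : {A : Set} (xs : List A) → IsLinear (∑ xs)
∑-linear []       = record { ≗-cong = λ _ → refl ; +-homo = λ _ _ → refl ; *-homo = λ p _ → sym (ℚ.*-zeroʳ p) }
∑-linear (x ∷ xs) = record
  { ≗-cong = λ F≗G → cong₂ _+_ (F≗G x) (∑xs.≗-cong F≗G)
  ; +-homo = λ F G → trans (cong (λ q → (F x + G x) + q) (∑xs.+-homo F G))
      (solve 4 (λ a b c d → (a :+ b) :+ (c :+ d) := (a :+ c) :+ (b :+ d)) refl (F x) (G x) (∑ xs F) (∑ xs G))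
  ; *-homo = λ p F → trans (cong (λ q → p * F x + q) (∑xs.*-homo p F)) (sym (ℚ.*-distribˡ-+ p (F x) (∑ xs F)))
  }
  where module ∑xs = IsLinear (∑-linear xs)

module _ {A : Set} where

  ∑-mono : ∀ {xs : List A} {F G} → All (λ a → F a ≤ G a) xs → ∑ xs F ≤ ∑ xs G
  ∑-mono []           = ℚ.≤-refl
  ∑-mono (F≤G ∷ rest) = ℚ.+-mono-≤ F≤G (∑-mono rest)

  ∑-cong-All : ∀ {xs : List A} {F G} → All (λ a → F a ≡ G a) xs → ∑ xs F ≡ ∑ xs G
  ∑-cong-All []           = refl
  ∑-cong-All (F≡G ∷ rest) = cong₂ _+_ F≡G (∑-cong-All rest)

  ∑-nonneg : ∀ (xs : List A) {F} → (∀ a → 0ℚ ≤ F a) → 0ℚ ≤ ∑ xs F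
  ∑-nonneg []       0≤F = ℚ.≤-refl
  ∑-nonneg (x ∷ xs) 0≤F = +-nonneg (0≤F x) (∑-nonneg xs 0≤F)

  ∑-∈ : ∀ {xs : List A} {F a} → (∀ a → 0ℚ ≤ F a) → a ∈ xs → F a ≤ ∑ xs F
  ∑-∈ {x ∷ xs} {F} 0≤F (here refl) = subst (_≤ F x + ∑ xs F) (ℚ.+-identityʳ (F x)) (ℚ.+-monoʳ-≤ (F x) (∑-nonneg xs 0≤F))
  ∑-∈ {x ∷ xs} {F} {a} 0≤F (there a∈) = subst (_≤ F x + ∑ xs F) (ℚ.+-identityˡ (F a)) (ℚ.+-mono-≤ (0≤F x) (∑-∈ 0≤F a∈))

  ∑-1 : ∀ (xs : List A) → ∑ xs (λ _ → 1ℚ) ≡ ι (length xs)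
  ∑-1 []       = refl
  ∑-1 (x ∷ xs) = trans (cong (λ q → 1ℚ + q) (∑-1 xs)) (sym (ι-suc (length xs)))

  ∑-⟪⟫ : ∀ {P : A → Set} (P? : Decidable P) xs → ∑ xs (λ a → ⟪ P? a ⟫) ≡ ι (length (filter P? xs))
  ∑-⟪⟫ P? []       = refl
  ∑-⟪⟫ P? (x ∷ xs) with does (P? x)
  ... | true  = trans (cong (λ q → 1ℚ + q) (∑-⟪⟫ P? xs)) (sym (ι-suc (length (filter P? xs))))
  ... | false = trans (ℚ.+-identityˡ _) (∑-⟪⟫ P? xs)

  Pr-*-length : ∀ {P : A → Set} (P? : Decidable P) xs → Pr xs P? * ι (length xs) ≡ ∑ xs (λ a → ⟪ P? a ⟫)
  Pr-*-length P? []          = refl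
  Pr-*-length P? xs@(_ ∷ ys) = trans (/-*-ι (+ length (filter P? xs)) (suc (length ys))) (sym (∑-⟪⟫ P? xs))

  ∑-++ : ∀ xs ys (F : A → ℚ) → ∑ (xs ++ ys) F ≡ ∑ xs F + ∑ ys F
  ∑-++ []       ys F = sym (ℚ.+-identityˡ (∑ ys F))
  ∑-++ (x ∷ xs) ys F = trans (cong (λ q → F x + q) (∑-++ xs ys F)) (sym (ℚ.+-assoc (F x) (∑ xs F) (∑ ys F)))

  ∑-map : ∀ {B : Set} (h : B → A) xs (F : A → ℚ) → ∑ (map h xs) F ≡ ∑ xs (F ∘ h)
  ∑-map h []       F = refl
  ∑-map h (x ∷ xs) F = cong (λ q → F (h x) + q) (∑-map h xs F)

∑-points : ∀ n (F : 𝔽₂^ n → ℚ) → ∑ (points n) F * ½ ^ℚ n ≡ 𝔼 F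
∑-points zero    F = trans (ℚ.*-identityʳ (F [] + 0ℚ)) (ℚ.+-identityʳ (F []))
∑-points (suc n) F = begin
  ∑ (map (false ∷_) ps ++ map (true ∷_) ps ++ []) F * (½ * ½ ^ℚ n)
    ≡⟨ cong (_* (½ * ½ ^ℚ n)) (trans (∑-++ (map (false ∷_) ps) _ F) (cong₂ _+_ (∑-map (false ∷_) ps F)
         (trans (∑-++ (map (true ∷_) ps) [] F) (trans (ℚ.+-identityʳ _) (∑-map (true ∷_) ps F))))) ⟩
  (∑ ps (F ∘ (false ∷_)) + ∑ ps (F ∘ (true ∷_))) * (½ * ½ ^ℚ n)
    ≡⟨ solve 4 (λ a b h p → (a :+ b) :* (h :* p) := h :* (a :* p :+ b :* p)) refl
         (∑ ps (F ∘ (false ∷_))) (∑ ps (F ∘ (true ∷_))) ½ (½ ^ℚ n) ⟩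
  ½ * (∑ ps (F ∘ (false ∷_)) * ½ ^ℚ n + ∑ ps (F ∘ (true ∷_)) * ½ ^ℚ n)
    ≡⟨ cong (½ *_) (cong₂ _+_ (∑-points n (F ∘ (false ∷_))) (∑-points n (F ∘ (true ∷_)))) ⟩
  𝔼 F ∎
  where
  open ≡-Reasoning
  ps = points n

-- The length of `points n` is not computed: `∑-points` for the constant 1 already says that its
-- product with ½^n is 1.
Pr-points : ∀ {n} {P : 𝔽₂^ n → Set} (P? : Decidable P) → Pr (points n) P? ≡ 𝔼 (λ x → ⟪ P? x ⟫)
Pr-points {n} P? = begin
  p                                       ≡⟨ ℚ.*-identityʳ p ⟨
  p * 1ℚ                                  ≡⟨ cong (p *_) (trans (∑-points n (λ _ → 1ℚ)) (const {𝔽₂^ n} 1ℚ)) ⟨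
  p * (∑ (points n) (λ _ → 1ℚ) * ½ ^ℚ n)  ≡⟨ ℚ.*-assoc p _ _ ⟨
  p * ∑ (points n) (λ _ → 1ℚ) * ½ ^ℚ n    ≡⟨ cong (λ q → p * q * ½ ^ℚ n) (∑-1 (points n)) ⟩
  p * ι (length (points n)) * ½ ^ℚ n      ≡⟨ cong (_* ½ ^ℚ n) (Pr-*-length P? (points n)) ⟩
  ∑ (points n) (λ x → ⟪ P? x ⟫) * ½ ^ℚ n  ≡⟨ ∑-points n (λ x → ⟪ P? x ⟫) ⟩
  𝔼 (λ x → ⟪ P? x ⟫)                      ∎
  where
  open ≡-Reasoning
  p = Pr (points n) P?

distance≡𝔼 : ∀ {n} (f g : 𝔽₂^ n → Bool) → distance f g ≡ 𝔼 (𝟙 ∘ (f ⊞ g))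
distance≡𝔼 f g = trans (Pr-points (λ x → ¬? (f x Bool.≟ g x))) (≗-cong λ x → cong 𝟙 (lemma (f x) (g x)))
  where
  lemma : ∀ a b → does (¬? (a Bool.≟ b)) ≡ a xor b
  lemma false false = refl
  lemma false true  = refl
  lemma true  false = refl
  lemma true  true  = refl

distance≡½-½bias : ∀ {n} (f g : 𝔽₂^ n → Bool) → distance f g ≡ ½ + (- ½) * bias (f ⊞ g)
distance≡½-½bias f g = trans (distance≡𝔼 f g) (𝔼-𝟙≡½-½bias (f ⊞ g))

distance-congʳ : ∀ {n} (f : 𝔽₂^ n → Bool) {g h} → g ≗ h → distance f g ≡ distance f h
distance-congʳ f {g} {h} g≗h = trans (distance≡𝔼 f g)
  (trans (≗-cong λ x → cong (λ b → 𝟙 (f x xor b)) (g≗h x)) (sym (distance≡𝔼 f h)))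

foldr-⊓-≤ : ∀ {p x} {xs : List ℚ} → x ∈ xs → foldr _⊓_ p xs ≤ x
foldr-⊓-≤ {p} {xs = x ∷ xs} (here refl) = ℚ.p⊓q≤p x (foldr _⊓_ p xs)
foldr-⊓-≤ {p} {xs = y ∷ xs} (there x∈)  = ℚ.≤-trans (ℚ.p⊓q≤q y (foldr _⊓_ p xs)) (foldr-⊓-≤ x∈)

⊓-glb-< : ∀ {p q r} → p < q → p < r → p < q ⊓ r
⊓-glb-< {p} {q} {r} p<q p<r with ℚ.≤-total q r
... | inj₁ q≤r = subst (p <_) (sym (ℚ.p≤q⇒p⊓q≡p q≤r)) p<q
... | inj₂ r≤q = subst (p <_) (sym (ℚ.p≥q⇒p⊓q≡q r≤q)) p<r

<-foldr-⊓ : ∀ {p q} {xs : List ℚ} → p < q → All (p <_) xs → p < foldr _⊓_ q xs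
<-foldr-⊓ p<q []           = p<q
<-foldr-⊓ p<q (p<x ∷ rest) = ⊓-glb-< p<x (<-foldr-⊓ p<q rest)

Deg≤-cong : ∀ {d n} {f g : 𝔽₂^ n → Bool} → f ≗ g → Deg≤ d f → Deg≤ d g
Deg≤-cong f≗g (c , rep , low) = c , (λ x → trans (rep x) (f≗g x)) , low

δ≤distance : ∀ {d n} (f : 𝔽₂^ n → Bool) {g} → Deg≤ d g → δ d f ≤ distance f g
δ≤distance {d} f {g} deg =
  let g′ , g′∈ , g′≗g = functions-complete g
  in  ℚ.≤-trans (foldr-⊓-≤ (∈-map⁺ (distance f) (∈-filter⁺ (deg≤? d) g′∈ (Deg≤-cong (λ x → sym (g′≗g x)) deg))))
        (ℚ.≤-reflexive (distance-congʳ f g′≗g))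

-- The bound `p < 1ℚ` handles the initial value of the fold that defines `δ`.
<δ : ∀ {d n p} (f : 𝔽₂^ n → Bool) → p < 1ℚ → (∀ g → Deg≤ d g → p < distance f g) → p < δ d f
<δ {d} {n} f p<1 p<distance = <-foldr-⊓ p<1
  (map⁺ (All.map (λ {g} → p<distance g) (all-filter (deg≤? d) (functions n))))

-- Change of variables along an injection. Both sides sum `F` over the image of `φ`, weighting each
-- point by the product of the two point masses; keeping the masses as factors avoids division.
push : ∀ {X Y : Set} {{μ : Mean X}} {{ν : Mean Y}} (φ : X → Y) → (∀ {x x′} → φ x ≡ φ x′ → x ≡ x′) →
       (F : Y → ℚ) → (∀ y → F y ≡ 0ℚ ⊎ ∃ λ x → φ x ≡ y) → Mean.mass μ * 𝔼 F ≡ Mean.mass ν * 𝔼 (F ∘ φ)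
push {{μ}} {{ν}} φ φ-injective F support = begin
  μ.mass * ν.𝔼 F                                   ≡⟨ ν.*-homo μ.mass F ⟨
  ν.𝔼 (λ y → μ.mass * F y)                         ≡⟨ ν.≗-cong (λ y → fibre y (support y)) ⟩
  ν.𝔼 (λ y → μ.𝔼 λ x → ⟪ y ν.≟ φ x ⟫ * F (φ x))    ≡⟨ ν.fubini μ.isLinear (λ y x → ⟪ y ν.≟ φ x ⟫ * F (φ x)) ⟩
  μ.𝔼 (λ x → ν.𝔼 λ y → ⟪ y ν.≟ φ x ⟫ * F (φ x))    ≡⟨ μ.≗-cong (λ x → ν.*-homoʳ (F (φ x)) (λ y → ⟪ y ν.≟ φ x ⟫)) ⟩
  μ.𝔼 (λ x → ν.𝔼 (λ y → ⟪ y ν.≟ φ x ⟫) * F (φ x))  ≡⟨ μ.≗-cong (λ x → cong (_* F (φ x)) (ν.point (φ x))) ⟩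
  μ.𝔼 (λ x → ν.mass * F (φ x))                     ≡⟨ μ.*-homo ν.mass (F ∘ φ) ⟩
  ν.mass * μ.𝔼 (F ∘ φ)                             ∎
  where
  open ≡-Reasoning
  module μ = Mean μ
  module ν = Mean ν
  fibre : ∀ y → F y ≡ 0ℚ ⊎ (∃ λ x → φ x ≡ y) → μ.mass * F y ≡ μ.𝔼 (λ x → ⟪ y ν.≟ φ x ⟫ * F (φ x))
  fibre y (inj₁ Fy≡0) = trans (trans (cong (μ.mass *_) Fy≡0) (ℚ.*-zeroʳ μ.mass))
    (sym (trans (μ.≗-cong vanish) (μ.const 0ℚ)))
    where
    vanish : ∀ x → ⟪ y ν.≟ φ x ⟫ * F (φ x) ≡ 0ℚ
    vanish x with y ν.≟ φ x
    ... | yes refl = trans (ℚ.*-identityˡ (F y)) Fy≡0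
    ... | no  _    = ℚ.*-zeroˡ (F (φ x))
  fibre _ (inj₂ (x₀ , refl)) = begin
    μ.mass * F (φ x₀)                       ≡⟨ cong (_* F (φ x₀)) (μ.point x₀) ⟨
    μ.𝔼 (λ x → ⟪ x μ.≟ x₀ ⟫) * F (φ x₀)     ≡⟨ μ.*-homoʳ (F (φ x₀)) (λ x → ⟪ x μ.≟ x₀ ⟫) ⟨
    μ.𝔼 (λ x → ⟪ x μ.≟ x₀ ⟫ * F (φ x₀))     ≡⟨ μ.≗-cong same ⟩
    μ.𝔼 (λ x → ⟪ φ x₀ ν.≟ φ x ⟫ * F (φ x))  ∎
    where
    same : ∀ x → ⟪ x μ.≟ x₀ ⟫ * F (φ x₀) ≡ ⟪ φ x₀ ν.≟ φ x ⟫ * F (φ x)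
    same x with x μ.≟ x₀
    ... | yes refl = cong (_* F (φ x₀)) (sym (⟪⟫-yes (φ x₀ ν.≟ φ x₀) refl))
    ... | no  x≢x₀ = trans (ℚ.*-zeroˡ (F (φ x₀))) (sym (trans
      (cong (_* F (φ x)) (⟪⟫-no (φ x₀ ν.≟ φ x) (λ e → x≢x₀ (sym (φ-injective e))))) (ℚ.*-zeroˡ (F (φ x)))))

-- Random affine maps and the test

independent? : ∀ {n k} (vs : Vec (𝔽₂^ n) k) → Dec (LinearlyIndependent vs)
independent? vs = all-by search-point (λ c → (combination vs c ≟ᵛ 𝟎) →-dec (c ≟ᵛ 𝟎))

span? : ∀ {n k} (vs : Vec (𝔽₂^ n) k) v → Dec (∃ λ c → combination vs c ≡ v)
span? vs v = search-point (λ c → combination vs c ≟ᵛ v)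

⊕-≡𝟎 : ∀ {n} {x y : 𝔽₂^ n} → x ⊕ y ≡ 𝟎 → x ≡ y
⊕-≡𝟎 {x = x} {y} x⊕y≡𝟎 = trans (sym (⊕-identityʳ x)) (trans (cong (x ⊕_) (sym x⊕y≡𝟎)) (⊕-cancelˡ x y))

independent-∷ : ∀ {n k} {vs : Vec (𝔽₂^ n) k} {v} → LinearlyIndependent vs →
                ¬ (∃ λ c → combination vs c ≡ v) → LinearlyIndependent (v ∷ vs)
independent-∷ {vs = vs} {v} ind v∉ (false ∷ c) e = cong (false ∷_) (ind c
  (trans (sym (trans (cong (_⊕ combination vs c) (scale-false v)) (⊕-identityˡ _))) e))
independent-∷ {vs = vs} {v} ind v∉ (true ∷ c) e = contradiction
  (c , sym (trans (sym (scale-true v)) (⊕-≡𝟎 e))) v∉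

-- A union bound: the span is covered by the 2^k vectors `combination vs c`, each hit with
-- probability ½^n. The factor ½^k turns the sum over `c` into a mean.
𝔼-span : ∀ {n k} (vs : Vec (𝔽₂^ n) k) → 𝔼 (λ v → ⟪ span? vs v ⟫) * ½ ^ℚ k ≤ ½ ^ℚ n
𝔼-span {n} {k} vs = begin
  𝔼 (λ v → ⟪ span? vs v ⟫) * ½ ^ℚ k           ≡⟨ *-homoʳ (½ ^ℚ k) (λ v → ⟪ span? vs v ⟫) ⟨
  𝔼 (λ v → ⟪ span? vs v ⟫ * ½ ^ℚ k)           ≤⟨ mono cover ⟩
  𝔼 (λ v → 𝔼 λ c → ⟪ v ≟ combination vs c ⟫)  ≡⟨ fubini isLinear (λ v c → ⟪ v ≟ combination vs c ⟫) ⟩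
  𝔼 (λ c → 𝔼 λ v → ⟪ v ≟ combination vs c ⟫)  ≡⟨ ≗-cong (λ c → trans (point (combination vs c)) (mass-point n)) ⟩
  𝔼 {𝔽₂^ k} (λ c → ½ ^ℚ n)                    ≡⟨ const {𝔽₂^ k} (½ ^ℚ n) ⟩
  ½ ^ℚ n                                      ∎
  where
  open ℚ.≤-Reasoning
  cover : ∀ v → ⟪ span? vs v ⟫ * ½ ^ℚ k ≤ 𝔼 (λ c → ⟪ v ≟ combination vs c ⟫)
  cover v with span? vs v
  ... | no _           = subst (_≤ 𝔼 (λ c → ⟪ v ≟ combination vs c ⟫)) (sym (ℚ.*-zeroˡ (½ ^ℚ k)))
                           (nonneg λ c → 𝟙-nonneg (does (v ≟ combination vs c)))
  ... | yes (c₀ , refl) = begin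
    1ℚ * ½ ^ℚ k                                     ≡⟨ ℚ.*-identityˡ (½ ^ℚ k) ⟩
    ½ ^ℚ k                                          ≡⟨ mass-point k ⟨
    mass {𝔽₂^ k}                                    ≡⟨ point c₀ ⟨
    𝔼 (λ c → ⟪ c ≟ c₀ ⟫)                            ≤⟨ mono (λ c → ⟪⟫-mono (c ≟ c₀) (combination vs c₀ ≟ combination vs c)
                                                         (λ e → cong (combination vs) (sym e))) ⟩
    𝔼 (λ c → ⟪ combination vs c₀ ≟ combination vs c ⟫) ∎

½^-pos : ∀ n → 0ℚ < ½ ^ℚ n
½^-pos zero    = 0<1
½^-pos (suc n) = *-pos (ℚ.positive⁻¹ ½) (½^-pos n)

½^≤1 : ∀ n → ½ ^ℚ n ≤ 1ℚ
½^≤1 zero    = ℚ.≤-refl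
½^≤1 (suc n) = ℚ.≤-trans (*-monoʳ (ℚ.nonNegative⁻¹ ½) (½^≤1 n)) (p≤p+q ½ (ℚ.nonNegative⁻¹ ½))

neg-mono : ∀ p {q r} → q ≤ r → p - r ≤ p - q
neg-mono p q≤r = ℚ.+-monoʳ-≤ p (ℚ.neg-antimono-≤ q≤r)

Pr-independent : ℕ → ℕ → ℚ
Pr-independent n k = 𝔼 {Vec (𝔽₂^ n) k} λ vs → ⟪ independent? vs ⟫

-- By `𝔼-span`, a fresh vector lies in the span of the `k` others with probability at most ½^(n-k),
-- which is ½^j.
Pr-independent-suc : ∀ j k → Pr-independent (j ℕ.+ k) k * (1ℚ - ½ ^ℚ j) ≤ Pr-independent (j ℕ.+ k) (suc k)
Pr-independent-suc j k = begin
  Pr-independent n k * (1ℚ - ½ ^ℚ j)       ≡⟨ *-homoʳ (1ℚ - ½ ^ℚ j) (λ vs → I vs) ⟨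
  𝔼 (λ vs → I vs * (1ℚ - ½ ^ℚ j))          ≤⟨ mono (λ vs → *-monoʳ (𝟙-nonneg (does (independent? vs))) (outside-span vs)) ⟩
  𝔼 (λ vs → I vs * 𝔼 (λ v → 1ℚ - S vs v))  ≡⟨ ≗-cong (λ vs → *-homo (I vs) (λ v → 1ℚ - S vs v)) ⟨
  𝔼 (λ vs → 𝔼 λ v → I vs * (1ℚ - S vs v))  ≤⟨ mono (λ vs → mono λ v → step vs v) ⟩
  𝔼 (λ vs → 𝔼 λ v → I⁺ v vs)               ≡⟨ fubini isLinear (λ vs v → I⁺ v vs) ⟩
  𝔼 (λ v → 𝔼 λ vs → I⁺ v vs)               ∎
  where
  open ℚ.≤-Reasoning
  n = j ℕ.+ k
  I : Vec (𝔽₂^ n) k → ℚ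
  I vs = ⟪ independent? vs ⟫
  I⁺ : 𝔽₂^ n → Vec (𝔽₂^ n) k → ℚ
  I⁺ v vs = ⟪ independent? (v ∷ vs) ⟫
  S : Vec (𝔽₂^ n) k → 𝔽₂^ n → ℚ
  S vs v = ⟪ span? vs v ⟫
  negate : ∀ p → 1ℚ + (- 1ℚ) * p ≡ 1ℚ - p
  negate = solve 1 (λ p → con 1ℚ :+ con (- 1ℚ) :* p := con 1ℚ :- p) refl
  outside-span : ∀ vs → 1ℚ - ½ ^ℚ j ≤ 𝔼 (λ v → 1ℚ - S vs v)
  outside-span vs = begin
    1ℚ - ½ ^ℚ j                     ≤⟨ neg-mono 1ℚ σ≤½^j ⟩
    1ℚ - 𝔼 (λ v → S vs v)           ≡⟨ negate (𝔼 λ v → S vs v) ⟨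
    1ℚ + (- 1ℚ) * 𝔼 (λ v → S vs v)  ≡⟨ affine 1ℚ (- 1ℚ) (S vs) ⟨
    𝔼 (λ v → 1ℚ + (- 1ℚ) * S vs v)  ≡⟨ ≗-cong (λ v → negate (S vs v)) ⟩
    𝔼 (λ v → 1ℚ - S vs v)           ∎
    where
    σ≤½^j : 𝔼 (S vs) ≤ ½ ^ℚ j
    σ≤½^j = ℚ.*-cancelʳ-≤-pos (½ ^ℚ k) {{positive (½^-pos k)}}
              (ℚ.≤-trans (𝔼-span vs) (ℚ.≤-reflexive (^-homo-* ½ j k)))
  step : ∀ vs v → I vs * (1ℚ - S vs v) ≤ I⁺ v vs
  step vs v with independent? vs | span? vs v
  ... | no _    | s      = subst (_≤ I⁺ v vs) (sym (ℚ.*-zeroˡ (1ℚ - ⟪ s ⟫))) (𝟙-nonneg (does (independent? (v ∷ vs))))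
  ... | yes _   | yes _  = 𝟙-nonneg (does (independent? (v ∷ vs)))
  ... | yes ind | no v∉  = ℚ.≤-reflexive (sym (⟪⟫-yes (independent? (v ∷ vs)) (independent-∷ ind v∉)))

-- The ambient dimension stays fixed, so removing a vector raises `j` and halves p = ½^j. Both the
-- remaining vectors and the new one then contribute 1 - p/2, and (1 - p/2)² ≥ 1 - p.
Pr-independent-≥ : ∀ j k → 1ℚ - ½ ^ℚ j ≤ Pr-independent (j ℕ.+ k) k
Pr-independent-≥ j zero = begin
  1ℚ - ½ ^ℚ j                 ≤⟨ neg-mono 1ℚ (ℚ.<⇒≤ (½^-pos j)) ⟩
  1ℚ                          ≡⟨ ⟪⟫-yes (independent? {j ℕ.+ 0} []) (λ { [] _ → refl }) ⟨
  Pr-independent (j ℕ.+ 0) 0  ∎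
  where open ℚ.≤-Reasoning
Pr-independent-≥ j (suc k) = subst (λ n → 1ℚ - p ≤ Pr-independent n (suc k)) (sym (ℕ.+-suc j k)) (begin
  1ℚ - p                                           ≤⟨ 0≤q-p⇒p≤q (subst (0ℚ ≤_)
                                                        (solve 1 (λ p → (con ½ :* p) :* (con ½ :* p)
                                                          := (con 1ℚ :- con ½ :* p) :* (con 1ℚ :- con ½ :* p) :- (con 1ℚ :- p)) refl p)
                                                        (p²-nonneg (½ * p))) ⟩
  (1ℚ - ½ * p) * (1ℚ - ½ * p)                    ≤⟨ *-monoˡ 0≤1-½p (Pr-independent-≥ (suc j) k) ⟩
  Pr-independent (suc j ℕ.+ k) k * (1ℚ - ½ * p)  ≤⟨ Pr-independent-suc (suc j) k ⟩
  Pr-independent (suc j ℕ.+ k) (suc k)           ∎)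
  where
  open ℚ.≤-Reasoning
  p = ½ ^ℚ j
  0≤1-½p : 0ℚ ≤ 1ℚ - ½ * p
  0≤1-½p = neg-mono 1ℚ (½^≤1 (suc j))

⊕-injectiveʳ : ∀ {n} (a : 𝔽₂^ n) {x y} → a ⊕ x ≡ a ⊕ y → x ≡ y
⊕-injectiveʳ a {x} {y} e = trans (sym (⊕-cancelˡ a x)) (trans (cong (a ⊕_) e) (⊕-cancelˡ a y))

combination-injective : ∀ {n k} (vs : Vec (𝔽₂^ n) k) → LinearlyIndependent vs →
                        ∀ {x y} → combination vs x ≡ combination vs y → x ≡ y
combination-injective vs ind {x} {y} e = ⊕-≡𝟎 (ind (x ⊕ y)
  (trans (combination-⊕ vs x y) (trans (cong (_⊕ combination vs y) e) (⊕-same (combination vs y)))))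

apply-injective : ∀ {n k} (φ : AffineMap k n) → LinearlyIndependent (proj₂ φ) →
                  ∀ {x y} → apply φ x ≡ apply φ y → x ≡ y
apply-injective (a , vs) ind e = combination-injective vs ind (⊕-injectiveʳ a e)

map-injective : ∀ {A B : Set} {f : A → B} → (∀ {x y} → f x ≡ f y → x ≡ y) →
                ∀ {n} {xs ys : Vec A n} → Vec.map f xs ≡ Vec.map f ys → xs ≡ ys
map-injective f-injective {xs = []}     {[]}     e = refl
map-injective f-injective {xs = x ∷ xs} {y ∷ ys} e =
  cong₂ _∷_ (f-injective (Vec.∷-injectiveˡ e)) (map-injective f-injective (Vec.∷-injectiveʳ e))

∘ᴬ-injective : ∀ {n k l} (φ : AffineMap k n) → LinearlyIndependent (proj₂ φ) →
               ∀ {ψ ψ′ : AffineMap l k} → φ ∘ᴬ ψ ≡ φ ∘ᴬ ψ′ → ψ ≡ ψ′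
∘ᴬ-injective φ ind e = cong₂ _,_
  (apply-injective φ ind (cong proj₁ e))
  (map-injective (combination-injective (proj₂ φ) ind) (cong proj₂ e))

-- A map from 𝔽₂^k to itself that parametrizes this set is an affine automorphism; these maps count
-- the parametrizations of any `k`-dimensional subspace.
everything : ∀ {n} → 𝔽₂^ n → Bool
everything _ = true

lift-vectors : ∀ {n k l} (us : Vec (𝔽₂^ n) k) (vs : Vec (𝔽₂^ n) l) →
               (∀ c → ∃ λ c′ → combination us c′ ≡ combination vs c) → ∃ λ cs → Vec.map (combination us) cs ≡ vs
lift-vectors us []       lift = [] , refl
lift-vectors us (v ∷ vs) lift =
  let c , c≡ = lift (true ∷ 𝟎)
      cs , cs≡ = lift-vectors us vs λ c → let c′ , c′≡ = lift (false ∷ c) in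
        c′ , trans c′≡ (trans (cong (_⊕ combination vs c) (scale-false v)) (⊕-identityˡ _))
  in  c ∷ cs , cong₂ _∷_ (trans c≡ (trans (cong₂ _⊕_ (scale-true v) (combination-𝟎 vs)) (⊕-identityʳ v))) cs≡

module _ {n k : ℕ} {A : 𝔽₂^ n → Bool} (φ : AffineMap k n) (φ-par : φ Parametrizes A) where

  factor : ∀ (φ′ : AffineMap k n) → φ′ Parametrizes A → ∃ λ ψ → φ ∘ᴬ ψ ≡ φ′
  factor φ′@(a , vs) (_ , φ′-par) =
    let cs , cs≡ = lift-vectors (proj₂ φ) vs lift in (c₀ , cs) , cong₂ _,_ c₀≡ cs≡
    where
    preimage : ∀ c → ∃ λ c′ → apply φ c′ ≡ apply φ′ c
    preimage c = Equivalence.to (proj₂ φ-par _) (Equivalence.from (φ′-par _) (c , refl))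
    c₀ = proj₁ (preimage 𝟎)
    c₀≡ : apply φ c₀ ≡ a
    c₀≡ = trans (proj₂ (preimage 𝟎)) (trans (cong (a ⊕_) (combination-𝟎 vs)) (⊕-identityʳ a))
    lift : ∀ c → ∃ λ c′ → combination (proj₂ φ) c′ ≡ combination vs c
    -- Two parametrizations need not share a base point, so the linear part is recovered as a
    -- difference, between the preimages `c₀` of the base point and `c′` of its translate.
    lift c = let c′ , c′≡ = preimage c in c₀ ⊕ c′ , ⊕-injectiveʳ a (begin
      a ⊕ combination (proj₂ φ) (c₀ ⊕ c′)           ≡⟨ cong (_⊕ combination (proj₂ φ) (c₀ ⊕ c′)) c₀≡ ⟨
      apply φ c₀ ⊕ combination (proj₂ φ) (c₀ ⊕ c′)  ≡⟨ apply-⊕ φ c₀ (c₀ ⊕ c′) ⟨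
      apply φ (c₀ ⊕ (c₀ ⊕ c′))                      ≡⟨ cong (apply φ) (⊕-cancelˡ c₀ c′) ⟩
      apply φ c′                                    ≡⟨ c′≡ ⟩
      a ⊕ combination vs c                          ∎)
      where open ≡-Reasoning

  ∘ᴬ-Parametrizes : (ψ : AffineMap k k) → (φ ∘ᴬ ψ) Parametrizes A ⇔ ψ Parametrizes everything
  ∘ᴬ-Parametrizes ψ@(_ , cs) = mk⇔ to from
    where
    us = proj₂ φ
    to : (φ ∘ᴬ ψ) Parametrizes A → ψ Parametrizes everything
    to (ind , par) = (λ x e → ind x (trans (combination-∘ us cs x) (trans (cong (combination us) e) (combination-𝟎 us))))
      , λ y → mk⇔ (λ _ → let x , x≡ = Equivalence.to (par (apply φ y)) (Equivalence.from (proj₂ φ-par _) (y , refl)) in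
                         x , apply-injective φ (proj₁ φ-par) (trans (sym (apply-∘ φ ψ x)) x≡))
                  (λ _ → refl)
    from : ψ Parametrizes everything → (φ ∘ᴬ ψ) Parametrizes A
    from (ind , par) = (λ x e → ind x (proj₁ φ-par _ (trans (sym (combination-∘ us cs x)) e)))
      , λ y → mk⇔
          (λ y∈ → let c , c≡ = Equivalence.to (proj₂ φ-par y) y∈
                      x , x≡ = Equivalence.to (par c) refl
                  in  x , trans (apply-∘ φ ψ x) (trans (cong (apply φ) x≡) c≡))
          (λ { (x , x≡) → Equivalence.from (proj₂ φ-par y) (apply ψ x , trans (sym (apply-∘ φ ψ x)) x≡) })

-- Every k-dimensional affine subspace has the same number of parametrizations: the right-hand
-- side does not depend on A.
Pr-Parametrizes : ∀ {n k} {A : 𝔽₂^ n → Bool} → IsAffineSubspace k A →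
  mass {AffineMap k k} * 𝔼 {AffineMap k n} (λ φ → ⟪ parametrizes? φ A ⟫) ≡
  mass {AffineMap k n} * 𝔼 {AffineMap k k} (λ ψ → ⟪ parametrizes? ψ everything ⟫)
Pr-Parametrizes {n} {k} {A} (φ₀ , φ₀-par) = trans
  (push (φ₀ ∘ᴬ_) (∘ᴬ-injective φ₀ (proj₁ φ₀-par)) (λ φ → ⟪ parametrizes? φ A ⟫) support)
  (cong (mass {AffineMap k n} *_) (Mean.≗-cong (×-mean {𝔽₂^ k} {Vec (𝔽₂^ k) k}) λ ψ →
    ⟪⟫-⇔ (parametrizes? (φ₀ ∘ᴬ ψ) A) (parametrizes? ψ everything) (∘ᴬ-Parametrizes φ₀ φ₀-par ψ)))
  where
  support : ∀ φ → ⟪ parametrizes? φ A ⟫ ≡ 0ℚ ⊎ ∃ λ ψ → φ₀ ∘ᴬ ψ ≡ φ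
  support φ = Sum.map₂ (factor φ₀ φ₀-par φ) (⟪⟫≡0⊎ (parametrizes? φ A))

functions-unique : ∀ n → Unique ((𝔽₂^ n) →-setoid Bool) (functions n)
functions-unique zero    = ((λ e → contradiction (e []) λ ()) ∷ []) ∷ [] ∷ []
functions-unique (suc n) = Unique.cartesianProductWith⁺ S S ((𝔽₂^ suc n) →-setoid Bool) glue
  (λ e → (λ x → e (false ∷ x)) , (λ x → e (true ∷ x))) (functions-unique n) (functions-unique n)
  where S = (𝔽₂^ n) →-setoid Bool

Parametrizes-unique : ∀ {n k} (φ : AffineMap k n) {A B} → φ Parametrizes A → φ Parametrizes B → A ≗ B
Parametrizes-unique φ {A} {B} (_ , A-par) (_ , B-par) y = both
  (λ Ay → Equivalence.from (B-par y) (Equivalence.to (A-par y) Ay))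
  (λ By → Equivalence.from (A-par y) (Equivalence.to (B-par y) By))
  where
  both : ∀ {a b} → (a ≡ true → b ≡ true) → (b ≡ true → a ≡ true) → a ≡ b
  both {false} {false} f g = refl
  both {false} {true}  f g = g refl
  both {true}          f g = sym (f refl)

∑-unique : ∀ {n} {P : (𝔽₂^ n → Bool) → Set} (P? : Decidable P) → (∀ {A B} → P A → P B → A ≗ B) →
           ∀ {xs} → Unique ((𝔽₂^ n) →-setoid Bool) xs → ∑ xs (λ A → ⟪ P? A ⟫) ≤ 1ℚ
∑-unique P? P-unique []            = 0≤1
∑-unique {P = P} P? P-unique {A ∷ xs} (A∉xs ∷ xs!) with P? A
... | no _   = subst (_≤ 1ℚ) (sym (ℚ.+-identityˡ _)) (∑-unique P? P-unique xs!)
... | yes PA = ℚ.≤-reflexive (trans (cong (λ q → 1ℚ + q)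
                 (∑-cong-All (All.map (λ {B} A≉B → ⟪⟫-no (P? B) (λ PB → A≉B (P-unique PA PB))) A∉xs)))
                 (trans (cong (λ q → 1ℚ + q) (∑-0 xs)) (ℚ.+-identityʳ 1ℚ)))
  where
  ∑-0 : ∀ xs → ∑ xs (λ _ → 0ℚ) ≡ 0ℚ
  ∑-0 []       = refl
  ∑-0 (_ ∷ xs) = trans (ℚ.+-identityˡ _) (∑-0 xs)

image : ∀ {n k} → AffineMap k n → 𝔽₂^ n → Bool
image φ y = does (search-point λ c → apply φ c ≟ᵛ y)

image-Parametrizes : ∀ {n k} (φ : AffineMap k n) {A} → LinearlyIndependent (proj₂ φ) → A ≗ image φ → φ Parametrizes A
image-Parametrizes φ ind A≗ = ind , λ y → mk⇔
  (λ y∈ → extract y (trans (sym (A≗ y)) y∈))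
  (λ e → trans (A≗ y) (dec-true (search-point λ c → apply φ c ≟ᵛ y) e))
  where
  extract : ∀ y → image φ y ≡ true → ∃ λ c → apply φ c ≡ y
  extract y = does⇒ (search-point λ c → apply φ c ≟ᵛ y)

-- If `f ∘ apply φ` were even it would have degree at most `d`. Every other parametrization of `A`
-- is `φ ∘ᴬ ψ`, and composing with `ψ` preserves `Flat`, so all of them would be accepted.
reject⇒odd : ∀ {n d f A} (φ : AffineMap (suc d) n) → ¬ Accepts d f A → φ Parametrizes A → odd f φ ≡ true
reject⇒odd {d = d} {f} {A} φ rejects φ-par with odd f φ in parity-φ
... | true  = refl
... | false = contradiction accepts rejects
  where
  accepts : Accepts d f A
  accepts φ′ φ′-par =
    let ψ , φ∘ψ≡φ′ = factor φ φ-par φ′ φ′-par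
        flat = Flat-apply d ψ {f ∘ apply φ} (Deg≤⇒Flat (even⇒Deg≤ (f ∘ apply φ) parity-φ))
    in  even⇒Deg≤ (f ∘ apply φ′) (Flat⇒even (Flat-cong d
          (λ x → cong f (trans (sym (apply-∘ φ ψ x)) (cong (λ φ → apply φ x) φ∘ψ≡φ′))) flat))

Pr-nonneg : {X : Set} {P : X → Set} (P? : Decidable P) (xs : List X) → 0ℚ ≤ Pr xs P?
Pr-nonneg P? []          = ℚ.≤-refl
Pr-nonneg P? xs@(_ ∷ ys) = ℚ.nonNegative⁻¹ _ {{ℚ.normalize-nonNeg (length (filter P? xs)) (suc (length ys))}}

-- Here `w y x` tells whether `y` represents `x`, and all `x` carry equal weight. The total weight
-- is at least `𝔼 F`, the share of it on `P` is exactly `Pr xs P?`, and that share is at most `𝔼 G`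
-- because `G` dominates wherever `P` is represented.
double-counting : {X Y : Set} {{_ : Mean Y}} (xs : List X) {P : X → Set} (P? : Decidable P)
  (w : Y → X → ℚ) (F G : Y → ℚ) {m c : ℚ} → 0ℚ < m →
  All (λ x → m * 𝔼 (λ y → w y x) ≡ c) xs →
  (∀ y → F y ≤ ∑ xs (w y)) → (∀ y → ∑ xs (w y) ≤ 1ℚ) →
  (∀ y → 0ℚ ≤ G y) → (∀ y x → ⟪ P? x ⟫ * w y x ≤ G y * w y x) →
  Pr xs P? * 𝔼 F ≤ 𝔼 G
double-counting xs P? w F G {m} {c} 0<m weight F≤ ≤1 0≤G P≤G =
  ℚ.*-cancelˡ-≤-pos m {{positive 0<m}} (begin
    m * (Pr xs P? * 𝔼 F)            ≡⟨ swap m (Pr xs P?) (𝔼 F) ⟩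
    Pr xs P? * (m * 𝔼 F)            ≤⟨ *-monoʳ (Pr-nonneg P? xs) all≤ ⟩
    Pr xs P? * (ι (length xs) * c)  ≡⟨ ℚ.*-assoc (Pr xs P?) (ι (length xs)) c ⟨
    Pr xs P? * ι (length xs) * c    ≡⟨ cong (_* c) (Pr-*-length P? xs) ⟩
    ∑ xs p * c                      ≤⟨ P≤ ⟩
    m * 𝔼 G                         ∎)
  where
  open ℚ.≤-Reasoning
  module ∑xs = IsLinear (∑-linear xs)
  p = λ x → ⟪ P? x ⟫
  swap : ∀ a b c → a * (b * c) ≡ b * (a * c)
  swap = solve 3 (λ a b c → a :* (b :* c) := b :* (a :* c)) refl
  all≤ : m * 𝔼 F ≤ ι (length xs) * c
  all≤ = begin
    m * 𝔼 F                           ≤⟨ *-monoʳ (ℚ.<⇒≤ 0<m) (mono F≤) ⟩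
    m * 𝔼 (λ y → ∑ xs (w y))          ≡⟨ cong (m *_) (fubini (∑-linear xs) w) ⟩
    m * ∑ xs (λ x → 𝔼 (λ y → w y x))  ≡⟨ ∑xs.*-homo m (λ x → 𝔼 (λ y → w y x)) ⟨
    ∑ xs (λ x → m * 𝔼 (λ y → w y x))  ≡⟨ ∑-cong-All (All.map (λ e → trans e (sym (ℚ.*-identityˡ c))) weight) ⟩
    ∑ xs (λ _ → 1ℚ * c)               ≡⟨ ∑xs.*-homoʳ c (λ _ → 1ℚ) ⟩
    ∑ xs (λ _ → 1ℚ) * c               ≡⟨ cong (_* c) (∑-1 xs) ⟩
    ι (length xs) * c                 ∎
  bound : ∀ y → ∑ xs (λ x → p x * w y x) ≤ G y
  bound y = begin
    ∑ xs (λ x → p x * w y x)  ≤⟨ ∑-mono (All.universal (P≤G y) xs) ⟩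
    ∑ xs (λ x → G y * w y x)  ≡⟨ ∑xs.*-homo (G y) (w y) ⟩
    G y * ∑ xs (w y)          ≤⟨ *-monoʳ (0≤G y) (≤1 y) ⟩
    G y * 1ℚ                  ≡⟨ ℚ.*-identityʳ (G y) ⟩
    G y                       ∎
  P≤ : ∑ xs p * c ≤ m * 𝔼 G
  P≤ = begin
    ∑ xs p * c                                ≡⟨ ∑xs.*-homoʳ c p ⟨
    ∑ xs (λ x → p x * c)                      ≡⟨ ∑-cong-All (All.map (λ {x} e → cong (p x *_) e) weight) ⟨
    ∑ xs (λ x → p x * (m * 𝔼 (λ y → w y x)))  ≡⟨ ∑xs.≗-cong (λ x → trans (swap (p x) m (𝔼 (λ y → w y x)))
                                                   (cong (m *_) (sym (*-homo (p x) (λ y → w y x))))) ⟩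
    ∑ xs (λ x → m * 𝔼 (λ y → p x * w y x))  ≡⟨ ∑xs.*-homo m (λ x → 𝔼 (λ y → p x * w y x)) ⟩
    m * ∑ xs (λ x → 𝔼 (λ y → p x * w y x))  ≡⟨ cong (m *_) (fubini (∑-linear xs) (λ y x → p x * w y x)) ⟨
    m * 𝔼 (λ y → ∑ xs (λ x → p x * w y x))  ≤⟨ *-monoʳ (ℚ.<⇒≤ 0<m) (mono bound) ⟩
    m * 𝔼 G                                 ∎

-- Given independent directions, the image of a uniform affine map is a uniform subspace, and if
-- that subspace is rejected then the map is odd.
Pr-rejects-≤ : ∀ d {n} (f : 𝔽₂^ n → Bool) → Pr-rejects d f * Pr-independent n (suc d) ≤ R (suc d) f
Pr-rejects-≤ d {n} f = subst₂ _≤_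
  -- Independence concerns the directions alone, so the mean over the base point is that of a
  -- constant.
  (cong (Pr-rejects d f *_) (const {𝔽₂^ n} (Pr-independent n k)))
  (sym (R≡𝔼-odd k f))
  (double-counting 𝔸 (λ A → ¬? (accepts? d f A)) par (λ φ → ⟪ independent? (proj₂ φ) ⟫) (λ φ → 𝟙 (odd {k} f φ))
    (mass>0 {AffineMap k k})
    (All.map (λ {A} → Pr-Parametrizes {A = A}) (all-filter (isAffineSubspace? k) (functions n)))
    one-≤ ≤-one (λ φ → 𝟙-nonneg (odd {k} f φ)) rejects≤)
  where
  k = suc d
  𝔸 = affineSubspaces n k
  par : AffineMap k n → (𝔽₂^ n → Bool) → ℚ
  par φ A = ⟪ parametrizes? φ A ⟫
  0≤par : ∀ φ A → 0ℚ ≤ par φ A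
  0≤par φ A = 𝟙-nonneg (does (parametrizes? φ A))

  one-≤ : ∀ φ → ⟪ independent? (proj₂ φ) ⟫ ≤ ∑ 𝔸 (par φ)
  one-≤ φ = ⟪⟫≤ (independent? (proj₂ φ)) (∑-nonneg 𝔸 (0≤par φ)) λ ind →
    let A , A∈ , A≗ = functions-complete (image φ)
        φ-par = image-Parametrizes φ ind A≗
    in  ℚ.≤-trans (ℚ.≤-reflexive (sym (⟪⟫-yes (parametrizes? φ A) φ-par)))
          (∑-∈ (0≤par φ) (∈-filter⁺ (isAffineSubspace? k) A∈ (φ , φ-par)))

  ≤-one : ∀ φ → ∑ 𝔸 (par φ) ≤ 1ℚ
  ≤-one φ = ∑-unique (parametrizes? φ) (Parametrizes-unique φ)
    (Unique.filter⁺ ((𝔽₂^ n) →-setoid Bool) (isAffineSubspace? k) (functions-unique n))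

  rejects≤ : ∀ φ A → ⟪ ¬? (accepts? d f A) ⟫ * par φ A ≤ 𝟙 (odd {k} f φ) * par φ A
  rejects≤ φ A = ⟪⟫*⟪⟫≤ (¬? (accepts? d f A)) (parametrizes? φ A) (reject⇒odd {f = f} φ)

-- The whole space as the only subspace, and distances there

injective⇒surjective : ∀ {n} (φ : 𝔽₂^ n → 𝔽₂^ n) → (∀ {x y} → φ x ≡ φ y → x ≡ y) → ∀ y → ∃ λ x → φ x ≡ y
injective⇒surjective {n} φ φ-injective y with search-point (λ x → φ x ≟ᵛ y)
... | yes e = e
... | no y∉ = contradiction 1≤1-m (<⇒≱ 1-m<1)
  where
  open ℚ.≤-Reasoning
  m = mass {𝔽₂^ n}
  hit? : ∀ z → Dec (∃ λ x → φ x ≡ z)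
  hit? z = search-point (λ x → φ x ≟ᵛ z)
  hit : 𝔽₂^ n → ℚ
  hit z = ⟪ hit? z ⟫
  1-m<1 : 1ℚ + (- 1ℚ) * m < 1ℚ
  1-m<1 = ℚ.+-monoʳ-< 1ℚ (ℚ.*-monoʳ-<-neg (- 1ℚ) (mass>0 {𝔽₂^ n}))
  -- Pigeonhole by averaging: changing variables along `φ` shows that the image has measure 1,
  -- whereas missing `y` would cost the mass of a point.
  𝔼-hit : m * 1ℚ ≡ m * 𝔼 hit
  𝔼-hit = sym (trans (push φ φ-injective hit (λ z → ⟪⟫≡0⊎ (hit? z))) (cong (m *_)
    (trans (≗-cong λ x → ⟪⟫-yes (hit? (φ x)) (x , refl)) (const {𝔽₂^ n} 1ℚ))))
  hit≤ : ∀ z → hit z ≤ 1ℚ + (- 1ℚ) * ⟪ z ≟ y ⟫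
  hit≤ z = ⟪⟫≤ (hit? z) (bound (z ≟ y)) λ e → ℚ.≤-reflexive (sym (cong (λ p → 1ℚ + (- 1ℚ) * p)
    (⟪⟫-no (z ≟ y) λ { refl → y∉ e })))
    where
    bound : ∀ {P : Set} (P? : Dec P) → 0ℚ ≤ 1ℚ + (- 1ℚ) * ⟪ P? ⟫
    bound (yes _) = ℚ.≤-refl
    bound (no _)  = 0≤1
  1≤1-m : 1ℚ ≤ 1ℚ + (- 1ℚ) * m
  1≤1-m = begin
    1ℚ                                 ≤⟨ ℚ.*-cancelˡ-≤-pos m {{positive (mass>0 {𝔽₂^ n})}} (ℚ.≤-reflexive 𝔼-hit) ⟩
    𝔼 hit                              ≤⟨ mono hit≤ ⟩
    𝔼 (λ z → 1ℚ + (- 1ℚ) * ⟪ z ≟ y ⟫)  ≡⟨ affine 1ℚ (- 1ℚ) (λ z → ⟪ z ≟ y ⟫) ⟩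
    1ℚ + (- 1ℚ) * 𝔼 (λ z → ⟪ z ≟ y ⟫)  ≡⟨ cong (λ p → 1ℚ + (- 1ℚ) * p) (point y) ⟩
    1ℚ + (- 1ℚ) * m                    ∎

-- Independent directions make `apply φ` bijective with an affine inverse. Were `f ∘ apply φ` even,
-- it would have degree at most `d`, and composing with the inverse would make `f` even.
independent⇒odd : ∀ {d} (f : 𝔽₂^ suc d → Bool) (φ : AffineMap (suc d) (suc d)) →
                  parity f ≡ true → LinearlyIndependent (proj₂ φ) → odd f φ ≡ true
independent⇒odd {d} f φ@(a , vs) f-odd ind with odd f φ in parity-φ
... | true  = refl
... | false = contradiction (trans (sym f-odd) (Flat⇒even {f = f} (Flat-cong d f∘φ∘φ⁻¹
    (Flat-∘ d φ⁻¹ inverse φ⁻¹-⊕ (Deg≤⇒Flat (even⇒Deg≤ (f ∘ apply φ) parity-φ)))))) λ ()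
  where
  surjective = injective⇒surjective (combination vs) (combination-injective vs ind)
  inverse : 𝔽₂^ suc d → 𝔽₂^ suc d
  inverse y = proj₁ (surjective y)
  combination-inverse : ∀ y → combination vs (inverse y) ≡ y
  combination-inverse y = proj₂ (surjective y)
  φ⁻¹ : 𝔽₂^ suc d → 𝔽₂^ suc d
  φ⁻¹ y = inverse (a ⊕ y)
  φ⁻¹-⊕ : ∀ x y → φ⁻¹ (x ⊕ y) ≡ φ⁻¹ x ⊕ inverse y
  φ⁻¹-⊕ x y = combination-injective vs ind (begin
    combination vs (φ⁻¹ (x ⊕ y))                         ≡⟨ combination-inverse (a ⊕ (x ⊕ y)) ⟩
    a ⊕ (x ⊕ y)                                          ≡⟨ ⊕-assoc a x y ⟨
    (a ⊕ x) ⊕ y                                          ≡⟨ cong₂ _⊕_ (combination-inverse (a ⊕ x)) (combination-inverse y) ⟨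
    combination vs (φ⁻¹ x) ⊕ combination vs (inverse y)  ≡⟨ combination-⊕ vs (φ⁻¹ x) (inverse y) ⟨
    combination vs (φ⁻¹ x ⊕ inverse y)                   ∎)
    where open ≡-Reasoning
  f∘φ∘φ⁻¹ : ∀ y → f (apply φ (φ⁻¹ y)) ≡ f y
  f∘φ∘φ⁻¹ y = cong f (trans (cong (a ⊕_) (combination-inverse (a ⊕ y))) (⊕-cancelˡ a y))

independent≤R : ∀ d (f : 𝔽₂^ suc d → Bool) → parity f ≡ true → Pr-independent (suc d) (suc d) ≤ R (suc d) f
independent≤R d f f-odd = subst₂ _≤_ (const {𝔽₂^ suc d} (Pr-independent (suc d) (suc d))) (sym (R≡𝔼-odd (suc d) f))
  (mono {AffineMap (suc d) (suc d)} λ φ → ⟪⟫≤ (independent? (proj₂ φ)) (𝟙-nonneg (odd {suc d} f φ))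
    λ ind → ℚ.≤-reflexive (cong 𝟙 (sym (independent⇒odd f φ f-odd ind))))

-- At `j = 0` the bound of `Pr-independent-≥` is 0, so the last direction is split off: the first
-- `d` are independent, and the last avoids their span, each with probability at least ½.
¼≤Pr-independent : ∀ d → ½ * ½ ≤ Pr-independent (suc d) (suc d)
¼≤Pr-independent d = ℚ.≤-trans (*-monoˡ (ℚ.nonNegative⁻¹ ½) (Pr-independent-≥ 1 d)) (Pr-independent-suc 1 d)

½≤Pr-independent : ∀ j k → ½ ≤ Pr-independent (suc j ℕ.+ k) k
½≤Pr-independent j k = ℚ.≤-trans
  (neg-mono 1ℚ (*-monoʳ (ℚ.nonNegative⁻¹ ½) (½^≤1 j))) (Pr-independent-≥ (suc j) k)

R-nonneg : ∀ k {n} (f : 𝔽₂^ n → Bool) → 0ℚ ≤ R k f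
R-nonneg zero    f = nonneg λ x → 𝟙-nonneg (f x)
R-nonneg (suc k) f = nonneg λ y → R-nonneg k (D y f)

𝔼-isZero : ∀ n → 𝔼 (𝟙 ∘ isZero {n}) ≡ ½ ^ℚ n
𝔼-isZero zero    = refl
𝔼-isZero (suc n) = cong (½ *_) (trans (cong₂ _+_ (𝔼-isZero n) (const {𝔽₂^ n} 0ℚ)) (ℚ.+-identityʳ (½ ^ℚ n)))

δ≤0 : ∀ {d n} (f : 𝔽₂^ n → Bool) → Deg≤ d f → δ d f ≤ 0ℚ
δ≤0 {d} {n} f deg = begin
  δ d f                 ≤⟨ δ≤distance f deg ⟩
  distance f f          ≡⟨ distance≡𝔼 f f ⟩
  𝔼 (𝟙 ∘ (f ⊞ f))       ≡⟨ ≗-cong (λ x → cong 𝟙 (Bool.xor-same (f x))) ⟩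
  𝔼 {𝔽₂^ n} (λ _ → 0ℚ)  ≡⟨ const {𝔽₂^ n} 0ℚ ⟩
  0ℚ                    ∎
  where open ℚ.≤-Reasoning

δ≤½^ : ∀ d (f : 𝔽₂^ suc d → Bool) → parity f ≡ true → δ d f ≤ ½ ^ℚ suc d
δ≤½^ d f f-odd = begin
  δ d f                            ≤⟨ δ≤distance f (even⇒Deg≤ (f ⊞ isZero) even) ⟩
  distance f (f ⊞ isZero)          ≡⟨ distance≡𝔼 f (f ⊞ isZero) ⟩
  𝔼 (𝟙 ∘ (f ⊞ (f ⊞ isZero)))       ≡⟨ ≗-cong (λ x → cong 𝟙 (trans (sym (Bool.xor-assoc (f x) (f x) (isZero x)))
                                        (cong (_xor isZero x) (Bool.xor-same (f x))))) ⟩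
  𝔼 (𝟙 ∘ isZero {suc d})           ≡⟨ 𝔼-isZero (suc d) ⟩
  ½ ^ℚ suc d                       ∎
  where
  open ℚ.≤-Reasoning
  even : parity (f ⊞ isZero) ≡ false
  even = trans (parity-⊞ f isZero) (cong₂ _xor_ f-odd (parity-isZero (suc d)))

-- Powers of two as rationals, and the lower bound for ρ

ι-* : ∀ m n → ι (m ℕ.* n) ≡ ι m * ι n
ι-* m n = ℚ.toℚᵘ-injective (begin-equality
  toℚᵘ (ι (m ℕ.* n))                    ≃⟨ toℚᵘ-/ (+ (m ℕ.* n)) 0 ⟩
  ℚᵘ.mkℚᵘ (+ (m ℕ.* n)) 0               ≃⟨ ℚᵘ.*≡* (cong (ℤ._* + 1) (ℤ.pos-* m n)) ⟩
  ℚᵘ.mkℚᵘ (+ m) 0 ℚᵘ.* ℚᵘ.mkℚᵘ (+ n) 0  ≃⟨ ℚᵘ.*-cong (toℚᵘ-/ (+ m) 0) (toℚᵘ-/ (+ n) 0) ⟨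
  toℚᵘ (ι m) ℚᵘ.* toℚᵘ (ι n)            ≃⟨ ℚ.toℚᵘ-homo-* (ι m) (ι n) ⟨
  toℚᵘ (ι m * ι n)                      ∎)
  where open ℚᵘ.≤-Reasoning

ι-injective : ∀ {m n} → ι m ≡ ι n → m ≡ n
ι-injective {m} {n} ιm≡ιn with ℚᵘ.≃-trans (ℚᵘ.≃-sym (toℚᵘ-/ (+ m) 0)) (ℚᵘ.≃-trans (ℚᵘ.≃-reflexive (cong toℚᵘ ιm≡ιn)) (toℚᵘ-/ (+ n) 0))
... | ℚᵘ.*≡* m*1≡n*1 = ℤ.+-injective (trans (sym (ℤ.*-identityʳ (+ m))) (trans m*1≡n*1 (ℤ.*-identityʳ (+ n))))

ι-nonneg : ∀ n → 0ℚ ≤ ι n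
ι-nonneg n = ℚ.nonNegative⁻¹ (ι n) {{ℚ.normalize-nonNeg n 1}}

ι2^-½^ : ∀ d → ι (2 ℕ.^ d) * ½ ^ℚ d ≡ 1ℚ
ι2^-½^ zero    = refl
ι2^-½^ (suc d) = begin
  ι (2 ℕ.* 2 ℕ.^ d) * (½ * ½ ^ℚ d)  ≡⟨ cong (_* (½ * ½ ^ℚ d)) (ι-* 2 (2 ℕ.^ d)) ⟩
  ι 2 * ι (2 ℕ.^ d) * (½ * ½ ^ℚ d)  ≡⟨ solve 2 (λ a b → con (ι 2) :* a :* (con ½ :* b) := a :* b) refl (ι (2 ℕ.^ d)) (½ ^ℚ d) ⟩
  ι (2 ℕ.^ d) * ½ ^ℚ d              ≡⟨ ι2^-½^ d ⟩
  1ℚ                                ∎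
  where open ≡-Reasoning

halve-≤ : ∀ {p q} → p + p ≤ q + q → p ≤ q
halve-≤ {p} {q} p+p≤q+q = subst₂ _≤_ (half p) (half q) (*-monoʳ (ℚ.nonNegative⁻¹ ½) p+p≤q+q)
  where
  half : ∀ p → ½ * (p + p) ≡ p
  half = solve 1 (λ p → con ½ :* (p :+ p) := p) refl

δ-Deg≤⇒≤R : ∀ {d n s} (f : 𝔽₂^ n → Bool) → Deg≤ d f → s < ι (2 ℕ.^ d) * δ d f → s ≤ R (suc d) f + R (suc d) f
δ-Deg≤⇒≤R {d} {s = s} f deg s<δ = begin
  s                          ≤⟨ ℚ.<⇒≤ s<δ ⟩
  ι (2 ℕ.^ d) * δ d f        ≤⟨ *-monoʳ (ι-nonneg (2 ℕ.^ d)) (δ≤0 f deg) ⟩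
  ι (2 ℕ.^ d) * 0ℚ           ≡⟨ ℚ.*-zeroʳ (ι (2 ℕ.^ d)) ⟩
  0ℚ                         ≤⟨ +-nonneg (R-nonneg (suc d) f) (R-nonneg (suc d) f) ⟩
  R (suc d) f + R (suc d) f  ∎
  where open ℚ.≤-Reasoning

-- For odd `f`, 2^d δ is at most 2^d · 2^-(d+1) = ½, which is exactly twice the ¼ available for `R`.
δ-whole-space : ∀ {d n s} → n ≡ suc d → (f : 𝔽₂^ n → Bool) → s < ι (2 ℕ.^ d) * δ d f → s ≤ R (suc d) f + R (suc d) f
δ-whole-space {d} {s = s} refl f s<δ = by-parity (parity f) refl
  where
  open ℚ.≤-Reasoning
  by-parity : ∀ b → parity f ≡ b → s ≤ R (suc d) f + R (suc d) f
  by-parity false f-even = δ-Deg≤⇒≤R f (even⇒Deg≤ f f-even) s<δ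
  by-parity true  f-odd  = begin
    s                           ≤⟨ ℚ.<⇒≤ s<δ ⟩
    ι (2 ℕ.^ d) * δ d f         ≤⟨ *-monoʳ (ι-nonneg (2 ℕ.^ d)) (δ≤½^ d f f-odd) ⟩
    ι (2 ℕ.^ d) * (½ * ½ ^ℚ d)  ≡⟨ solve 2 (λ a b → a :* (con ½ :* b) := con ½ :* (a :* b)) refl (ι (2 ℕ.^ d)) (½ ^ℚ d) ⟩
    ½ * (ι (2 ℕ.^ d) * ½ ^ℚ d)  ≡⟨ cong (½ *_) (ι2^-½^ d) ⟩
    ½ * ½ + ½ * ½               ≤⟨ ℚ.+-mono-≤ ¼≤R ¼≤R ⟩
    R (suc d) f + R (suc d) f   ∎
    where
    ¼≤R = ℚ.≤-trans (¼≤Pr-independent d) (independent≤R d f f-odd)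

δ-large : ∀ {ε₁} → TestBound ε₁ → ∀ {d n} j → suc j ℕ.+ suc d ≡ n → (f : 𝔽₂^ n → Bool) → ∀ {s} →
          s < ι (2 ℕ.^ d) * δ d f → L ε₁ s → s ≤ R (suc d) f + R (suc d) f
δ-large bound {d} {n} j refl f {s} s<δ s<ε = begin
  s                          ≤⟨ ℚ.<⇒≤ (bound d n (ℕ.m≤n+m (suc d) (suc j)) f (s<δ , s<ε)) ⟩
  rej                        ≡⟨ solve 1 (λ p → p := p :* con ½ :+ p :* con ½) refl rej ⟩
  rej * ½ + rej * ½          ≤⟨ ℚ.+-mono-≤ ½rej≤R ½rej≤R ⟩
  R (suc d) f + R (suc d) f  ∎
  where
  open ℚ.≤-Reasoning
  rej = Pr-rejects d f
  ½rej≤R : rej * ½ ≤ R (suc d) f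
  ½rej≤R = ℚ.≤-trans (*-monoʳ (Pr-nonneg (λ A → ¬? (accepts? d f A)) (affineSubspaces n (suc d))) (½≤Pr-independent j (suc d))) (Pr-rejects-≤ d f)

-- The rational `s` stands for a number below 2 min{ε₁/4, 2^(d-2) δ}; doubling it clears the
-- denominators. Quantifying over `s` replaces the comparison of a real minimum with `R`.
R-lower-bound : ∀ ε₁ → TestBound ε₁ → ∀ d {n} (f : 𝔽₂^ n → Bool) {s} →
                s + s < ι (2 ℕ.^ d) * δ d f → L ε₁ (s + s) → s ≤ R (suc d) f
R-lower-bound ε₁ bound d {n} f {s} s<δ s<ε = halve-≤ (by-dimension (ℕ.<-cmp n (suc d)))
  where
  by-dimension : Tri (n ℕ.< suc d) (n ≡ suc d) (suc d ℕ.< n) → s + s ≤ R (suc d) f + R (suc d) f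
  by-dimension (tri< n≤d _ _)   = δ-Deg≤⇒≤R {d} f (Deg≤-dimension f (ℕ.s≤s⁻¹ n≤d)) s<δ
  by-dimension (tri≈ _ n≡1+d _) = δ-whole-space n≡1+d f s<δ
  by-dimension (tri> _ _ 1+d<n) = δ-large {ε₁} bound (n ℕ.∸ suc (suc d))
    (trans (sym (ℕ.+-suc (n ℕ.∸ suc (suc d)) (suc d))) (ℕ.m∸n+n≡m 1+d<n)) f s<δ s<ε

-- The XOR lemma

-- The exponent is stored in lowest terms, so its numerator and denominator need not be the given
-- ones; the final equation keeps the relation between them.
U-power : ∀ x (e : ℚ⁺) {q} → U (x ^ e) q → 0ℚ < q × ∃ λ r → U x r ×
          ∃₂ λ a b → r ^ℚ suc a < q ^ℚ suc b × value e * ι (suc b) ≡ ι (suc a)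
U-power x (mkℚ⁺ p@(mkℚ +[1+ a ] b _)) (0<q , r , _ , r∈x , rᵃ<qᵇ) =
  0<q , r , r∈x , a , b , rᵃ<qᵇ ,
  trans (cong (_* ι (suc b)) (sym (ℚ.↥p/↧p≡p p))) (/-*-ι +[1+ a ] (suc b))

-- `K` is 1 for the explicit bound; for the exponential one, its reciprocal is the constant hidden
-- in Ω.
cross-multiply : ∀ K a b t d .{{_ : NonZero K}} .{{_ : NonZero t}} →
                 (+ 1 / K) * value (t /2^ d) * ι b ≡ ι a → K ℕ.* a ℕ.* 2 ℕ.^ d ≡ t ℕ.* b
cross-multiply K a b t d eq = ι-injective (begin
  ι (K ℕ.* a ℕ.* 2 ℕ.^ d)                            ≡⟨ trans (ι-* (K ℕ.* a) (2 ℕ.^ d)) (cong (_* ι (2 ℕ.^ d)) (ι-* K a)) ⟩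
  ι K * ι a * ι (2 ℕ.^ d)                            ≡⟨ cong (λ p → ι K * p * ι (2 ℕ.^ d)) eq ⟨
  ι K * (1/K * T * ι b) * ι (2 ℕ.^ d)                ≡⟨ solve 5 (λ k k′ t b p → k :* (k′ :* t :* b) :* p := (k′ :* k) :* (t :* p) :* b)
                                                          refl (ι K) 1/K T (ι b) (ι (2 ℕ.^ d)) ⟩
  (1/K * ι K) * (T * ι (2 ℕ.^ d)) * ι b  ≡⟨ cong₂ (λ p q → p * q * ι b) (/-*-ι (+ 1) K) (/-*-ι (+ t) (2 ℕ.^ d) {{ℕ.m^n≢0 2 d}}) ⟩
  1ℚ * ι t * ι b                         ≡⟨ cong (_* ι b) (ℚ.*-identityˡ (ι t)) ⟩
  ι t * ι b                              ≡⟨ ι-* t b ⟨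
  ι (t ℕ.* b)                            ∎)
  where
  open ≡-Reasoning
  1/K = + 1 / K
  T = value (t /2^ d)

^-mono-<′ : ∀ n .{{_ : NonZero n}} {p q} → 0ℚ ≤ p → p < q → p ^ℚ n < q ^ℚ n
^-mono-<′ (suc n) = ^-mono-< n

-- Roots are avoided by comparing powers with exponent 2^d (b + 1). There `bias-^⊕` bounds the left
-- side by a power of 1 - ρ, and `eq` regroups its exponent as K (a + 1) 2^d.
∣bias∣< : ∀ d {n} (f : 𝔽₂^ n → Bool) t {g} → Deg≤ d g → ∀ K a b {q r} →
          K ℕ.* suc a ℕ.* 2 ℕ.^ d ≡ t ℕ.* suc b → (1ℚ - R (suc d) f) ^ℚ K ≤ r →
          0ℚ < q → r ^ℚ suc a < q ^ℚ suc b → ∣ bias (f ^⊕ t ⊞ g) ∣ < q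
∣bias∣< d f t {g} deg K a b {q} {r} eq ρᴷ≤r 0<q rᵃ<qᵇ = ^-cancel-< (m ℕ.* suc b) (ℚ.<⇒≤ 0<q) (begin-strict
  β ^ℚ (m ℕ.* suc b)          ≡⟨ ^-assocʳ β m (suc b) ⟨
  (β ^ℚ m) ^ℚ suc b           ≤⟨ ^-mono-≤ (suc b) (^-nonneg m (ℚ.0≤∣p∣ (bias (f ^⊕ t ⊞ g)))) (bias-^⊕ d f t (Deg≤⇒Flat deg)) ⟩
  (ρ ^ℚ t) ^ℚ suc b           ≡⟨ ^-assocʳ ρ t (suc b) ⟩
  ρ ^ℚ (t ℕ.* suc b)          ≡⟨ cong (ρ ^ℚ_) (trans (sym eq) (ℕ.*-assoc K (suc a) m)) ⟩
  ρ ^ℚ (K ℕ.* (suc a ℕ.* m))  ≡⟨ ^-assocʳ ρ K (suc a ℕ.* m) ⟨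
  (ρ ^ℚ K) ^ℚ (suc a ℕ.* m)   ≤⟨ ^-mono-≤ (suc a ℕ.* m) (^-nonneg K 0≤ρ) ρᴷ≤r ⟩
  r ^ℚ (suc a ℕ.* m)          ≡⟨ ^-assocʳ r (suc a) m ⟨
  (r ^ℚ suc a) ^ℚ m           <⟨ ^-mono-<′ m {{ℕ.m^n≢0 2 d}} (^-nonneg (suc a) (ℚ.≤-trans (^-nonneg K 0≤ρ) ρᴷ≤r)) rᵃ<qᵇ ⟩
  (q ^ℚ suc b) ^ℚ m           ≡⟨ ^-assocʳ q (suc b) m ⟩
  q ^ℚ (suc b ℕ.* m)          ≡⟨ cong (q ^ℚ_) (ℕ.*-comm (suc b) m) ⟩
  q ^ℚ (m ℕ.* suc b)          ∎)
  where
  open ℚ.≤-Reasoning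
  m = 2 ℕ.^ d
  β = ∣ bias (f ^⊕ t ⊞ g) ∣
  ρ = 1ℚ - R (suc d) f
  0≤ρ = ℚ.≤-trans (N-nonneg d f) (N≤1-R d f)

<½-½ : ∀ {q e} → e < 1ℚ - (q + q) → q < ½ + (- ½) * e
<½-½ {q} {e} e<1-2q = subst (_< ½ + (- ½) * e)
  (solve 1 (λ q → con ½ :+ con (- ½) :* (con 1ℚ :- (q :+ q)) := q) refl q)
  (ℚ.+-monoʳ-< ½ (ℚ.*-monoʳ-<-neg (- ½) e<1-2q))

module _ {d n t : ℕ} (f : 𝔽₂^ n → Bool) where

  <δ-^⊕ : ∀ {q} → 0ℚ < 1ℚ - (q + q) → (∀ {g} → Deg≤ d g → ∣ bias (f ^⊕ t ⊞ g) ∣ < 1ℚ - (q + q)) →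
          q < δ d (f ^⊕ t)
  <δ-^⊕ {q} 0<1-2q small = <δ (f ^⊕ t) (ℚ.<-≤-trans (<½-½ {q} 0<1-2q) (p≤p+q ½ (ℚ.nonNegative⁻¹ ½)))
    λ g deg → subst (_ <_) (sym (distance≡½-½bias (f ^⊕ t) g))
      (<½-½ (ℚ.≤-<-trans (p≤∣p∣ (bias (f ^⊕ t ⊞ g))) (small deg)))

xor-lemma : (ε₁ : ℝ) → TestBound ε₁ →
  (d n t : ℕ) .{{_ : NonZero n}} .{{_ : NonZero t}} (f : 𝔽₂^ n → Bool) →
  ½ · (1ℚ ⊖ (1ℚ ⊖ (+ 2 / 1) · (((+ 1 / 4) · ε₁) ⊓ℝ fromℚ ((+ (2 ℕ.^ d) / 4) * δ d f))) ^ (t /2^ d))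
    ≤ℝ fromℚ (δ d (f ^⊕ t))
xor-lemma ε₁ bound d n t f {q} q∈ =
  -- By definition, `q` below ½(1 - y) means 1 - 2q above y, here with y the power.
  let 0<1-2q , r , (s<ε , s<δ) , a , b , rᵃ<qᵇ , eq =
        U-power (1ℚ ⊖ (+ 2 / 1) · (((+ 1 / 4) · ε₁) ⊓ℝ fromℚ ((+ (2 ℕ.^ d) / 4) * δ d f))) (t /2^ d) q∈
      1-2q≡ = solve 1 (λ q → con 1ℚ :- q :* con (ι 2) := con 1ℚ :- (q :+ q)) refl q
      -- As `r` lies above 1 - 2 min{...}, this `s` lies below 2 min{...}, as `R-lower-bound` asks.
      s = 1ℚ - r
      s≤R = R-lower-bound ε₁ bound d f {s} (rescale s s<δ)
        (subst (L ε₁) (solve 1 (λ s → s :* con ½ :* con (ι 4) := s :+ s) refl s) s<ε)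
      1-R≤r = ℚ.≤-trans (neg-mono 1ℚ s≤R) (ℚ.≤-reflexive (p-[p-q]≡q 1ℚ r))
  in  <δ-^⊕ {d} {n} {t} f (subst (0ℚ <_) 1-2q≡ 0<1-2q) λ {g} deg → subst (∣ bias (f ^⊕ t ⊞ g) ∣ <_) 1-2q≡
        (∣bias∣< d f t deg 1 a b
          (cross-multiply 1 (suc a) (suc b) t d (trans (cong (_* ι (suc b)) (ℚ.*-identityˡ (value (t /2^ d)))) eq))
          (ℚ.≤-trans (ℚ.≤-reflexive (ℚ.*-identityʳ (1ℚ - R (suc d) f))) 1-R≤r) 0<1-2q rᵃ<qᵇ)
  where
  rescale : ∀ s → s * ½ < (+ (2 ℕ.^ d) / 4) * δ d f → s + s < ι (2 ℕ.^ d) * δ d f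
  rescale s s<δ = subst₂ _<_
    (solve 1 (λ s → s :* con ½ :* con (ι 4) := s :+ s) refl s)
    (trans (solve 3 (λ p q r → p :* q :* r := p :* r :* q) refl (+ (2 ℕ.^ d) / 4) (δ d f) (ι 4))
      (cong (_* δ d f) (/-*-ι (+ (2 ℕ.^ d)) 4)))
    (ℚ.*-monoˡ-<-pos (ι 4) s<δ)

-- Exponential decay at constant distance

bernoulli : ∀ {θ} → 0ℚ ≤ θ → 0ℚ ≤ 1ℚ - θ → ∀ k → (1ℚ - θ) ^ℚ k * (1ℚ + grid θ k) ≤ 1ℚ
bernoulli 0≤θ 0≤1-θ zero    = ℚ.≤-refl
bernoulli {θ} 0≤θ 0≤1-θ (suc k) = begin
  (1ℚ - θ) * p * (1ℚ + (g + θ))         ≡⟨ ℚ.*-comm ((1ℚ - θ) * p) (1ℚ + (g + θ)) ⟩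
  -- With g = kθ, the factor (1 + (k+1)θ)(1 - θ) equals 1 + kθ minus the nonnegative θ · (k+1)θ.
  (1ℚ + (g + θ)) * ((1ℚ - θ) * p)       ≡⟨ solve 3 (λ θ g p → (con 1ℚ :+ (g :+ θ)) :* ((con 1ℚ :- θ) :* p)
                                             := p :* (con 1ℚ :+ g) :- p :* (θ :* (g :+ θ))) refl θ g p ⟩
  p * (1ℚ + g) - p * (θ * (g + θ))      ≤⟨ neg-mono (p * (1ℚ + g)) (*-nonneg (^-nonneg k 0≤1-θ)
                                             (*-nonneg 0≤θ (+-nonneg (grid-nonneg 0≤θ k) 0≤θ))) ⟩
  p * (1ℚ + g) - 0ℚ  ≡⟨ ℚ.+-identityʳ (p * (1ℚ + g)) ⟩
  p * (1ℚ + g)       ≤⟨ bernoulli 0≤θ 0≤1-θ k ⟩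
  1ℚ                 ∎
  where
  open ℚ.≤-Reasoning
  p = (1ℚ - θ) ^ℚ k
  g = grid θ k

-- Once kθ ≥ 1, `bernoulli` gives the factor ½. The exponent is a successor because its reciprocal
-- becomes the constant in Ω.
^-halves : ∀ {θ} → 0ℚ < θ → 0ℚ ≤ 1ℚ - θ → ∃ λ k → (1ℚ - θ) ^ℚ suc k ≤ ½
^-halves {θ} 0<θ 0≤1-θ with grid-unbounded 0<θ 1ℚ
... | k , 1≤grid = k , halve-≤ (begin
  p + p                      ≡⟨ solve 1 (λ p → p :+ p := p :* (con 1ℚ :+ con 1ℚ)) refl p ⟩
  p * (1ℚ + 1ℚ)              ≤⟨ *-monoʳ (^-nonneg (suc k) 0≤1-θ) (ℚ.+-monoʳ-≤ 1ℚ (ℚ.≤-trans 1≤grid (p≤p+q (grid θ k) (ℚ.<⇒≤ 0<θ)))) ⟩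
  p * (1ℚ + grid θ (suc k))  ≤⟨ bernoulli (ℚ.<⇒≤ 0<θ) 0≤1-θ (suc k) ⟩
  ½ + ½                      ∎)
  where
  open ℚ.≤-Reasoning
  p = (1ℚ - θ) ^ℚ suc k

1≤ι2^ : ∀ d → 1ℚ ≤ ι (2 ℕ.^ d)
1≤ι2^ zero    = ℚ.≤-refl
1≤ι2^ (suc d) = subst (1ℚ ≤_) (trans (solve 1 (λ p → p :+ p := con (ι 2) :* p) refl (ι (2 ℕ.^ d))) (sym (ι-* 2 (2 ℕ.^ d))))
  (ℚ.≤-trans (1≤ι2^ d) (p≤p+q (ι (2 ℕ.^ d)) (ι-nonneg (2 ℕ.^ d))))

-- As 2^d ≥ 1, the assumption δ ≥ 1/10 keeps 2^d δ at least 1/10 for every `d`, so one θ serves all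
-- dimensions and degrees.
R-constant : (ε₁ : ℝ) → fromℚ 0ℚ <ℝ ε₁ → TestBound ε₁ → ∃ λ θ → 0ℚ < θ × 0ℚ ≤ 1ℚ - θ ×
             (∀ d {n} (f : 𝔽₂^ n → Bool) → + 1 / 10 ≤ δ d f → θ ≤ R (suc d) f)
R-constant ε₁ (p , 0<p , p∈) bound = θ , 0<θ , 0≤1-θ , λ d f δ≥ → R-lower-bound ε₁ bound d f (begin-strict
    θ + θ                     <⟨ 2θ<m ⟩
    m                         ≤⟨ ℚ.p⊓q≤q p (+ 1 / 10) ⟩
    + 1 / 10                  ≡⟨ ℚ.*-identityˡ (+ 1 / 10) ⟨
    1ℚ * (+ 1 / 10)           ≤⟨ *-monoˡ (ℚ.nonNegative⁻¹ (+ 1 / 10)) (1≤ι2^ d) ⟩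
    ι (2 ℕ.^ d) * (+ 1 / 10)  ≤⟨ *-monoʳ (ι-nonneg (2 ℕ.^ d)) δ≥ ⟩
    ι (2 ℕ.^ d) * δ d f       ∎)
    (L-down ε₁ (ℚ.<-≤-trans 2θ<m (ℚ.p⊓q≤p p (+ 1 / 10))) p∈)
  where
  open ℚ.≤-Reasoning
  m = p ⊓ (+ 1 / 10)
  -- With a quarter of `m`, 2θ is strictly below both 1/10 and `p`, a rational below ε₁.
  θ = m * (½ * ½)
  0<m : 0ℚ < m
  0<m = ⊓-glb-< 0<p (ℚ.positive⁻¹ (+ 1 / 10))
  0<θ : 0ℚ < θ
  0<θ = *-pos 0<m (ℚ.positive⁻¹ (½ * ½))
  0<2θ : 0ℚ < θ + θ
  0<2θ = ℚ.+-mono-< 0<θ 0<θ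
  2θ<m : θ + θ < m
  2θ<m = subst (θ + θ <_) (solve 1 (λ m → let θ = m :* con (½ * ½) in (θ :+ θ) :+ (θ :+ θ) := m) refl m)
    (p<p+q (θ + θ) 0<2θ)
  0≤1-θ : 0ℚ ≤ 1ℚ - θ
  0≤1-θ = neg-mono 1ℚ (begin
    θ         ≤⟨ p≤p+q θ (ℚ.<⇒≤ 0<θ) ⟩
    θ + θ     <⟨ 2θ<m ⟩
    m         ≤⟨ ℚ.p⊓q≤q p (+ 1 / 10) ⟩
    + 1 / 10  ≤⟨ p≤p+q (+ 1 / 10) (ℚ.nonNegative⁻¹ (+ 9 / 10)) ⟩
    1ℚ        ∎)

-- Proved from `∣bias∣<` directly: with K = k + 1, (1 - ρ)^K ≤ (1 - θ)^K ≤ ½, so (1 - ρ)^(t/2^d) ≤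
-- ½^(t/(K 2^d)) and c = 1/K.
exponential-decay : (ε₁ : ℝ) → fromℚ 0ℚ <ℝ ε₁ → TestBound ε₁ →
  ∃ λ (c : ℚ⁺) → ((d n t : ℕ) .{{_ : NonZero n}} .{{_ : NonZero t}} (f : 𝔽₂^ n → Bool) →
    + 1 / 10 ≤ δ d f → ½ ⊖ fromℚ ½ ^ (c *⁺ (t /2^ d)) ≤ℝ fromℚ (δ d (f ^⊕ t)))
exponential-decay ε₁ 0<ε₁ bound =
  let θ , 0<θ , 0≤1-θ , θ≤R = R-constant ε₁ 0<ε₁ bound
      k , ≤½ = ^-halves 0<θ 0≤1-θ
  in  c k , λ d n t f δ≥ → decay 0≤1-θ k ≤½ d n t f (θ≤R d f δ≥)
  where
  c : ℕ → ℚ⁺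
  c k = mkℚ⁺ (+ 1 / suc k) {{ℚ.normalize-pos 1 (suc k)}}
  decay : ∀ {θ} → 0ℚ ≤ 1ℚ - θ → ∀ k → (1ℚ - θ) ^ℚ suc k ≤ ½ →
          (d n t : ℕ) .{{_ : NonZero n}} .{{_ : NonZero t}} (f : 𝔽₂^ n → Bool) → θ ≤ R (suc d) f →
          ½ ⊖ fromℚ ½ ^ (c k *⁺ (t /2^ d)) ≤ℝ fromℚ (δ d (f ^⊕ t))
  decay {θ} 0≤1-θ k ≤½ d n t f θ≤R {q} q∈ =
    let 0<½-q , r , ½<r , a , b , rᵃ<qᵇ , eq = U-power (fromℚ ½) (c k *⁺ (t /2^ d)) q∈
        double : ½ - q + (½ - q) ≡ 1ℚ - (q + q)
        double = solve 1 (λ q → con ½ :- q :+ (con ½ :- q) := con 1ℚ :- (q :+ q)) refl q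
        -- A bias below ½ - q is more than enough: 1 - 2q is twice that, and the factor 2 is given
        -- away.
        ½-q<1-2q = subst (½ - q <_) double (p<p+q (½ - q) 0<½-q)
        ρᴷ≤r = ℚ.≤-trans (^-mono-≤ (suc k) (ℚ.≤-trans (N-nonneg d f) (N≤1-R d f)) (neg-mono 1ℚ θ≤R))
                 (ℚ.≤-trans ≤½ (ℚ.<⇒≤ ½<r))
    in  <δ-^⊕ {d} {n} {t} f (ℚ.<-trans 0<½-q ½-q<1-2q) λ deg → ℚ.<-trans
          (∣bias∣< d f t deg (suc k) a b (cross-multiply (suc k) (suc a) (suc b) t d eq) ρᴷ≤r 0<½-q rᵃ<qᵇ)
          ½-q<1-2q

theorem4 : (ε₁ : ℝ) → fromℚ 0ℚ <ℝ ε₁ → TestBound ε₁ →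
    ((d n t : ℕ) .{{_ : NonZero n}} .{{_ : NonZero t}} (f : 𝔽₂^ n → Bool) →
    ½ · (1ℚ ⊖ (1ℚ ⊖ (+ 2 / 1) · (((+ 1 / 4) · ε₁) ⊓ℝ fromℚ ((+ (2 ℕ.^ d) / 4) * δ d f))) ^ (t /2^ d))
    ≤ℝ fromℚ (δ d (f ^⊕ t)))
    ×
    (∃ λ (c : ℚ⁺) → ((d n t : ℕ) .{{_ : NonZero n}} .{{_ : NonZero t}} (f : 𝔽₂^ n → Bool) →
    + 1 / 10 ≤ δ d f →
    ½ ⊖ fromℚ ½ ^ (c *⁺ (t /2^ d)) ≤ℝ fromℚ (δ d (f ^⊕ t))))
theorem4 ε₁ 0<ε₁ bound = xor-lemma ε₁ bound , exponential-decay ε₁ 0<ε₁ bound
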